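{- Let $T$ be a tree of order at least $2$. Then $T$ is $\gamma_R$-excellent if and only if there is a labeling $S:V(T)\rightarrow\{A,B,C,D\}$ such that $(T,S)\in\mathscr{T}$. Moreover, if $(T,S)\in\mathscr{T}$, then $S_B(T)=\{x\in V^{02}(T)\mid \deg(x)=2 \text{ and } |N(x)\cap V^{02}(T)|=1\}$, $S_A(T)=V^{01}(T)$, $S_D(T)=V^{012}(T)$, and $S_C(T)=V^{02}(T)-S_B(T)$.
   Context: All graphs are finite and simple. A Roman dominating function (RDF) on a graph $G$ is a map $f:V(G)\to\{0,1,2\}$ such that every vertex $v$ with $f(v)=0$ has a neighbor $u$ with $f(u)=2$; its weight is $\sum_{v}f(v)$. The Roman domination number $\gamma_R(G)$ is the minimum weight of an RDF on $G$, and an RDF of weight $\gamma_R(G)$ is a $\gamma_R$-function. For $X\subseteq\{0,1,2\}$, $V^{X}(G)$ denotes the set of vertices $v$ with $\{f(v): f \text{ a } \gamma_R\text{ -function on } G\}=X$; we write $V^{01}(G)=V^{\{0,1\}}(G)$, $V^{02}(G)=V^{\{0,2\}}(G)$, $V^{012}(G)=V^{\{0,1,2\}}(G)$. $G$ is $\gamma_R$-excellent if for every vertex $v$ there is a $\gamma_R$-function $f$ with $f(v)\neq 0$. A labeling of a tree $T$ is a map $S:V(T)\to\{A,B,C,D\}$; $S(v)$ is the status of $v$, and $S_X(T)$ is the set of vertices of status $X$. Labeled trees used (statuses indicated): $(H_1,I^1)$: $K_2$, both vertices of status $D$. $(H_2,I^2)$: path on 4 vertices, endpoints of status $A$, the two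 inner vertices of status $B$. $(H_3,I^3)$: two adjacent vertices $c_1,c_2$ of status $C$, each adjacent to two leaves of status $A$ (6 vertices). $(H_4,I^4)$: adjacent $c_1,c_2$ of status $C$; $c_1$ adjacent to two leaves of status $A$; $c_2$ adjacent to one leaf of status $A$ and to a vertex $d$ of status $D$ which is adjacent to a leaf $d'$ of status $D$ (7 vertices). $(H_5,I^5)$: adjacent $c_1,c_2$ of status $C$; each $c_i$ is adjacent to one leaf of status $A$ and to a vertex $d_i$ of status $D$ which is adjacent to a leaf $d_i'$ of status $D$ (8 vertices). $(H_6,I^6)$: adjacent $c_1,c_2$ of status $C$; $c_1$ adjacent to two leaves of status $A$; $c_2$ adjacent to two vertices $d_1,d_2$ of status $D$, each $d_i$ adjacent to a leaf $d_i'$ of status $D$ (8 vertices). $(H_7,I^7)$: adjacent $c_1,c_2$ of status $C$; $c_1$ adjacent to one leaf of status $A$ and to a vertex $d_1$ of status $D$ adjacent to a leaf $d_1'$ of status $D$; $c_2$ adjacent to two vertices $d_2,d_3$ of status $D$, each $d_i$ adjacent to a leaf $d_i'$ of status $D$ (9 vertices). $(F_1,J^1)$: path $a,x,a'$ with statuses $A,C,A$. $(F_2,J^2)$: path $a,x,d,d'$ with statuses $A,C,D,D$. $(F_3,J^3)$: path $d',d,x,e,e'$ with statuses $D,D,C,D,D$. $(F_4,J^4)$: path $x,d,d'$ with statuses $C,D,D$. In each $F_i$, $x$ denotes the unique vertex of status $C$. Operations on a labeled tree $(T',S')$ (all existing vertices keep their statuses, and added vertices keep the statuses from the copy): $O_1$: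 add a disjoint copy of some $(F,J)\in\{(F_1,J^1),(F_2,J^2),(F_3,J^3)\}$ and the edge $ux$, where $u\in V(T')$ has status $C$ and $x$ is the status-$C$ vertex of $F$. $O_2$: add a disjoint copy of $(F_4,J^4)$ and the edge $ux$, where $u\in V(T')$ has status $D$ and $x$ is the status-$C$ vertex of $F_4$. $O_3$: take a disjoint copy of $(H_k,I^k)$, $k\in\{2,\dots,7\}$, and identify a vertex $u$ of $T'$ of status $A$ with a vertex $v$ of $H_k$ of status $A$; the identified vertex has status $A$. $O_4$: take a disjoint copy of $(H_k,I^k)$, $k\in\{3,4,6\}$, and identify a vertex $u$ of $T'$ of status $D$ with a vertex $v$ of $H_k$ of status $A$; the identified vertex has status $D$. $\mathscr{T}$ is the family of labeled trees $(T,S)$ for which there is a sequence $(T^1,S^1),\dots,(T^j,S^j)$, $j\ge1$, with $(T^1,S^1)$ (a copy of) one of $(H_1,I^1),\dots,(H_5,I^5)$, $(T^j,S^j)=(T,S)$, and each $(T^{i+1},S^{i+1})$ obtained from $(T^i,S^i)$ by one of $O_1,O_2,O_3,O_4$. -}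

module Defs where

open import Data.Nat using (ℕ; zero; suc; _+_; _≤_)
open import Data.Fin using (Fin; zero; suc; #_; splitAt; punchIn; toℕ; _≟_)
open import Data.Bool using (Bool; true; false; T; _∧_; _∨_; if_then_else_)
open import Data.List using (List; []; _∷_; _++_; length; map; allFin)
open import Data.Nat.ListAction using (sum)
open import Data.Bool.ListAction using (any)
open import Data.List.Relation.Unary.Linked using (Linked)
open import Data.List.Relation.Unary.Unique.Propositional using (Unique)
open import Data.Vec using (Vec; lookup) renaming ([] to []ᵛ; _∷_ to _∷ᵛ_)
open import Data.Product using (Σ; ∃; _×_; _,_)
open import Data.Sum using (_⊎_; inj₁; inj₂)
open import Relation.Nullary using (¬_; ⌊_⌋)
open import Relation.Binary.PropositionalEquality using (_≡_)
open import Relation.Binary.Construct.Closure.ReflexiveTransitive using (Star)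

Adj : ℕ → Set
Adj n = Fin n → Fin n → Bool

Edge : ∀ {n} → Adj n → Fin n → Fin n → Set
Edge adj u v = T (adj u v)

IsSimple : ∀ {n} → Adj n → Set
IsSimple {n} adj = (∀ u v → adj u v ≡ adj v u) × (∀ v → adj v v ≡ false)

Connected : ∀ {n} → Adj n → Set
Connected {n} adj = ∀ (u v : Fin n) → Star (Edge adj) u v

HasCycle : ∀ {n} → Adj n → Set
HasCycle {n} adj = Σ (Fin n) λ x → Σ (List (Fin n)) λ xs →
  (2 ≤ length xs) × Unique (x ∷ xs) × Linked (Edge adj) (x ∷ xs ++ x ∷ [])

Acyclic : ∀ {n} → Adj n → Set
Acyclic adj = ¬ HasCycle adj

IsTree : ∀ {n} → Adj n → Set
IsTree adj = IsSimple adj × Connected adj × Acyclic adj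

deg : ∀ {n} → Adj n → Fin n → ℕ
deg {n} adj x = sum (map (λ u → if adj x u then 1 else 0) (allFin n))

RF : ℕ → Set
RF n = Fin n → Fin 3

weight : ∀ {n} → RF n → ℕ
weight {n} f = sum (map (λ v → toℕ (f v)) (allFin n))

IsRDF : ∀ {n} → Adj n → RF n → Set
IsRDF {n} adj f = ∀ v → f v ≡ # 0 → ∃ λ u → Edge adj v u × f u ≡ # 2

IsγR : ∀ {n} → Adj n → RF n → Set
IsγR {n} adj f = IsRDF adj f × (∀ g → IsRDF adj g → weight f ≤ weight g)

Attains : ∀ {n} → Adj n → Fin n → Fin 3 → Set
Attains adj v k = ∃ λ f → IsγR adj f × f v ≡ k

V01 V02 V012 : ∀ {n} → Adj n → Fin n → Set
V01 adj v = Attains adj v (# 0) × Attains adj v (# 1) × ¬ Attains adj v (# 2)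
V02 adj v = Attains adj v (# 0) × ¬ Attains adj v (# 1) × Attains adj v (# 2)
V012 adj v = Attains adj v (# 0) × Attains adj v (# 1) × Attains adj v (# 2)

Excellent : ∀ {n} → Adj n → Set
Excellent {n} adj = ∀ v → ∃ λ f → IsγR adj f × ¬ (f v ≡ # 0)

data Status : Set where
  A B C D : Status

record LTree : Set where
  constructor mk
  field
    size : ℕ
    adj  : Adj size
    lab  : Fin size → Status
open LTree public

fromEdges : ∀ {n} → List (Fin n × Fin n) → Adj n
fromEdges es i j = any (λ { (a , b) → (⌊ a ≟ i ⌋ ∧ ⌊ b ≟ j ⌋) ∨ (⌊ a ≟ j ⌋ ∧ ⌊ b ≟ i ⌋) }) es

data HName : Set where
  h1 h2 h3 h4 h5 h6 h7 : HName

H : HName → LTree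
H h1 = mk 2 (fromEdges ((# 0 , # 1) ∷ [])) (lookup (D ∷ᵛ D ∷ᵛ []ᵛ))
H h2 = mk 4 (fromEdges ((# 0 , # 1) ∷ (# 1 , # 2) ∷ (# 2 , # 3) ∷ []))
            (lookup (A ∷ᵛ B ∷ᵛ B ∷ᵛ A ∷ᵛ []ᵛ))
H h3 = mk 6 (fromEdges ((# 0 , # 1) ∷ (# 0 , # 2) ∷ (# 0 , # 3) ∷ (# 1 , # 4) ∷ (# 1 , # 5) ∷ []))
            (lookup (C ∷ᵛ C ∷ᵛ A ∷ᵛ A ∷ᵛ A ∷ᵛ A ∷ᵛ []ᵛ))
H h4 = mk 7 (fromEdges ((# 0 , # 1) ∷ (# 0 , # 2) ∷ (# 0 , # 3) ∷ (# 1 , # 4) ∷ (# 1 , # 5)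
                        ∷ (# 5 , # 6) ∷ []))
            (lookup (C ∷ᵛ C ∷ᵛ A ∷ᵛ A ∷ᵛ A ∷ᵛ D ∷ᵛ D ∷ᵛ []ᵛ))
H h5 = mk 8 (fromEdges ((# 0 , # 1) ∷ (# 0 , # 2) ∷ (# 0 , # 3) ∷ (# 3 , # 4)
                        ∷ (# 1 , # 5) ∷ (# 1 , # 6) ∷ (# 6 , # 7) ∷ []))
            (lookup (C ∷ᵛ C ∷ᵛ A ∷ᵛ D ∷ᵛ D ∷ᵛ A ∷ᵛ D ∷ᵛ D ∷ᵛ []ᵛ))
H h6 = mk 8 (fromEdges ((# 0 , # 1) ∷ (# 0 , # 2) ∷ (# 0 , # 3) ∷ (# 1 , # 4) ∷ (# 4 , # 5)
                        ∷ (# 1 , # 6) ∷ (# 6 , # 7) ∷ []))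
            (lookup (C ∷ᵛ C ∷ᵛ A ∷ᵛ A ∷ᵛ D ∷ᵛ D ∷ᵛ D ∷ᵛ D ∷ᵛ []ᵛ))
H h7 = mk 9 (fromEdges ((# 0 , # 1) ∷ (# 0 , # 2) ∷ (# 0 , # 3) ∷ (# 3 , # 4)
                        ∷ (# 1 , # 5) ∷ (# 5 , # 6) ∷ (# 1 , # 7) ∷ (# 7 , # 8) ∷ []))
            (lookup (C ∷ᵛ C ∷ᵛ A ∷ᵛ D ∷ᵛ D ∷ᵛ D ∷ᵛ D ∷ᵛ D ∷ᵛ D ∷ᵛ []ᵛ))

data FName : Set where
  f1 f2 f3 f4 : FName

F : FName → LTree
F f1 = mk 3 (fromEdges ((# 0 , # 1) ∷ (# 1 , # 2) ∷ [])) (lookup (A ∷ᵛ C ∷ᵛ A ∷ᵛ []ᵛ))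
F f2 = mk 4 (fromEdges ((# 0 , # 1) ∷ (# 1 , # 2) ∷ (# 2 , # 3) ∷ []))
            (lookup (A ∷ᵛ C ∷ᵛ D ∷ᵛ D ∷ᵛ []ᵛ))
F f3 = mk 5 (fromEdges ((# 0 , # 1) ∷ (# 1 , # 2) ∷ (# 2 , # 3) ∷ (# 3 , # 4) ∷ []))
            (lookup (D ∷ᵛ D ∷ᵛ C ∷ᵛ D ∷ᵛ D ∷ᵛ []ᵛ))
F f4 = mk 3 (fromEdges ((# 0 , # 1) ∷ (# 1 , # 2) ∷ [])) (lookup (C ∷ᵛ D ∷ᵛ D ∷ᵛ []ᵛ))

xOf : (k : FName) → Fin (size (F k))
xOf f1 = # 1
xOf f2 = # 1
xOf f3 = # 2
xOf f4 = # 0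

combine : ∀ n m → Adj n → Adj m → (Fin n → Fin m → Bool) → Adj (n + m)
combine n m a b cross i j with splitAt n i | splitAt n j
... | inj₁ x | inj₁ y = a x y
... | inj₂ x | inj₂ y = b x y
... | inj₁ x | inj₂ y = cross x y
... | inj₂ x | inj₁ y = cross y x

combineLab : ∀ n m → (Fin n → Status) → (Fin m → Status) → Fin (n + m) → Status
combineLab n m s t i with splitAt n i
... | inj₁ x = s x
... | inj₂ y = t y

attach : (G : LTree) → Fin (size G) → (K : LTree) → Fin (size K) → LTree
attach G u K x = mk (size G + size K)
  (combine (size G) (size K) (adj G) (adj K) (λ a b → ⌊ a ≟ u ⌋ ∧ ⌊ b ≟ x ⌋))
  (combineLab (size G) (size K) (lab G) (lab K))

-- identify u ∈ G with v ∈ K (the identified vertex is u and keeps u's status)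
glueAux : (G : LTree) → Fin (size G) → (s : ℕ) → Adj s → (Fin s → Status) → Fin s → LTree
glueAux G u (suc m) b t v = mk (size G + m)
  (combine (size G) m (adj G) (λ x y → b (punchIn v x) (punchIn v y))
     (λ a y → ⌊ a ≟ u ⌋ ∧ b v (punchIn v y)))
  (combineLab (size G) m (lab G) (λ y → t (punchIn v y)))

glue : (G : LTree) → Fin (size G) → (K : LTree) → Fin (size K) → LTree
glue G u K v = glueAux G u (size K) (adj K) (lab K) v

data Start : HName → Set where
  s1 : Start h1
  s2 : Start h2
  s3 : Start h3
  s4 : Start h4
  s5 : Start h5

data O1ok : FName → Set where
  o1 : O1ok f1
  o2 : O1ok f2
  o3 : O1ok f3

data O3ok : HName → Set where
  k2 : O3ok h2
  k3 : O3ok h3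
  k4 : O3ok h4
  k5 : O3ok h5
  k6 : O3ok h6
  k7 : O3ok h7

data O4ok : HName → Set where
  k3 : O4ok h3
  k4 : O4ok h4
  k6 : O4ok h6

-- canonical representatives of the labeled trees obtainable by the construction
data Built : LTree → Set where
  start : ∀ k → Start k → Built (H k)
  op1 : ∀ {G} → Built G → (u : Fin (size G)) → lab G u ≡ C →
        ∀ k → O1ok k → Built (attach G u (F k) (xOf k))
  op2 : ∀ {G} → Built G → (u : Fin (size G)) → lab G u ≡ D →
        Built (attach G u (F f4) (xOf f4))
  op3 : ∀ {G} → Built G → (u : Fin (size G)) → lab G u ≡ A →
        ∀ k → O3ok k → (v : Fin (size (H k))) → lab (H k) v ≡ A →
        Built (glue G u (H k) v)
  op4 : ∀ {G} → Built G → (u : Fin (size G)) → lab G u ≡ D →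
        ∀ k → O4ok k → (v : Fin (size (H k))) → lab (H k) v ≡ A →
        Built (glue G u (H k) v)

record LIso (G K : LTree) : Set where
  field
    to      : Fin (size G) → Fin (size K)
    from    : Fin (size K) → Fin (size G)
    from∘to : ∀ i → from (to i) ≡ i
    to∘from : ∀ j → to (from j) ≡ j
    adj-pres : ∀ i j → adj K (to i) (to j) ≡ adj G i j
    lab-pres : ∀ i → lab K (to i) ≡ lab G i

-- (T , S) ∈ 𝒯  (membership up to isomorphism: "a copy of")
InFam : LTree → Set
InFam G = Σ LTree λ K → Built K × LIso K G

OneV02Nbr : ∀ {n} → Adj n → Fin n → Set
OneV02Nbr adj x = ∃ λ u → Edge adj x u × V02 adj u ×
  (∀ w → Edge adj x w → V02 adj w → w ≡ u)

SB-set : ∀ {n} → Adj n → Fin n → Set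
SB-set adj x = V02 adj x × deg adj x ≡ 2 × OneV02Nbr adj x

{-# OPTIONS --safe #-}
module Submission where

-- From the family to the statuses: a labelled tree of the family has a number W such that every function
-- dominating all vertices of status A, B, D has weight at least W, with equality only if its values lie in
-- {0,1} on A, in {0,2} on B and C; and each of these values, and each value on D, is attained by a Roman
-- dominating function of weight W. This survives every operation because the new part is joined to the old
-- tree at a single vertex whose status is known. So W = γ_R, and the statuses are the sets V⁰¹, V⁰², V⁰¹².
-- B and C are told apart by their neighbours: a B-vertex has one neighbour in A and one in B, a C-vertex has
-- two neighbours in A ∪ D.
--
-- From excellence to the family: cut a tree at an edge uv. Up to a constant, the minimum weights on the side
-- of u for the possible states of u have one of six forms, the message from u to v. If some γ_R-function is
-- nonzero at u and some at v, only few pairs of messages remain, and these force the local structure around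
-- every vertex: an A-vertex has neighbours in B ∪ C, a D-vertex has one neighbour in D and the others in C,
-- a B-vertex is as above, and a C-vertex has two neighbours in A ∪ D and the others in C. A tree with this
-- structure is grown outwards by the operations, from an A-vertex or from an edge between D-vertices.

open import Defs
open import Data.Nat using (ℕ; _≤_)
open import Data.Fin using (Fin)
open import Data.Product using (Σ; _×_)
open import Relation.Nullary using (¬_)
open import Relation.Binary.PropositionalEquality using (_≡_)
open import Function.Bundles using (_⇔_)

open import Data.Bool using (Bool; true; false; T; _∧_; if_then_else_) renaming (_≟_ to _≟B_)
open import Data.Bool.Properties using (∧-comm; ∧-zeroʳ; T-∧; T-≡; T?)
open import Data.Fin using (zero; suc; #_; toℕ; join; punchIn; punchOut; splitAt; _↑ˡ_; _↑ʳ_) renaming (_≟_ to _≟F_)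
open import Data.Fin.Permutation using (permutation)
import Data.Fin.Properties as Fin
open import Data.List using (List; []; _∷_; allFin; length) renaming (_++_ to _++ₗ_; map to mapₗ; tabulate to tabulateₗ)
open import Data.List.Membership.Propositional using (_∈_; find)
open import Data.List.Membership.Propositional.Properties using (∈-map⁻)
open import Data.List.Properties using (length-map; map-tabulate)
open import Data.List.Relation.Unary.All using (All; all?)
import Data.List.Relation.Unary.All as All
import Data.List.Relation.Unary.All.Properties as All
open import Data.List.Relation.Unary.AllPairs using ([]; _∷_)
open import Data.List.Relation.Unary.Any using (Any; any?)
open import Data.List.Relation.Unary.Linked using (Linked; [-]; _∷_)
open import Data.List.Relation.Unary.Unique.Propositional using (Unique)
import Data.List.Relation.Unary.Unique.Propositional.Properties as Unique
open import Data.Nat using (zero; suc; _+_; _∸_; _⊓_; _<_; z≤n; s≤s; s≤s⁻¹; _≤?_) renaming (_≟_ to _≟ℕ_)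
import Data.Nat.ListAction as ListAction
import Data.Nat.Properties as ℕ
open import Data.Product using (∃; _,_; proj₁; proj₂)
open import Data.Sum using (_⊎_; inj₁; inj₂; [_,_]′)
import Data.Sum as Sum
open import Data.Sum.Properties using (inj₁-injective; inj₂-injective)
open import Data.Unit using (⊤; tt)
open import Data.Vec using (Vec; []; _∷_; lookup; tabulate)
open import Data.Vec.Functional using (_++_; updateAt; insertAt)
open import Data.Vec.Functional.Properties using (updateAt-updates; updateAt-minimal; insertAt-lookup; insertAt-punchIn)
open import Data.Vec.Properties using (lookup∘tabulate)
open import Function using (_∘_; const; Equivalence; mk⇔)
open import Relation.Binary.Construct.Closure.ReflexiveTransitive using (Star; _◅_) renaming (ε to nil)
open import Relation.Binary.PropositionalEquality using (_≢_; _≗_; refl; sym; trans; cong; cong₂; subst; module ≡-Reasoning)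
open import Relation.Nullary using (Dec; yes; no; does; contradiction; ⌊_⌋; True; toWitness; fromWitness; map′; ¬?; _×-dec_; _⊎-dec_; _→-dec_)

open import Algebra.Properties.CommutativeMonoid.Sum ℕ.+-0-commutativeMonoid using (sum; sum-cong-≗; sum-remove; sum-permute; ∑-distrib-+)

-- Sums and weights

-- In the first direction the obstacle is that a vertex at the junction may be dominated from the
-- other side only. The value 1 mediates: a vertex of value 1 neither dominates nor needs a
-- dominator, so raising a 0 to 1 or lowering a 1 to 0 separates or joins the two sides at the price
-- of one unit. In the second direction six messages suffice because a missing dominator of the root
-- can be bought for one unit, root value 2 costs at most two units more than an undominated 0, and
-- the amount by which a 2 is cheaper than a 0 never matters. The pairs left at an edge of an
-- excellent tree are `tL`-`tL` (edge D-D), `tR`-`tR` (edge B-B), `tL`-`tP` (an A-vertex with a B-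
-- or C-vertex), `tR`-`tP` (edge D-C), and any two of `tN₀`, `tN₁` (edge C-C). One message does not
-- determine the status: A- and D-vertices can both send `tL`, B- and D-vertices can both send `tR`.
-- The growth therefore looks at both ends of an edge, and separates B from C by the degree.

sum-allFin : ∀ {n} (f : Fin n → ℕ) → ListAction.sum (mapₗ f (allFin n)) ≡ sum f
sum-allFin f = trans (cong ListAction.sum (map-tabulate (λ i → i) f)) (go f)
  where
  go : ∀ {n} (f : Fin n → ℕ) → ListAction.sum (tabulateₗ f) ≡ sum f
  go {zero}  f = refl
  go {suc n} f = cong (f zero +_) (go (f ∘ suc))

sum-splitAt : ∀ n {m} (f : Fin (n + m) → ℕ) → sum f ≡ sum (λ i → f (i ↑ˡ m)) + sum (λ j → f (n ↑ʳ j))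
sum-splitAt zero    f = refl
sum-splitAt (suc n) f = trans (cong (f zero +_) (sum-splitAt n (f ∘ suc))) (sym (ℕ.+-assoc (f zero) _ _))

weight-sum : ∀ {n} (f : RF n) → weight f ≡ sum (toℕ ∘ f)
weight-sum f = sum-allFin (toℕ ∘ f)

weight-cong : ∀ {n} {f g : RF n} → f ≗ g → weight f ≡ weight g
weight-cong {f = f} {g} e = trans (weight-sum f) (trans (sum-cong-≗ (cong toℕ ∘ e)) (sym (weight-sum g)))

weight-splitAt : ∀ n {m} (f : RF (n + m)) → weight f ≡ weight (λ i → f (i ↑ˡ m)) + weight (λ j → f (n ↑ʳ j))
weight-splitAt n {m} f = begin
  weight f                                                           ≡⟨ weight-sum f ⟩
  sum (toℕ ∘ f)                                                      ≡⟨ sum-splitAt n (toℕ ∘ f) ⟩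
  sum (λ i → toℕ (f (i ↑ˡ m))) + sum (λ j → toℕ (f (n ↑ʳ j)))  ≡⟨ cong₂ _+_ (weight-sum (λ i → f (i ↑ˡ m))) (weight-sum (λ j → f (n ↑ʳ j))) ⟨
  weight (λ i → f (i ↑ˡ m)) + weight (λ j → f (n ↑ʳ j))            ∎
  where open ≡-Reasoning

weight-updateAt : ∀ {n} (f : RF n) u k → weight (updateAt f u (const k)) + toℕ (f u) ≡ weight f + toℕ k
weight-updateAt f u k = begin
  weight (updateAt f u (const k)) + toℕ (f u)     ≡⟨ cong (_+ toℕ (f u)) (weight-sum (updateAt f u (const k))) ⟩
  sum (toℕ ∘ updateAt f u (const k)) + toℕ (f u)  ≡⟨ go f u ⟩
  sum (toℕ ∘ f) + toℕ k                           ≡⟨ cong (_+ toℕ k) (weight-sum f) ⟨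
  weight f + toℕ k                                ∎
  where
  open ≡-Reasoning
  +-right-comm : ∀ a b c → a + b + c ≡ a + c + b
  +-right-comm a b c = trans (ℕ.+-assoc a b c) (trans (cong (a +_) (ℕ.+-comm b c)) (sym (ℕ.+-assoc a c b)))
  go : ∀ {n} (f : RF n) u → sum (toℕ ∘ updateAt f u (const k)) + toℕ (f u) ≡ sum (toℕ ∘ f) + toℕ k
  go {suc n} f zero = begin
    toℕ k + s + toℕ (f zero)    ≡⟨ cong (_+ toℕ (f zero)) (ℕ.+-comm (toℕ k) s) ⟩
    s + toℕ k + toℕ (f zero)    ≡⟨ ℕ.+-comm (s + toℕ k) _ ⟩
    toℕ (f zero) + (s + toℕ k)  ≡⟨ ℕ.+-assoc (toℕ (f zero)) s (toℕ k) ⟨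
    toℕ (f zero) + s + toℕ k    ∎
    where s = sum (λ i → toℕ (f (suc i)))
  go {suc n} f (suc u) = begin
    toℕ (f zero) + s′ + toℕ (f (suc u))    ≡⟨ ℕ.+-assoc (toℕ (f zero)) s′ _ ⟩
    toℕ (f zero) + (s′ + toℕ (f (suc u)))  ≡⟨ cong (toℕ (f zero) +_) (go (f ∘ suc) u) ⟩
    toℕ (f zero) + (s + toℕ k)             ≡⟨ ℕ.+-assoc (toℕ (f zero)) s (toℕ k) ⟨
    toℕ (f zero) + s + toℕ k               ∎
    where
    s = sum (λ i → toℕ (f (suc i)))
    s′ = sum (toℕ ∘ updateAt (f ∘ suc) u (const k))

weight-remove : ∀ {m} (f : RF (suc m)) v → weight f ≡ toℕ (f v) + weight (λ y → f (punchIn v y))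
weight-remove f v = trans (weight-sum f)
  (trans (sum-remove {i = v} (toℕ ∘ f)) (cong (toℕ (f v) +_) (sym (weight-sum (λ y → f (punchIn v y))))))

weight-insertAt : ∀ {m} (g : RF m) v k → weight (insertAt g v k) ≡ toℕ k + weight g
weight-insertAt g v k = trans (weight-remove (insertAt g v k) v)
  (cong₂ (λ x w → toℕ x + w) (insertAt-lookup g v k) (weight-cong (insertAt-punchIn g v k)))

data Split (n : ℕ) {m : ℕ} : Fin (n + m) → Set where
  left  : ∀ i → Split n (i ↑ˡ m)
  right : ∀ j → Split n (n ↑ʳ j)

split : ∀ n {m} (i : Fin (n + m)) → Split n i
split n {m} i with splitAt n i | Fin.join-splitAt n m i
... | inj₁ a | refl = left a
... | inj₂ b | refl = right b

module _ {n m : ℕ} (f : RF n) (g : RF m) where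
  ++-left : ∀ i → (f ++ g) (i ↑ˡ m) ≡ f i
  ++-left i rewrite Fin.splitAt-↑ˡ n i m = refl

  ++-right : ∀ j → (f ++ g) (n ↑ʳ j) ≡ g j
  ++-right j rewrite Fin.splitAt-↑ʳ n m j = refl

  weight-++ : weight (f ++ g) ≡ weight f + weight g
  weight-++ = trans (weight-splitAt n (f ++ g)) (cong₂ _+_ (weight-cong ++-left) (weight-cong ++-right))

module _ {n m : ℕ} (a : Adj n) (b : Adj m) (x : Fin n → Fin m → Bool) where
  combine-ll : ∀ i j → combine n m a b x (i ↑ˡ m) (j ↑ˡ m) ≡ a i j
  combine-ll i j rewrite Fin.splitAt-↑ˡ n i m | Fin.splitAt-↑ˡ n j m = refl

  combine-lr : ∀ i j → combine n m a b x (i ↑ˡ m) (n ↑ʳ j) ≡ x i j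
  combine-lr i j rewrite Fin.splitAt-↑ˡ n i m | Fin.splitAt-↑ʳ n m j = refl

  combine-rl : ∀ i j → combine n m a b x (n ↑ʳ i) (j ↑ˡ m) ≡ x j i
  combine-rl i j rewrite Fin.splitAt-↑ʳ n m i | Fin.splitAt-↑ˡ n j m = refl

  combine-rr : ∀ i j → combine n m a b x (n ↑ʳ i) (n ↑ʳ j) ≡ b i j
  combine-rr i j rewrite Fin.splitAt-↑ʳ n m i | Fin.splitAt-↑ʳ n m j = refl

module _ {n m : ℕ} (s : Fin n → Status) (t : Fin m → Status) where
  combineLab-l : ∀ i → combineLab n m s t (i ↑ˡ m) ≡ s i
  combineLab-l i rewrite Fin.splitAt-↑ˡ n i m = refl

  combineLab-r : ∀ j → combineLab n m s t (n ↑ʳ j) ≡ t j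
  combineLab-r j rewrite Fin.splitAt-↑ʳ n m j = refl

-- Rigid labelled trees: lower bound, attained values, local structure

data Allowed : Status → Fin 3 → Set where
  A0 : Allowed A (# 0)
  A1 : Allowed A (# 1)
  B0 : Allowed B (# 0)
  B2 : Allowed B (# 2)
  C0 : Allowed C (# 0)
  C2 : Allowed C (# 2)
  D* : ∀ {k} → Allowed D k

Dominated : (X : LTree) → RF (size X) → Fin (size X) → Set
Dominated X f v = ∃ λ u → Edge (adj X) v u × f u ≡ # 2

-- Domination of the C-vertices is never needed for the lower bound; dropping it makes the
-- bound restrict to the two sides of an edge between C-vertices.
Admissible : (X : LTree) → RF (size X) → Set
Admissible X f = ∀ v → lab X v ≢ C → f v ≡ # 0 → Dominated X f v

Compatible : (X : LTree) → RF (size X) → Set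
Compatible X f = ∀ v → Allowed (lab X v) (f v)

LowerBound : LTree → ℕ → Set
LowerBound X W = ∀ f → Admissible X f → W ≤ weight f × (weight f ≡ W → Compatible X f)

AttainedBy : (X : LTree) → ℕ → Fin (size X) → Fin 3 → Set
AttainedBy X W v k = ∃ λ f → IsRDF (adj X) f × Compatible X f × weight f ≡ W × f v ≡ k

AllAttained : LTree → ℕ → Set
AllAttained X W = ∀ v k → Allowed (lab X v) k → AttainedBy X W v k

data Strong : Status → Set where
  strongB : Strong B
  strongC : Strong C

-- The statuses for which the value 1 is allowed. A vertex of weak status with value 1 can be
-- lowered to 0 once something outside dominates it, which saves one unit.
data Weak : Status → Set where
  weakA : Weak A
  weakD : Weak D

TwoWeakNeighbours : (X : LTree) → Fin (size X) → Set
TwoWeakNeighbours X v = ∃ λ a → ∃ λ b → a ≢ b ×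
  (Weak (lab X a) × Weak (lab X b) × Edge (adj X) v a × Edge (adj X) v b)

-- Neighbours are recorded only as weak or strong, that is, as lying outside or inside V⁰². This is
-- all that the description by degrees uses, and it is not affected when `O₄` turns an A-neighbour
-- into a D-neighbour.
BStructure CStructure : LTree → Set
BStructure X = ∀ v → lab X v ≡ B → ∃ λ a → ∃ λ b →
  Weak (lab X a) × Strong (lab X b) × Edge (adj X) v a × Edge (adj X) v b ×
  (∀ w → Edge (adj X) v w → w ≡ a ⊎ w ≡ b)
CStructure X = ∀ v → lab X v ≡ C → TwoWeakNeighbours X v

record Rigid (X : LTree) (W : ℕ) : Set where
  field
    lower : LowerBound X W
    attained : AllAttained X W
    bStructure : BStructure X
    cStructure : CStructure X

-- Transfers tightness of a total weight to both sides, so that the equality clauses of the two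
-- lower bounds apply.
≡-split : ∀ {a b c d} → a ≤ c → b ≤ d → c + d ≡ a + b → c ≡ a × d ≡ b
≡-split {a} {b} {c} {d} p q e with ℕ.m≤n⇒m<n∨m≡n p | ℕ.m≤n⇒m<n∨m≡n q
... | inj₂ refl | inj₂ refl = refl , refl
... | inj₁ a<c  | _         = contradiction (sym e) (ℕ.<⇒≢ (ℕ.+-mono-<-≤ a<c q))
... | inj₂ refl | inj₁ b<d  = contradiction (sym e) (ℕ.<⇒≢ (ℕ.+-mono-≤-< p b<d))

edge : ∀ {n} {adj : Adj n} {i j b} → adj i j ≡ b → T b → Edge adj i j
edge e = subst T (sym e)

unedge : ∀ {n} {adj : Adj n} {i j b} → adj i j ≡ b → Edge adj i j → T b
unedge e = subst T e

-- Attaching and gluing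

-- Both attach and glue join G to a graph on Fin m by edges from the single vertex u of G.
module Hook (G : LTree) (u : Fin (size G)) {m : ℕ} (b : Adj m) (t : Fin m → Status) (h : Fin m → Bool) where
  n : ℕ
  n = size G

  X : LTree
  X = mk (n + m) (combine n m (adj G) b (λ a y → ⌊ a ≟F u ⌋ ∧ h y)) (combineLab n m (lab G) t)

  K : LTree
  K = mk m b t

  lab-l : ∀ i → lab X (i ↑ˡ m) ≡ lab G i
  lab-l = combineLab-l (lab G) t

  lab-r : ∀ j → lab X (n ↑ʳ j) ≡ t j
  lab-r = combineLab-r (lab G) t

  private
    x : Fin n → Fin m → Bool
    x a y = ⌊ a ≟F u ⌋ ∧ h y

  edge-ll : ∀ {i j} → Edge (adj G) i j → Edge (adj X) (i ↑ˡ m) (j ↑ˡ m)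
  edge-ll {i} {j} = edge {adj = adj X} (combine-ll (adj G) b x i j)

  edge-rr : ∀ {i j} → Edge b i j → Edge (adj X) (n ↑ʳ i) (n ↑ʳ j)
  edge-rr {i} {j} = edge {adj = adj X} (combine-rr (adj G) b x i j)

  edge-lr : ∀ {j} → T (h j) → Edge (adj X) (u ↑ˡ m) (n ↑ʳ j)
  edge-lr {j} p = edge {adj = adj X} (combine-lr (adj G) b x u j) (Equivalence.from T-∧ (fromWitness refl , p))

  edge-rl : ∀ {j} → T (h j) → Edge (adj X) (n ↑ʳ j) (u ↑ˡ m)
  edge-rl {j} p = edge {adj = adj X} (combine-rl (adj G) b x j u) (Equivalence.from T-∧ (fromWitness refl , p))

  unedge-ll : ∀ {i j} → Edge (adj X) (i ↑ˡ m) (j ↑ˡ m) → Edge (adj G) i j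
  unedge-ll {i} {j} = unedge {adj = adj X} (combine-ll (adj G) b x i j)

  unedge-rr : ∀ {i j} → Edge (adj X) (n ↑ʳ i) (n ↑ʳ j) → Edge b i j
  unedge-rr {i} {j} = unedge {adj = adj X} (combine-rr (adj G) b x i j)

  unedge-lr : ∀ {i j} → Edge (adj X) (i ↑ˡ m) (n ↑ʳ j) → i ≡ u × T (h j)
  unedge-lr {i} {j} e with Equivalence.to T-∧ (unedge {adj = adj X} (combine-lr (adj G) b x i j) e)
  ... | p , q = toWitness p , q

  unedge-rl : ∀ {i j} → Edge (adj X) (n ↑ʳ j) (i ↑ˡ m) → i ≡ u × T (h j)
  unedge-rl {i} {j} e with Equivalence.to T-∧ (unedge {adj = adj X} (combine-rl (adj G) b x j i) e)
  ... | p , q = toWitness p , q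

  dominated-l : ∀ {f v} → Dominated X f (v ↑ˡ m) →
    Dominated G (λ i → f (i ↑ˡ m)) v ⊎ (v ≡ u × ∃ λ y → T (h y) × f (n ↑ʳ y) ≡ # 2)
  dominated-l (w , e , p) with split n w
  ... | left i  = inj₁ (i , unedge-ll e , p)
  ... | right j = inj₂ (proj₁ (unedge-lr e) , j , proj₂ (unedge-lr e) , p)

  dominated-r : ∀ {f y} → Dominated X f (n ↑ʳ y) →
    Dominated K (λ j → f (n ↑ʳ j)) y ⊎ (T (h y) × f (u ↑ˡ m) ≡ # 2)
  dominated-r {f} (w , e , p) with split n w
  ... | right j = inj₁ (j , unedge-rr e , p)
  ... | left i  = inj₂ (proj₂ (unedge-rl e) , trans (cong (λ z → f (z ↑ˡ m)) (sym (proj₁ (unedge-rl e)))) p)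

  compatible : ∀ f → Compatible G (λ i → f (i ↑ˡ m)) → Compatible K (λ j → f (n ↑ʳ j)) → Compatible X f
  compatible f p q w with split n w
  ... | left i  = subst (λ s → Allowed s _) (sym (lab-l i)) (p i)
  ... | right j = subst (λ s → Allowed s _) (sym (lab-r j)) (q j)

  admissible-l : ∀ {f} → Admissible X f → ∀ v → lab G v ≢ C → f (v ↑ˡ m) ≡ # 0 →
    Dominated G (λ i → f (i ↑ˡ m)) v ⊎ (v ≡ u × ∃ λ y → T (h y) × f (n ↑ʳ y) ≡ # 2)
  admissible-l {f} adm v nc z = dominated-l (adm (v ↑ˡ m) (nc ∘ trans (sym (lab-l v))) z)

  admissible-r : ∀ {f} → Admissible X f → ∀ y → t y ≢ C → f (n ↑ʳ y) ≡ # 0 →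
    Dominated K (λ j → f (n ↑ʳ j)) y ⊎ (T (h y) × f (u ↑ˡ m) ≡ # 2)
  admissible-r {f} adm y nc z = dominated-r (adm (n ↑ʳ y) (nc ∘ trans (sym (lab-r y))) z)

  isRDF-++ : ∀ (f : RF n) (g : RF m) →
    (∀ i → f i ≡ # 0 → Dominated G f i ⊎ (i ≡ u × ∃ λ y → T (h y) × g y ≡ # 2)) →
    (∀ j → g j ≡ # 0 → Dominated K g j ⊎ (T (h j) × f u ≡ # 2)) →
    IsRDF (adj X) (f ++ g)
  isRDF-++ f g p q w z with split n w
  isRDF-++ f g p q _ z | left i with p i (trans (sym (++-left f g i)) z)
  ... | inj₁ (k , e , r)              = k ↑ˡ m , edge-ll e , trans (++-left f g k) r
  ... | inj₂ (refl , y , e , r)       = n ↑ʳ y , edge-lr e , trans (++-right f g y) r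
  isRDF-++ f g p q _ z | right j with q j (trans (sym (++-right f g j)) z)
  ... | inj₁ (k , e , r) = n ↑ʳ k , edge-rr e , trans (++-right f g k) r
  ... | inj₂ (e , r)     = u ↑ˡ m , edge-rl e , trans (++-left f g u) r

  compatible-++ : ∀ f g → Compatible G f → Compatible K g → Compatible X (f ++ g)
  compatible-++ f g p q = compatible (f ++ g)
    (λ i → subst (Allowed _) (sym (++-left f g i)) (p i))
    (λ j → subst (Allowed _) (sym (++-right f g j)) (q j))

  -- Only `u` acquires neighbours, so the B-vertices of `G` keep exactly their two as soon as `u` is
  -- not one of them.
  bStructure : lab G u ≢ B → BStructure G →
    (∀ y → t y ≡ B → ∃ λ p → ∃ λ q → Weak (lab X p) × Strong (lab X q) ×
      Edge (adj X) (n ↑ʳ y) p × Edge (adj X) (n ↑ʳ y) q × (∀ w → Edge (adj X) (n ↑ʳ y) w → w ≡ p ⊎ w ≡ q)) →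
    BStructure X
  bStructure u≢B left-b right-b v l with split n v
  ... | right y = right-b y (trans (sym (lab-r y)) l)
  ... | left i with left-b i (trans (sym (lab-l i)) l)
  ... | p , q , wp , sq , ep , eq , only =
    p ↑ˡ m , q ↑ˡ m , subst Weak (sym (lab-l p)) wp , subst Strong (sym (lab-l q)) sq , edge-ll ep , edge-ll eq , nbr
    where
    nbr : ∀ w → Edge (adj X) (i ↑ˡ m) w → w ≡ p ↑ˡ m ⊎ w ≡ q ↑ˡ m
    nbr w e with split n w
    ... | right y = contradiction (trans (cong (lab G) (sym (proj₁ (unedge-lr e)))) (trans (sym (lab-l i)) l)) u≢B
    ... | left j with only j (unedge-ll e)
    ... | inj₁ refl = inj₁ refl
    ... | inj₂ refl = inj₂ refl

  cStructure : CStructure G →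
    (∀ y → t y ≡ C → TwoWeakNeighbours X (n ↑ʳ y)) →
    CStructure X
  cStructure left-c right-c v l with split n v
  ... | right y = right-c y (trans (sym (lab-r y)) l)
  ... | left i with left-c i (trans (sym (lab-l i)) l)
  ... | p , q , p≢q , wp , wq , ep , eq =
    p ↑ˡ m , q ↑ˡ m , p≢q ∘ Fin.↑ˡ-injective m p q , subst Weak (sym (lab-l p)) wp , subst Weak (sym (lab-l q)) wq ,
    edge-ll ep , edge-ll eq

-- Trading one unit at the common vertex

weight-raise : ∀ {n} (f : RF n) u → f u ≡ # 0 → weight (updateAt f u (const (# 1))) ≡ suc (weight f)
weight-raise f u z = trans (sym (ℕ.+-identityʳ _))
  (trans (subst (λ k → weight (updateAt f u (const (# 1))) + toℕ k ≡ weight f + 1) z (weight-updateAt f u (# 1)))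
         (ℕ.+-comm (weight f) 1))

-- With value 1 the vertex `u` no longer needs a dominator, and nobody loses one because `u` had
-- value 0. This repairs the restriction to the old tree when `u` was dominated only from the new
-- part.
admissible-raise : ∀ X {f u} → (∀ v → v ≢ u → lab X v ≢ C → f v ≡ # 0 → Dominated X f v) → f u ≡ # 0 →
  Admissible X (updateAt f u (const (# 1)))
admissible-raise X {f} {u} adm fu v nc z with v ≟F u
... | yes refl = contradiction (trans (sym z) (updateAt-updates u f)) λ ()
... | no v≢u with adm v v≢u nc (trans (sym (updateAt-minimal v u f v≢u)) z)
... | w , e , p = w , e , trans (updateAt-minimal w u f w≢u) p
  where
  w≢u : w ≢ u
  w≢u refl = contradiction (trans (sym fu) p) λ ()

compatible-lower : ∀ X {f u} → Allowed (lab X u) (f u) → Compatible X (updateAt f u (const (# 1))) → Compatible X f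
compatible-lower X {f} {u} a c v with v ≟F u
... | yes refl = a
... | no v≢u = subst (Allowed _) (updateAt-minimal v u f v≢u) (c v)

weak-0 : ∀ {s} → Weak s → Allowed s (# 0)
weak-0 weakA = A0
weak-0 weakD = D*

weak-1 : ∀ {s} → Weak s → Allowed s (# 1)
weak-1 weakA = A1
weak-1 weakD = D*

weak≢C : ∀ {s} → Weak s → s ≢ C
weak≢C weakA ()
weak≢C weakD ()

weak≢B : ∀ {s} → Weak s → s ≢ B
weak≢B weakA ()
weak≢B weakD ()

module _ (X : LTree) {f : RF (size X)} {u : Fin (size X)} (fu : f u ≡ # 1) where
  private
    f′ : RF (size X)
    f′ = updateAt f u (const (# 0))

  weight-lower : suc (weight f′) ≡ weight f
  weight-lower = begin
    suc (weight f′)        ≡⟨ ℕ.+-comm 1 (weight f′) ⟩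
    weight f′ + 1          ≡⟨ cong (λ k → weight f′ + toℕ k) fu ⟨
    weight f′ + toℕ (f u)  ≡⟨ weight-updateAt f u (# 0) ⟩
    weight f + 0           ≡⟨ ℕ.+-identityʳ (weight f) ⟩
    weight f               ∎
    where open ≡-Reasoning

  -- A vertex of value 1 dominates nobody, so after lowering it only `u` itself may lack a
  -- dominator; the new part will supply it.
  dominated-lower : IsRDF (adj X) f → ∀ i → f′ i ≡ # 0 → Dominated X f′ i ⊎ i ≡ u
  dominated-lower rdf i z with i ≟F u
  ... | yes i≡u = inj₂ i≡u
  ... | no i≢u with rdf i (trans (sym (updateAt-minimal i u f i≢u)) z)
  ... | w , e , p = inj₁ (w , e , trans (updateAt-minimal w u f w≢u) p)
    where
    w≢u : w ≢ u
    w≢u refl = contradiction (trans (sym fu) p) λ ()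

  compatible-clear : Weak (lab X u) → Compatible X f → Compatible X f′
  compatible-clear wk cf i with i ≟F u
  ... | yes refl = subst (Allowed _) (sym (updateAt-updates u f)) (weak-0 wk)
  ... | no i≢u   = subst (Allowed _) (sym (updateAt-minimal i u f i≢u)) (cf i)

-- c is the value at the vertex outside K to which x is joined.
Extension : (K : LTree) → Fin (size K) → ℕ → Fin 3 → RF (size K) → Set
Extension K x W c g = Compatible K g × weight g ≡ W × (∀ y → g y ≡ # 0 → Dominated K g y ⊎ (y ≡ x × c ≡ # 2))

-- The second alternative is made for `F f4`: its root has one weak neighbour of its own, and the
-- vertex of status `σ` to which it is attached is the other.
PendantCStructure : Status → (K : LTree) → Fin (size K) → Set
PendantCStructure σ K x = ∀ y → lab K y ≡ C →
  TwoWeakNeighbours K y ⊎ (y ≡ x × Weak σ × ∃ λ p → Weak (lab K p) × Edge (adj K) x p)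

-- K is to be attached through the edge ux, where u has status σ.
record Pendant (σ : Status) (K : LTree) (x : Fin (size K)) (W : ℕ) : Set where
  field
    lower : LowerBound K W
    -- A root of value 2 may dominate the vertex `u` outside, leaving the old tree one unit below
    -- its bound; the piece must then cost one unit more. Nothing is asked for `σ = C`, since
    -- `Admissible` does not require C-vertices to be dominated.
    demand : Weak σ → ∀ g → Admissible K g → g x ≡ # 2 → suc W ≤ weight g × (weight g ≡ suc W → Compatible K g)

    extend : ∀ c → Allowed σ c → ∃ (Extension K x W c)
    -- In the second alternative the value at `u` is lowered from 1 to 0: the unit saved pays for
    -- `suc W`, and the root of the piece, having value 2, dominates `u`.
    attained : ∀ y k → Allowed (lab K y) k →
      (∃ λ c → Allowed σ c × ∃ λ g → Extension K x W c g × g y ≡ k) ⊎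
      (Weak σ × ∃ λ g → Extension K x (suc W) (# 0) g × g x ≡ # 2 × g y ≡ k)
    noB : ∀ y → lab K y ≢ B
    cStructure : PendantCStructure σ K x

module _ {G : LTree} (u : Fin (size G)) (u-CD : lab G u ≡ C ⊎ Weak (lab G u)) {K : LTree} {x : Fin (size K)} (x-C : lab K x ≡ C)
         {W W′} (lowerG : LowerBound G W) (lowerK : LowerBound K W′)
         (demand : Weak (lab G u) → ∀ g → Admissible K g → g x ≡ # 2 → suc W′ ≤ weight g × (weight g ≡ suc W′ → Compatible K g)) where
  private
    m = size K
    module J = Hook G u (adj K) (lab K) (λ y → ⌊ y ≟F x ⌋)

  open J using (n)

  -- On the side of `K` only the C-vertex `x` could profit from the new edge, so the restriction is
  -- always admissible. On the side of `G` it fails to be so only if `u` is weak with value 0 and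
  -- `x` has value 2. Then `u` is raised to 1 and `demand` is used on `K`: the left weight is
  -- increased by one, the right bound is higher by one, and the two units cancel.
  lowerBound-attach : LowerBound (attach G u K x) (W + W′)
  lowerBound-attach f adm = go (f (u ↑ˡ m) ≟F # 0) (f (n ↑ʳ x) ≟F # 2) u-CD
    where
    fG : RF n
    fG i = f (i ↑ˡ m)
    g : RF m
    g j = f (n ↑ʳ j)

    admG : ∀ v → lab G v ≢ C → f (v ↑ˡ m) ≡ # 0 → Dominated G fG v ⊎ (v ≡ u × g x ≡ # 2)
    admG v nc z with J.admissible-l adm v nc z
    ... | inj₁ d = inj₁ d
    ... | inj₂ (e , y , p , q) = inj₂ (e , trans (cong g (sym (toWitness p))) q)

    admK : Admissible K g
    admK y nc z with J.admissible-r adm y nc z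
    ... | inj₁ d = d
    ... | inj₂ (p , _) = contradiction (trans (cong (lab K) (toWitness p)) x-C) nc

    weights : weight f ≡ weight fG + weight g
    weights = weight-splitAt n f

    easy : Admissible G fG → W + W′ ≤ weight f × (weight f ≡ W + W′ → Compatible (attach G u K x) f)
    easy a with lowerG fG a | lowerK g admK
    ... | p , p= | q , q= =
      subst (W + W′ ≤_) (sym weights) (ℕ.+-mono-≤ p q) ,
      λ e → let e₁ , e₂ = ≡-split p q (trans (sym weights) e) in J.compatible f (p= e₁) (q= e₂)

    go : Dec (fG u ≡ # 0) → Dec (g x ≡ # 2) → lab G u ≡ C ⊎ Weak (lab G u) →
      W + W′ ≤ weight f × (weight f ≡ W + W′ → Compatible (attach G u K x) f)
    go (yes fu) (yes gx) (inj₂ wk)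
      with lowerG (updateAt fG u (const (# 1)))
             (admissible-raise G (λ v v≢u nc z → [ (λ d → d) , (λ p → contradiction (proj₁ p) v≢u) ]′ (admG v nc z)) fu)
         | demand wk g admK gx
    ... | p , p= | q , q= rewrite weight-raise fG u fu =
      s≤s⁻¹ (subst (_≤ suc (weight f)) (ℕ.+-suc W W′) (subst (W + suc W′ ≤_) (cong suc (sym weights)) (ℕ.+-mono-≤ p q))) ,
      λ e → let e₁ , e₂ = ≡-split p q (trans (cong suc (trans (sym weights) e)) (sym (ℕ.+-suc W W′))) in
        J.compatible f (compatible-lower G (subst (Allowed _) (sym fu) (weak-0 wk)) (p= e₁)) (q= e₂)
    go _ _ (inj₁ uC) = easy λ v nc z → [ (λ d → d) , (λ p → contradiction (trans (cong (lab G) (proj₁ p)) uC) nc) ]′ (admG v nc z)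
    go (no fu) _ _ = easy λ v nc z → [ (λ d → d) , (λ p → contradiction (trans (cong fG (sym (proj₁ p))) z) fu) ]′ (admG v nc z)
    go _ (no gx) _ = easy λ v nc z → [ (λ d → d) , (λ p → contradiction (proj₂ p) gx) ]′ (admG v nc z)

module Attach {G : LTree} {W} (rigid : Rigid G W) (u : Fin (size G)) (u-CD : lab G u ≡ C ⊎ Weak (lab G u))
              {K : LTree} {x : Fin (size K)} (x-C : lab K x ≡ C) {W′} (pendant : Pendant (lab G u) K x W′) where
  private
    m = size K
    module R = Rigid rigid
    module P = Pendant pendant
    module J = Hook G u (adj K) (lab K) (λ y → ⌊ y ≟F x ⌋)

  open J using (n)

  glueUp : ∀ f → IsRDF (adj G) f → Compatible G f → weight f ≡ W → ∀ g → Extension K x W′ (f u) g →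
    IsRDF (adj (attach G u K x)) (f ++ g) × Compatible (attach G u K x) (f ++ g) × weight (f ++ g) ≡ W + W′
  glueUp f rdf cf wf g (cg , wg , dom) =
    J.isRDF-++ f g (λ i z → inj₁ (rdf i z))
      (λ j z → [ inj₁ , (λ { (refl , e) → inj₂ (fromWitness refl , e) }) ]′ (dom j z)) ,
    J.compatible-++ f g cf cg , trans (weight-++ f g) (cong₂ _+_ wf wg)

  attained : AllAttained (attach G u K x) (W + W′)
  attained w k al with split n w
  ... | left i =
    let f , rdf , cf , wf , fk = R.attained i k (subst (λ s → Allowed s k) (J.lab-l i) al)
        g , ext = P.extend (f u) (cf u)
        r , c , e = glueUp f rdf cf wf g ext
    in f ++ g , r , c , e , trans (++-left f g i) fk
  ... | right j with P.attained j k (subst (λ s → Allowed s k) (J.lab-r j) al)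
  ... | inj₁ (c , ac , g , ext , gk) =
    let f , rdf , cf , wf , fk = R.attained u c ac
        r , c′ , e = glueUp f rdf cf wf g (subst (λ c → Extension K x W′ c g) (sym fk) ext)
    in f ++ g , r , c′ , e , trans (++-right f g j) gk
  ... | inj₂ (wk , g , (cg , wg , dom) , gx , gk) with R.attained u (# 1) (weak-1 wk)
  ... | f , rdf , cf , wf , fu = f′ ++ g ,
    J.isRDF-++ f′ g
      (λ i z → [ inj₁ , (λ e → inj₂ (e , x , fromWitness refl , gx)) ]′ (dominated-lower G fu rdf i z))
      (λ j z → inj₁ ([ (λ d → d) , (λ { (_ , ()) }) ]′ (dom j z))) ,
    J.compatible-++ f′ g (compatible-clear G fu wk cf) cg ,
    (begin
      weight (f′ ++ g)        ≡⟨ weight-++ f′ g ⟩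
      weight f′ + weight g    ≡⟨ cong (weight f′ +_) wg ⟩
      weight f′ + suc W′      ≡⟨ ℕ.+-suc (weight f′) W′ ⟩
      suc (weight f′) + W′    ≡⟨ cong (_+ W′) (trans (weight-lower G fu) wf) ⟩
      W + W′                  ∎) ,
    trans (++-right f′ g j) gk
    where
    open ≡-Reasoning
    f′ : RF n
    f′ = updateAt f u (const (# 0))

  rigid-attach : Rigid (attach G u K x) (W + W′)
  rigid-attach = record
    { lower = lowerBound-attach u u-CD x-C R.lower P.lower P.demand
    ; attained = attained
    ; bStructure = J.bStructure u≢B R.bStructure (λ y l → contradiction l (P.noB y))
    ; cStructure = J.cStructure R.cStructure cStructure
    }
    where
    u≢B : lab G u ≢ B
    u≢B l = [ (λ uC → contradiction (trans (sym l) uC) λ ()) , (λ wk → weak≢B wk l) ]′ u-CD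

    cStructure : ∀ y → lab K y ≡ C → TwoWeakNeighbours J.X (n ↑ʳ y)
    cStructure y l with P.cStructure y l
    ... | inj₁ (p , q , p≢q , wp , wq , ep , eq) = n ↑ʳ p , n ↑ʳ q , p≢q ∘ Fin.↑ʳ-injective n p q ,
      subst Weak (sym (J.lab-r p)) wp , subst Weak (sym (J.lab-r q)) wq , J.edge-rr ep , J.edge-rr eq
    ... | inj₂ (refl , wk , p , wp , ep) = u ↑ˡ m , n ↑ʳ p , u≢p ,
      subst Weak (sym (J.lab-l u)) wk , subst Weak (sym (J.lab-r p)) wp , J.edge-rl (fromWitness refl) , J.edge-rr ep
      where
      u≢p : u ↑ˡ m ≢ n ↑ʳ p
      u≢p e = contradiction (trans (sym (Fin.splitAt-↑ˡ n u m)) (trans (cong (splitAt n) e) (Fin.splitAt-↑ʳ n m p))) λ ()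

punchIn-view : ∀ {m} (v z : Fin (suc m)) → z ≡ v ⊎ ∃ λ z′ → punchIn v z′ ≡ z
punchIn-view v z with v ≟F z
... | yes v≡z = inj₁ (sym v≡z)
... | no v≢z  = inj₂ (punchOut v≢z , Fin.punchIn-punchOut v≢z)

-- The identified vertex is counted in `G`. With value 1 at `v` it accounts for one unit of the
-- weight of `K`, hence the normalisation `suc W′`. If `u` has status D it may take the value 2,
-- which no minimum function of `K` takes at the A-vertex `v`; the neighbours of `v` are then
-- dominated from outside, which is harmless when they all have status C.
module Glue {G : LTree} {W} (rigid : Rigid G W) (u : Fin (size G)) {m} {b : Adj (suc m)} {t : Fin (suc m) → Status}
            (b-sym : ∀ i j → b i j ≡ b j i) {W′} (rigid′ : Rigid (mk (suc m) b t) (suc W′))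
            (v : Fin (suc m)) (v-A : t v ≡ A)
            (u-AD : lab G u ≡ A ⊎ (lab G u ≡ D × (∀ y → Edge b v y → t y ≡ C))) where
  private
    module R = Rigid rigid
    module R′ = Rigid rigid′
    K : LTree
    K = mk (suc m) b t

  module J = Hook G u (λ x y → b (punchIn v x) (punchIn v y)) (λ y → t (punchIn v y)) (λ y → b v (punchIn v y))
  open J using (n; X)

  flip : ∀ {i j} → Edge b i j → Edge b j i
  flip {i} {j} = subst T (b-sym i j)

  u-weak : Weak (lab G u)
  u-weak = [ (λ e → subst Weak (sym e) weakA) , (λ p → subst Weak (sym (proj₁ p)) weakD) ]′ u-AD

  dominated-insert : ∀ (g : RF m) k y → Dominated (J.K) g y → Dominated K (insertAt g v k) (punchIn v y)
  dominated-insert g k y (z , e , p) = punchIn v z , e , trans (insertAt-punchIn g v k z) p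

  -- The value at `u` decides what is put at `v` in `K`. If `u` has value 1, or value 0 with a
  -- dominator in `G`, put 1 there. If `u` is dominated only from `K`, keep 0 there and raise `u` to
  -- 1 in `G`. If `u` has value 2 and status D, put 1, the neighbours of `v` being C-vertices. If
  -- `u` has value 2 and status A, put 2 on both sides: neither side can be tight at an A-vertex of
  -- value 2, and the two strict inequalities outweigh the double count, so the total is strictly
  -- above `W + W′`.
  lower : LowerBound X (W + W′)
  lower f adm = go (fG u) refl
    where
    fG : RF n
    fG i = f (i ↑ˡ m)
    g : RF m
    g j = f (n ↑ʳ j)

    Goal : Set
    Goal = W + W′ ≤ weight f × (weight f ≡ W + W′ → Compatible X f)

    weights : weight f ≡ weight fG + weight g
    weights = weight-splitAt n f

    admK : ∀ k → (k ≡ # 0 → Dominated K (insertAt g v k) v) →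
      (fG u ≡ # 2 → k ≢ # 2 → ∀ y → Edge b v y → t y ≡ C) → Admissible K (insertAt g v k)
    admK k vK uK z nc p with punchIn-view v z
    ... | inj₁ refl = vK (trans (sym (insertAt-lookup g v k)) p)
    ... | inj₂ (y , refl) with J.admissible-r adm y nc (trans (sym (insertAt-punchIn g v k y)) p)
    ... | inj₁ d = dominated-insert g k y d
    ... | inj₂ (e , fu) with k ≟F # 2
    ... | yes refl = v , flip e , insertAt-lookup g v (# 2)
    ... | no k≢2   = contradiction (uK fu k≢2 (punchIn v y) e) nc

    compatible-remove : ∀ k → Compatible K (insertAt g v k) → Compatible J.K g
    compatible-remove k c y = subst (Allowed _) (insertAt-punchIn g v k y) (c (punchIn v y))

    viaOne : Admissible G fG → Admissible K (insertAt g v (# 1)) → Goal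
    viaOne a a′ with R.lower fG a | R′.lower (insertAt g v (# 1)) a′
    ... | p , p= | q , q= rewrite weight-insertAt g v (# 1) =
      subst (W + W′ ≤_) (sym weights) (ℕ.+-mono-≤ p (s≤s⁻¹ q)) ,
      λ e → let e₁ , e₂ = ≡-split p (s≤s⁻¹ q) (trans (sym weights) e) in
        J.compatible f (p= e₁) (compatible-remove (# 1) (q= (cong suc e₂)))

    viaTwo : lab G u ≡ A → fG u ≡ # 2 → Admissible G fG → Admissible K (insertAt g v (# 2)) → Goal
    viaTwo uA fu a a′ with R.lower fG a | R′.lower (insertAt g v (# 2)) a′
    ... | p , p= | q , q= rewrite weight-insertAt g v (# 2) =
      ℕ.<⇒≤ bound , λ e → contradiction (sym e) (ℕ.<⇒≢ bound)
      where
      notTwo : ∀ {k s} → Allowed s k → s ≡ A → k ≢ # 2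
      notTwo A0 _ ()
      notTwo A1 _ ()
      notTwo C2 () _
      notTwo D* () _
      p< : suc W ≤ weight fG
      p< = ℕ.≤∧≢⇒< p λ e → notTwo (p= (sym e) u) uA fu
      q< : suc W′ < 2 + weight g
      q< = ℕ.≤∧≢⇒< q λ e → notTwo (q= (sym e) v) v-A (insertAt-lookup g v (# 2))
      bound : W + W′ < weight f
      bound = subst (W + W′ <_) (sym weights) (ℕ.+-mono-≤ p< (s≤s⁻¹ (s≤s⁻¹ q<)))

    viaZero : fG u ≡ # 0 → (∃ λ y → Edge b v (punchIn v y) × g y ≡ # 2) → Goal
    viaZero fu (y , e , gy)
      with R.lower (updateAt fG u (const (# 1))) (admissible-raise G
             (λ w w≢u nc z → [ (λ d → d) , (λ d → contradiction (proj₁ d) w≢u) ]′ (J.admissible-l adm w nc z)) fu)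
         | R′.lower (insertAt g v (# 0)) (admK (# 0) (λ _ → punchIn v y , e , trans (insertAt-punchIn g v (# 0) y) gy)
             (λ fu′ _ → contradiction (trans (sym fu) fu′) λ ()))
    ... | p , p= | q , q= rewrite weight-raise fG u fu | weight-insertAt g v (# 0) =
      s≤s⁻¹ (subst (_≤ suc (weight f)) (ℕ.+-suc W W′) (subst (W + suc W′ ≤_) (cong suc (sym weights)) (ℕ.+-mono-≤ p q))) ,
      λ e → let e₁ , e₂ = ≡-split p q (trans (cong suc (trans (sym weights) e)) (sym (ℕ.+-suc W W′))) in
        J.compatible f (compatible-lower G (subst (Allowed _) (sym fu) (weak-0 u-weak)) (p= e₁))
          (compatible-remove (# 0) (q= e₂))

    admG : (fG u ≡ # 0 → Dominated G fG u) → Admissible G fG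
    admG du w nc z with J.admissible-l adm w nc z
    ... | inj₁ d          = d
    ... | inj₂ (refl , _) = du z

    go : ∀ c → fG u ≡ c → Goal
    go zero fu with J.admissible-l adm u (weak≢C u-weak) fu
    ... | inj₂ (_ , d) = viaZero fu d
    ... | inj₁ d = viaOne (admG λ _ → d) (admK (# 1) (λ ()) λ fu′ _ → contradiction (trans (sym fu) fu′) λ ())
    go (suc zero) fu = viaOne (admG λ z → contradiction (trans (sym fu) z) λ ())
      (admK (# 1) (λ ()) λ fu′ _ → contradiction (trans (sym fu) fu′) λ ())
    go (suc (suc zero)) fu = [
      (λ uA → viaTwo uA fu (admG λ z → contradiction (trans (sym fu) z) λ ())
        (admK (# 2) (λ ()) λ _ k → contradiction refl k)) ,
      (λ uD → viaOne (admG λ z → contradiction (trans (sym fu) z) λ ()) (admK (# 1) (λ ()) λ _ _ → proj₂ uD)) ]′ u-AD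

  remove : RF (suc m) → RF m
  remove f y = f (punchIn v y)

  dominated-remove : ∀ {f y} → Dominated K f (punchIn v y) → Dominated J.K (remove f) y ⊎ (Edge b (punchIn v y) v × f v ≡ # 2)
  dominated-remove (z , e , p) with punchIn-view v z
  ... | inj₁ refl        = inj₂ (e , p)
  ... | inj₂ (z′ , refl) = inj₁ (z′ , e , p)

  Attained-++ : RF n → RF m → Set
  Attained-++ f g = IsRDF (adj X) (f ++ g) × Compatible X (f ++ g) × weight (f ++ g) ≡ W + W′

  viaOne : ∀ f → IsRDF (adj G) f → Compatible G f → weight f ≡ W →
    ∀ g → IsRDF b g → Compatible K g → weight g ≡ suc W′ → g v ≡ # 1 → Attained-++ f (remove g)
  viaOne f rdf cf wf g rdf′ cg wg gv =
    J.isRDF-++ f (remove g) (λ i z → inj₁ (rdf i z))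
      (λ j z → inj₁ ([ (λ d → d) , (λ p → contradiction (trans (sym gv) (proj₂ p)) λ ()) ]′
        (dominated-remove (rdf′ (punchIn v j) z)))) ,
    J.compatible-++ f (remove g) cf (λ y → cg (punchIn v y)) ,
    trans (weight-++ f (remove g)) (cong₂ _+_ wf (ℕ.suc-injective (trans (sym (trans (weight-remove g v) (cong (λ k → toℕ k + weight (remove g)) gv))) wg)))

  viaZero : ∀ f → IsRDF (adj G) f → Compatible G f → weight f ≡ W → f u ≡ # 1 →
    ∀ g → IsRDF b g → Compatible K g → weight g ≡ suc W′ → g v ≡ # 0 → Attained-++ (updateAt f u (const (# 0))) (remove g)
  viaZero f rdf cf wf fu g rdf′ cg wg gv =
    J.isRDF-++ f′ (remove g) rdf-l
      (λ j z → inj₁ ([ (λ d → d) , (λ p → contradiction (trans (sym gv) (proj₂ p)) λ ()) ]′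
        (dominated-remove (rdf′ (punchIn v j) z)))) ,
    J.compatible-++ f′ (remove g) (compatible-clear G fu u-weak cf) (λ y → cg (punchIn v y)) ,
    (begin
      weight (f′ ++ remove g)          ≡⟨ weight-++ f′ (remove g) ⟩
      weight f′ + weight (remove g)    ≡⟨ cong (weight f′ +_) (trans (sym (trans (weight-remove g v) (cong (λ k → toℕ k + weight (remove g)) gv))) wg) ⟩
      weight f′ + suc W′               ≡⟨ ℕ.+-suc (weight f′) W′ ⟩
      suc (weight f′) + W′             ≡⟨ cong (_+ W′) (trans (weight-lower G fu) wf) ⟩
      W + W′                           ∎)
    where
    open ≡-Reasoning
    f′ : RF n
    f′ = updateAt f u (const (# 0))

    rdf-l : ∀ i → f′ i ≡ # 0 → Dominated G f′ i ⊎ (i ≡ u × ∃ λ y → Edge b v (punchIn v y) × remove g y ≡ # 2)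
    rdf-l i z with dominated-lower G fu rdf i z
    ... | inj₁ d = inj₁ d
    ... | inj₂ i≡u with rdf′ v gv
    ... | w , e , p with punchIn-view v w
    ... | inj₁ refl        = contradiction (trans (sym gv) p) λ ()
    ... | inj₂ (w′ , refl) = inj₂ (i≡u , w′ , e , p)

  -- A function on `K` with value 1 at `v` fits any function on `G`, since in `K` such a `v` neither
  -- dominates nor is dominated by need. If instead `v` has value 0, it has a dominator in `K`, so a
  -- function on `G` with value 1 at `u` can be lowered there.
  attained : AllAttained X (W + W′)
  attained w k al with split n w
  ... | left i =
    let f , rdf , cf , wf , fk = R.attained i k (subst (λ s → Allowed s k) (J.lab-l i) al)
        g , rdf′ , cg , wg , gv = R′.attained v (# 1) (subst (λ s → Allowed s _) (sym v-A) A1)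
        r , c , e = viaOne f rdf cf wf g rdf′ cg wg gv
    in f ++ remove g , r , c , e , trans (++-left f (remove g) i) fk
  ... | right j with R′.attained (punchIn v j) k (subst (λ s → Allowed s k) (J.lab-r j) al)
                   | R.attained u (# 1) (weak-1 u-weak)
  ... | g , rdf′ , cg , wg , gk | f , rdf , cf , wf , fu with g v in gv | subst (λ s → Allowed s (g v)) v-A (cg v)
  ... | _ | A1 =
    let r , c , e = viaOne f rdf cf wf g rdf′ cg wg gv
    in f ++ remove g , r , c , e , trans (++-right f (remove g) j) gk
  ... | _ | A0 =
    let r , c , e = viaZero f rdf cf wf fu g rdf′ cg wg gv
    in updateAt f u (const (# 0)) ++ remove g , r , c , e , trans (++-right (updateAt f u (const (# 0))) (remove g) j) gk

  into : Fin (suc m) → Fin (n + m)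
  into z = [ const (u ↑ˡ m) , (λ p → n ↑ʳ proj₁ p) ]′ (punchIn-view v z)

  into-v : into v ≡ u ↑ˡ m
  into-v with punchIn-view v v
  ... | inj₁ _       = refl
  ... | inj₂ (z , e) = contradiction e (Fin.punchInᵢ≢i v z)

  into-punchIn : ∀ z → into (punchIn v z) ≡ n ↑ʳ z
  into-punchIn z with punchIn-view v (punchIn v z)
  ... | inj₁ e        = contradiction e (Fin.punchInᵢ≢i v z)
  ... | inj₂ (z′ , e) = cong (n ↑ʳ_) (Fin.punchIn-injective v z′ z e)

  into-injective : ∀ p q → into p ≡ into q → p ≡ q
  into-injective p q e with punchIn-view v p | punchIn-view v q
  ... | inj₁ refl        | inj₁ refl        = refl
  ... | inj₂ (p′ , refl) | inj₂ (q′ , refl) = cong (punchIn v) (Fin.↑ʳ-injective n p′ q′ e)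
  ... | inj₁ refl        | inj₂ (q′ , refl) =
    contradiction (trans (sym (Fin.splitAt-↑ˡ n u m)) (trans (cong (splitAt n) e) (Fin.splitAt-↑ʳ n m q′))) λ ()
  ... | inj₂ (p′ , refl) | inj₁ refl        =
    contradiction (trans (sym (Fin.splitAt-↑ˡ n u m)) (trans (cong (splitAt n) (sym e)) (Fin.splitAt-↑ʳ n m p′))) λ ()

  edge-into : ∀ y z → Edge b (punchIn v y) z → Edge (adj X) (n ↑ʳ y) (into z)
  edge-into y z e with punchIn-view v z
  ... | inj₁ refl       = J.edge-rl (flip e)
  ... | inj₂ (_ , refl) = J.edge-rr e

  unedge-into : ∀ y w → Edge (adj X) (n ↑ʳ y) w → ∃ λ z → Edge b (punchIn v y) z × w ≡ into z
  unedge-into y w e with split n w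
  ... | right z = punchIn v z , J.unedge-rr e , sym (into-punchIn z)
  ... | left i with J.unedge-rl e
  ... | refl , h = v , flip h , sym into-v

  weak-into : ∀ z → Weak (t z) → Weak (lab X (into z))
  weak-into z wk with punchIn-view v z
  ... | inj₁ refl        = subst Weak (sym (J.lab-l u)) u-weak
  ... | inj₂ (z′ , refl) = subst Weak (sym (J.lab-r z′)) wk

  strong-into : ∀ z → Strong (t z) → Strong (lab X (into z))
  strong-into z st with punchIn-view v z
  ... | inj₁ refl        = contradiction (subst Strong v-A st) λ ()
  ... | inj₂ (z′ , refl) = subst Strong (sym (J.lab-r z′)) st

  rigid-glue : Rigid X (W + W′)
  rigid-glue = record
    { lower = lower
    ; attained = attained
    ; bStructure = J.bStructure (weak≢B u-weak) R.bStructure λ y l →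
        let p , q , wp , sq , ep , eq , only = R′.bStructure (punchIn v y) l in
        into p , into q , weak-into p wp , strong-into q sq , edge-into y p ep , edge-into y q eq ,
        λ w e → let z , e′ , w≡ = unedge-into y w e in
          [ (λ z≡ → inj₁ (trans w≡ (cong into z≡))) , (λ z≡ → inj₂ (trans w≡ (cong into z≡))) ]′ (only z e′)
    ; cStructure = J.cStructure R.cStructure λ y l →
        let p , q , p≢q , wp , wq , ep , eq = R′.cStructure (punchIn v y) l in
        into p , into q , p≢q ∘ into-injective p q , weak-into p wp , weak-into q wq , edge-into y p ep , edge-into y q eq
    }

-- Finite verification for the trees H and F

weight-iso : ∀ {G K} (φ : LIso G K) (f : RF (size K)) → weight (f ∘ LIso.to φ) ≡ weight f
weight-iso φ f = trans (weight-sum (f ∘ to))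
  (trans (sym (sum-permute (toℕ ∘ f) (permutation to from to∘from from∘to))) (sym (weight-sum f)))
  where open LIso φ

module _ {G K : LTree} (φ : LIso G K) where
  open LIso φ

  edge-to : ∀ {i j} → Edge (adj G) i j → Edge (adj K) (to i) (to j)
  edge-to {i} {j} = subst T (sym (adj-pres i j))

  edge-from : ∀ {i j} → Edge (adj K) i j → Edge (adj G) (from i) (from j)
  edge-from {i} {j} e = subst T (trans (sym (cong₂ (adj K) (to∘from i) (to∘from j))) (adj-pres (from i) (from j))) e

  lab-from : ∀ j → lab G (from j) ≡ lab K j
  lab-from j = trans (sym (lab-pres (from j))) (cong (lab K) (to∘from j))

  dominated-from : ∀ {f v} → Dominated K f v → Dominated G (f ∘ to) (from v)
  dominated-from {f} (u , e , p) = from u , edge-from e , trans (cong f (to∘from u)) p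

  dominated-to : ∀ {f v} → Dominated G f v → Dominated K (f ∘ from) (to v)
  dominated-to {f} (u , e , p) = to u , edge-to e , trans (cong f (from∘to u)) p

LIso-sym : ∀ {G K} → LIso G K → LIso K G
LIso-sym {G} {K} φ = record
  { to = from ; from = to ; from∘to = to∘from ; to∘from = from∘to
  ; adj-pres = λ i j → trans (sym (adj-pres (from i) (from j))) (cong₂ (adj K) (to∘from i) (to∘from j))
  ; lab-pres = lab-from φ }
  where open LIso φ

lowerBound-iso : ∀ {G K W} → LIso G K → LowerBound G W → LowerBound K W
lowerBound-iso {G} {K} φ low f adm with low (f ∘ to) adm′
  where
  open LIso φ
  adm′ : Admissible G (f ∘ to)
  adm′ v nc z = subst (Dominated G (f ∘ to)) (from∘to v)
    (dominated-from φ (adm (to v) (nc ∘ trans (sym (lab-pres v))) z))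
... | p , q rewrite weight-iso φ f = p , λ e j →
  subst (λ s → Allowed s (f j)) (lab-from φ j) (subst (λ k → Allowed _ (f k)) (LIso.to∘from φ j) (q e (LIso.from φ j)))

_≟S_ : (s t : Status) → Dec (s ≡ t)
A ≟S A = yes refl
A ≟S B = no λ ()
A ≟S C = no λ ()
A ≟S D = no λ ()
B ≟S A = no λ ()
B ≟S B = yes refl
B ≟S C = no λ ()
B ≟S D = no λ ()
C ≟S A = no λ ()
C ≟S B = no λ ()
C ≟S C = yes refl
C ≟S D = no λ ()
D ≟S A = no λ ()
D ≟S B = no λ ()
D ≟S C = no λ ()
D ≟S D = yes refl

allowed? : ∀ s k → Dec (Allowed s k)
allowed? A zero = yes A0
allowed? A (suc zero) = yes A1
allowed? A (suc (suc zero)) = no λ ()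
allowed? B zero = yes B0
allowed? B (suc zero) = no λ ()
allowed? B (suc (suc zero)) = yes B2
allowed? C zero = yes C0
allowed? C (suc zero) = no λ ()
allowed? C (suc (suc zero)) = yes C2
allowed? D k = yes D*

weak? : ∀ s → Dec (Weak s)
weak? A = yes weakA
weak? B = no λ ()
weak? C = no λ ()
weak? D = yes weakD

strong? : ∀ s → Dec (Strong s)
strong? A = no λ ()
strong? B = yes strongB
strong? C = yes strongC
strong? D = no λ ()

-- Vectors are enumerable entry by entry. Bounds for functions are recovered through
-- `lookup ∘ tabulate`, which agrees with the function pointwise only; hence the congruence lemmas
-- below.
allVec? : ∀ {m} {P : Vec (Fin 3) m → Set} → (∀ v → Dec (P v)) → Dec (∀ v → P v)
allVec? {zero}  d = map′ (λ { p [] → p }) (λ f → f []) (d [])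
allVec? {suc m} d = map′ (λ { p (x ∷ v) → p x v }) (λ f x v → f (x ∷ v)) (Fin.all? λ x → allVec? λ v → d (x ∷ v))

module Decide (X : LTree) where
  private
    n = size X

  dominated? : ∀ f v → Dec (Dominated X f v)
  dominated? f v = Fin.any? λ u → T? (adj X v u) ×-dec (f u ≟F # 2)

  admissible? : ∀ f → Dec (Admissible X f)
  admissible? f = Fin.all? λ v → ¬? (lab X v ≟S C) →-dec ((f v ≟F # 0) →-dec dominated? f v)

  compatible? : ∀ f → Dec (Compatible X f)
  compatible? f = Fin.all? λ v → allowed? (lab X v) (f v)

  LowerAt : ℕ → RF n → Set
  LowerAt W f = W ≤ weight f × (weight f ≡ W → Compatible X f)

  lowerAt? : ∀ W f → Dec (LowerAt W f)
  lowerAt? W f = (W ≤? weight f) ×-dec ((weight f ≟ℕ W) →-dec compatible? f)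

  lowerAt-cong : ∀ {W f g} → f ≗ g → LowerAt W f → LowerAt W g
  lowerAt-cong e (p , q) rewrite weight-cong e = p , λ w v → subst (Allowed _) (e v) (q w v)

  admissible-cong : ∀ {f g} → f ≗ g → Admissible X f → Admissible X g
  admissible-cong e a v nc z = let u , uv , p = a v nc (trans (e v) z) in u , uv , trans (sym (e u)) p

  lowerBound-check : ∀ {W} → True (allVec? {n} λ v → admissible? (lookup v) →-dec lowerAt? W (lookup v)) → LowerBound X W
  lowerBound-check ok f a = lowerAt-cong (lookup∘tabulate f)
    (toWitness ok (tabulate f) (admissible-cong (sym ∘ lookup∘tabulate f) a))

  demand-check : ∀ {W} x →
    True (allVec? {n} λ v → (lookup v x ≟F # 2) →-dec (admissible? (lookup v) →-dec lowerAt? W (lookup v))) →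
    ∀ f → Admissible X f → f x ≡ # 2 → LowerAt W f
  demand-check x ok f a fx = lowerAt-cong (lookup∘tabulate f)
    (toWitness ok (tabulate f) (trans (lookup∘tabulate f x) fx) (admissible-cong (sym ∘ lookup∘tabulate f) a))

  bStructure? : Dec (BStructure X)
  bStructure? = Fin.all? λ v → (lab X v ≟S B) →-dec (Fin.any? λ a → Fin.any? λ b →
    weak? (lab X a) ×-dec (strong? (lab X b) ×-dec (T? (adj X v a) ×-dec (T? (adj X v b) ×-dec
      (Fin.all? λ w → T? (adj X v w) →-dec ((w ≟F a) ⊎-dec (w ≟F b)))))))

  twoWeakNeighbours? : ∀ v → Dec (TwoWeakNeighbours X v)
  twoWeakNeighbours? v = Fin.any? λ a → Fin.any? λ b →
    ¬? (a ≟F b) ×-dec (weak? (lab X a) ×-dec (weak? (lab X b) ×-dec (T? (adj X v a) ×-dec T? (adj X v b))))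

  cStructure? : Dec (CStructure X)
  cStructure? = Fin.all? λ v → (lab X v ≟S C) →-dec twoWeakNeighbours? v

  pendantCStructure? : ∀ σ x → Dec (PendantCStructure σ X x)
  pendantCStructure? σ x = Fin.all? λ y → (lab X y ≟S C) →-dec (twoWeakNeighbours? y ⊎-dec
    ((y ≟F x) ×-dec (weak? σ ×-dec (Fin.any? λ p → weak? (lab X p) ×-dec T? (adj X x p)))))

  isRDF? : ∀ f → Dec (IsRDF (adj X) f)
  isRDF? f = Fin.all? λ v → (f v ≟F # 0) →-dec dominated? f v

  attained? : ∀ W (vs : List (Vec (Fin 3) n)) → Dec
    (All (λ v → IsRDF (adj X) (lookup v) × Compatible X (lookup v) × weight (lookup v) ≡ W) vs ×
     (∀ v k → Allowed (lab X v) k → Any (λ f → lookup f v ≡ k) vs))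
  attained? W vs = (all? (λ v → isRDF? (lookup v) ×-dec (compatible? (lookup v) ×-dec (weight (lookup v) ≟ℕ W))) vs)
    ×-dec (Fin.all? λ v → Fin.all? λ k → allowed? (lab X v) k →-dec any? (λ f → lookup f v ≟F k) vs)

  -- The lower bound is an argument, so that for the larger trees it can be composed from two paths
  -- instead of being tested on all 3^n functions; the list `vs` only has to exhibit the attained
  -- values.
  rigid-check : ∀ {W} (vs : List (Vec (Fin 3) n)) → LowerBound X W →
    True (attained? W vs) → True bStructure? → True cStructure? → Rigid X W
  rigid-check {W} vs low ok bs cs = record
    { lower = low
    ; attained = attained
    ; bStructure = toWitness bs
    ; cStructure = toWitness cs
    }
    where
    attained : AllAttained X W
    attained v k al with find (proj₂ (toWitness ok) v k al)
    ... | f , f∈ , e with All.lookup (proj₁ (toWitness ok)) f∈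
    ... | r , c , w = lookup f , r , c , w , e

  extension? : ∀ x W c g → Dec (Extension X x W c g)
  extension? x W c g = compatible? g ×-dec ((weight g ≟ℕ W) ×-dec
    (Fin.all? λ y → (g y ≟F # 0) →-dec (dominated? g y ⊎-dec ((y ≟F x) ×-dec (c ≟F # 2)))))

  Witness : Status → Fin n → ℕ → Fin 3 × Vec (Fin 3) n → Set
  Witness σ x W (c , v) = (Allowed σ c × Extension X x W c (lookup v)) ⊎
    (Weak σ × Extension X x (suc W) (# 0) (lookup v) × lookup v x ≡ # 2)

  Witnesses : Status → Fin n → ℕ → List (Fin 3 × Vec (Fin 3) n) → Set
  Witnesses σ x W vs = All (Witness σ x W) vs ×
    (∀ c → Allowed σ c → Any (λ p → proj₁ p ≡ c × Extension X x W c (lookup (proj₂ p))) vs) ×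
    (∀ y k → Allowed (lab X y) k → Any (λ p → lookup (proj₂ p) y ≡ k) vs)

  witnesses? : ∀ σ x W vs → Dec (Witnesses σ x W vs)
  witnesses? σ x W vs =
    (all? (λ { (c , v) → (allowed? σ c ×-dec extension? x W c (lookup v)) ⊎-dec
      (weak? σ ×-dec (extension? x (suc W) (# 0) (lookup v) ×-dec (lookup v x ≟F # 2))) }) vs)
    ×-dec ((Fin.all? λ c → allowed? σ c →-dec any? (λ p → (proj₁ p ≟F c) ×-dec extension? x W c (lookup (proj₂ p))) vs)
    ×-dec (Fin.all? λ y → Fin.all? λ k → allowed? (lab X y) k →-dec any? (λ p → lookup (proj₂ p) y ≟F k) vs))

  pendant-check : ∀ {σ x W} (vs : List (Fin 3 × Vec (Fin 3) n)) → LowerBound X W →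
    (Weak σ → ∀ g → Admissible X g → g x ≡ # 2 → LowerAt (suc W) g) →
    True (witnesses? σ x W vs) → True (Fin.all? λ y → ¬? (lab X y ≟S B)) → True (pendantCStructure? σ x) → Pendant σ X x W
  pendant-check {σ} {x} {W} vs low dem ok nb cs = record
    { lower = low
    ; demand = dem
    ; extend = extend
    ; attained = attained
    ; noB = toWitness nb
    ; cStructure = toWitness cs
    }
    where
    extend : ∀ c → Allowed σ c → ∃ (Extension X x W c)
    extend c al with find (proj₁ (proj₂ (toWitness ok)) c al)
    ... | (_ , v) , _ , _ , ext = lookup v , ext

    attained : ∀ y k → Allowed (lab X y) k →
      (∃ λ c → Allowed σ c × ∃ λ g → Extension X x W c g × g y ≡ k) ⊎
      (Weak σ × ∃ λ g → Extension X x (suc W) (# 0) g × g x ≡ # 2 × g y ≡ k)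
    attained y k al with find (proj₂ (proj₂ (toWitness ok)) y k al)
    ... | (c , v) , v∈ , e with All.lookup (proj₁ (toWitness ok)) v∈
    ... | inj₁ (a , r)       = inj₁ (c , a , lookup v , r , e)
    ... | inj₂ (w , r , v≡2) = inj₂ (w , lookup v , r , v≡2 , e)

isIso? : (G K : LTree) (p : Vec (Fin (size K)) (size G)) (q : Vec (Fin (size G)) (size K)) → Dec
  ((∀ i → lookup q (lookup p i) ≡ i) × (∀ j → lookup p (lookup q j) ≡ j) ×
   (∀ i j → adj K (lookup p i) (lookup p j) ≡ adj G i j) × (∀ i → lab K (lookup p i) ≡ lab G i))
isIso? G K p q = (Fin.all? λ i → lookup q (lookup p i) ≟F i) ×-dec ((Fin.all? λ j → lookup p (lookup q j) ≟F j) ×-dec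
  ((Fin.all? λ i → Fin.all? λ j → adj K (lookup p i) (lookup p j) ≟B adj G i j) ×-dec
   (Fin.all? λ i → lab K (lookup p i) ≟S lab G i)))

iso-check : ∀ {G K} p q → True (isIso? G K p q) → LIso G K
iso-check p q ok with toWitness ok
... | a , b , c , d = record { to = lookup p ; from = lookup q ; from∘to = a ; to∘from = b ; adj-pres = c ; lab-pres = d }

open Decide

lowerBound-F1 : LowerBound (F f1) 2
lowerBound-F1 = lowerBound-check (F f1) _

lowerBound-F2 : LowerBound (F f2) 3
lowerBound-F2 = lowerBound-check (F f2) _

lowerBound-F3 : LowerBound (F f3) 4
lowerBound-F3 = lowerBound-check (F f3) _

lowerBound-F4 : LowerBound (F f4) 2
lowerBound-F4 = lowerBound-check (F f4) _

pendant-F1 : Pendant C (F f1) (xOf f1) 2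
pendant-F1 = pendant-check (F f1)
  ((# 0 , # 0 ∷ # 2 ∷ # 0 ∷ []) ∷
   (# 2 , # 1 ∷ # 0 ∷ # 1 ∷ []) ∷ [])
  lowerBound-F1 (λ ()) _ _ _

pendant-F2 : Pendant C (F f2) (xOf f2) 3
pendant-F2 = pendant-check (F f2)
  ((# 0 , # 0 ∷ # 2 ∷ # 0 ∷ # 1 ∷ []) ∷
   (# 2 , # 1 ∷ # 0 ∷ # 2 ∷ # 0 ∷ []) ∷
   (# 2 , # 1 ∷ # 0 ∷ # 0 ∷ # 2 ∷ []) ∷
   (# 2 , # 1 ∷ # 0 ∷ # 1 ∷ # 1 ∷ []) ∷ [])
  lowerBound-F2 (λ ()) _ _ _

pendant-F3 : Pendant C (F f3) (xOf f3) 4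
pendant-F3 = pendant-check (F f3)
  ((# 0 , # 0 ∷ # 2 ∷ # 0 ∷ # 0 ∷ # 2 ∷ []) ∷
   (# 2 , # 1 ∷ # 0 ∷ # 2 ∷ # 0 ∷ # 1 ∷ []) ∷
   (# 0 , # 1 ∷ # 1 ∷ # 0 ∷ # 2 ∷ # 0 ∷ []) ∷
   (# 2 , # 2 ∷ # 0 ∷ # 0 ∷ # 1 ∷ # 1 ∷ []) ∷ [])
  lowerBound-F3 (λ ()) _ _ _

pendant-F4 : Pendant D (F f4) (xOf f4) 2
pendant-F4 = pendant-check (F f4)
  ((# 0 , # 0 ∷ # 2 ∷ # 0 ∷ []) ∷
   (# 2 , # 0 ∷ # 0 ∷ # 2 ∷ []) ∷
   (# 2 , # 0 ∷ # 1 ∷ # 1 ∷ []) ∷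
   (# 1 , # 0 ∷ # 2 ∷ # 0 ∷ []) ∷
   -- Weight 3, one above the bound 2: with value 2 at the root the edge between the D-vertices
   -- still costs 1. This is the witness used with `u` lowered from 1 to 0.
   (# 0 , # 2 ∷ # 0 ∷ # 1 ∷ []) ∷ [])
  lowerBound-F4 (λ _ g a e → demand-check (F f4) {3} (xOf f4) _ g a e) _ _ _

rigid-H1 : Rigid (H h1) 2
rigid-H1 = rigid-check (H h1) ((# 0 ∷ # 2 ∷ []) ∷
  (# 1 ∷ # 1 ∷ []) ∷
  (# 2 ∷ # 0 ∷ []) ∷ []) (lowerBound-check (H h1) _) _ _ _

rigid-H2 : Rigid (H h2) 3
rigid-H2 = rigid-check (H h2) ((# 0 ∷ # 2 ∷ # 0 ∷ # 1 ∷ []) ∷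
  (# 1 ∷ # 0 ∷ # 2 ∷ # 0 ∷ []) ∷ []) (lowerBound-check (H h2) _) _ _ _

-- Deleting the edge between the two C-vertices of H₃, …, H₇ leaves two of the paths F₁, F₂, F₃.
lowerBound-join : ∀ k l {W W′} → O1ok k → O1ok l → LowerBound (F k) W → LowerBound (F l) W′ →
  LowerBound (attach (F k) (xOf k) (F l) (xOf l)) (W + W′)
lowerBound-join k l ok ok′ low low′ = lowerBound-attach (xOf k) (inj₁ (x-C ok)) (x-C ok′) low low′
  λ wk → contradiction (x-C ok) (weak≢C wk)
  where
  x-C : ∀ {k} → O1ok k → lab (F k) (xOf k) ≡ C
  x-C o1 = refl
  x-C o2 = refl
  x-C o3 = refl

rigid-H3 : Rigid (H h3) 4
rigid-H3 = rigid-check (H h3)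
  ((# 0 ∷ # 2 ∷ # 1 ∷ # 1 ∷ # 0 ∷ # 0 ∷ []) ∷
   (# 2 ∷ # 0 ∷ # 0 ∷ # 0 ∷ # 1 ∷ # 1 ∷ []) ∷ [])
  (lowerBound-iso (iso-check (# 2 ∷ # 0 ∷ # 3 ∷ # 4 ∷ # 1 ∷ # 5 ∷ [])
                             (# 1 ∷ # 4 ∷ # 0 ∷ # 2 ∷ # 3 ∷ # 5 ∷ []) _)
    (lowerBound-join f1 f1 o1 o1 lowerBound-F1 lowerBound-F1)) _ _ _

rigid-H4 : Rigid (H h4) 5
rigid-H4 = rigid-check (H h4)
  ((# 0 ∷ # 2 ∷ # 1 ∷ # 1 ∷ # 0 ∷ # 0 ∷ # 1 ∷ []) ∷
   (# 2 ∷ # 0 ∷ # 0 ∷ # 0 ∷ # 1 ∷ # 2 ∷ # 0 ∷ []) ∷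
   (# 2 ∷ # 0 ∷ # 0 ∷ # 0 ∷ # 1 ∷ # 0 ∷ # 2 ∷ []) ∷
   (# 2 ∷ # 0 ∷ # 0 ∷ # 0 ∷ # 1 ∷ # 1 ∷ # 1 ∷ []) ∷ [])
  (lowerBound-iso (iso-check (# 2 ∷ # 0 ∷ # 3 ∷ # 4 ∷ # 1 ∷ # 5 ∷ # 6 ∷ [])
                             (# 1 ∷ # 4 ∷ # 0 ∷ # 2 ∷ # 3 ∷ # 5 ∷ # 6 ∷ []) _)
    (lowerBound-join f1 f2 o1 o2 lowerBound-F1 lowerBound-F2)) _ _ _

rigid-H5 : Rigid (H h5) 6
rigid-H5 = rigid-check (H h5)
  ((# 0 ∷ # 0 ∷ # 1 ∷ # 2 ∷ # 0 ∷ # 1 ∷ # 2 ∷ # 0 ∷ []) ∷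
   (# 2 ∷ # 2 ∷ # 0 ∷ # 0 ∷ # 1 ∷ # 0 ∷ # 0 ∷ # 1 ∷ []) ∷
   (# 0 ∷ # 2 ∷ # 1 ∷ # 0 ∷ # 2 ∷ # 0 ∷ # 0 ∷ # 1 ∷ []) ∷
   (# 0 ∷ # 2 ∷ # 1 ∷ # 1 ∷ # 1 ∷ # 0 ∷ # 0 ∷ # 1 ∷ []) ∷
   (# 2 ∷ # 0 ∷ # 0 ∷ # 0 ∷ # 1 ∷ # 1 ∷ # 0 ∷ # 2 ∷ []) ∷
   (# 2 ∷ # 0 ∷ # 0 ∷ # 0 ∷ # 1 ∷ # 1 ∷ # 1 ∷ # 1 ∷ []) ∷ [])
  (lowerBound-iso (iso-check (# 2 ∷ # 0 ∷ # 3 ∷ # 4 ∷ # 5 ∷ # 1 ∷ # 6 ∷ # 7 ∷ [])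
                             (# 1 ∷ # 5 ∷ # 0 ∷ # 2 ∷ # 3 ∷ # 4 ∷ # 6 ∷ # 7 ∷ []) _)
    (lowerBound-join f2 f2 o2 o2 lowerBound-F2 lowerBound-F2)) _ _ _

rigid-H6 : Rigid (H h6) 6
rigid-H6 = rigid-check (H h6)
  ((# 0 ∷ # 2 ∷ # 1 ∷ # 1 ∷ # 0 ∷ # 1 ∷ # 0 ∷ # 1 ∷ []) ∷
   (# 2 ∷ # 0 ∷ # 0 ∷ # 0 ∷ # 2 ∷ # 0 ∷ # 2 ∷ # 0 ∷ []) ∷
   (# 2 ∷ # 0 ∷ # 0 ∷ # 0 ∷ # 0 ∷ # 2 ∷ # 0 ∷ # 2 ∷ []) ∷
   (# 2 ∷ # 0 ∷ # 0 ∷ # 0 ∷ # 1 ∷ # 1 ∷ # 1 ∷ # 1 ∷ []) ∷ [])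
  (lowerBound-iso (iso-check (# 2 ∷ # 0 ∷ # 3 ∷ # 5 ∷ # 4 ∷ # 1 ∷ # 6 ∷ # 7 ∷ [])
                             (# 1 ∷ # 5 ∷ # 0 ∷ # 2 ∷ # 4 ∷ # 3 ∷ # 6 ∷ # 7 ∷ []) _)
    (lowerBound-join f1 f3 o1 o3 lowerBound-F1 lowerBound-F3)) _ _ _

rigid-H7 : Rigid (H h7) 7
rigid-H7 = rigid-check (H h7)
  ((# 0 ∷ # 0 ∷ # 1 ∷ # 2 ∷ # 0 ∷ # 0 ∷ # 2 ∷ # 2 ∷ # 0 ∷ []) ∷
   (# 2 ∷ # 0 ∷ # 0 ∷ # 0 ∷ # 1 ∷ # 1 ∷ # 1 ∷ # 0 ∷ # 2 ∷ []) ∷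
   (# 0 ∷ # 0 ∷ # 1 ∷ # 2 ∷ # 0 ∷ # 2 ∷ # 0 ∷ # 1 ∷ # 1 ∷ []) ∷
   (# 0 ∷ # 2 ∷ # 1 ∷ # 0 ∷ # 2 ∷ # 0 ∷ # 1 ∷ # 0 ∷ # 1 ∷ []) ∷
   (# 0 ∷ # 2 ∷ # 1 ∷ # 1 ∷ # 1 ∷ # 0 ∷ # 1 ∷ # 0 ∷ # 1 ∷ []) ∷ [])
  (lowerBound-iso (iso-check (# 2 ∷ # 0 ∷ # 3 ∷ # 4 ∷ # 6 ∷ # 5 ∷ # 1 ∷ # 7 ∷ # 8 ∷ [])
                             (# 1 ∷ # 6 ∷ # 0 ∷ # 2 ∷ # 3 ∷ # 5 ∷ # 4 ∷ # 7 ∷ # 8 ∷ []) _)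
    (lowerBound-join f2 f3 o2 o3 lowerBound-F2 lowerBound-F3)) _ _ _

H-symmetric : ∀ k i j → adj (H k) i j ≡ adj (H k) j i
H-symmetric h1 = toWitness {a? = Fin.all? λ i → Fin.all? λ j → _ ≟B _} _
H-symmetric h2 = toWitness {a? = Fin.all? λ i → Fin.all? λ j → _ ≟B _} _
H-symmetric h3 = toWitness {a? = Fin.all? λ i → Fin.all? λ j → _ ≟B _} _
H-symmetric h4 = toWitness {a? = Fin.all? λ i → Fin.all? λ j → _ ≟B _} _
H-symmetric h5 = toWitness {a? = Fin.all? λ i → Fin.all? λ j → _ ≟B _} _
H-symmetric h6 = toWitness {a? = Fin.all? λ i → Fin.all? λ j → _ ≟B _} _
H-symmetric h7 = toWitness {a? = Fin.all? λ i → Fin.all? λ j → _ ≟B _} _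

A-neighbours? : ∀ G → Dec (∀ v → lab G v ≡ A → ∀ y → T (adj G v y) → lab G y ≡ C)
A-neighbours? G = Fin.all? λ v → (lab G v ≟S A) →-dec (Fin.all? λ y → T? (adj G v y) →-dec (lab G y ≟S C))

A-neighbours : ∀ {k} → O4ok k → ∀ v → lab (H k) v ≡ A → ∀ y → T (adj (H k) v y) → lab (H k) y ≡ C
A-neighbours k3 = toWitness {a? = A-neighbours? (H h3)} _
A-neighbours k4 = toWitness {a? = A-neighbours? (H h4)} _
A-neighbours k6 = toWitness {a? = A-neighbours? (H h6)} _

built-rigid : ∀ {G} → Built G → ∃ (Rigid G)
built-rigid (start .h1 s1) = _ , rigid-H1
built-rigid (start .h2 s2) = _ , rigid-H2
built-rigid (start .h3 s3) = _ , rigid-H3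
built-rigid (start .h4 s4) = _ , rigid-H4
built-rigid (start .h5 s5) = _ , rigid-H5
built-rigid (op1 b u uC .f1 o1) with built-rigid b
... | _ , r = _ , Attach.rigid-attach r u (inj₁ uC) refl (subst (λ s → Pendant s (F f1) (xOf f1) 2) (sym uC) pendant-F1)
built-rigid (op1 b u uC .f2 o2) with built-rigid b
... | _ , r = _ , Attach.rigid-attach r u (inj₁ uC) refl (subst (λ s → Pendant s (F f2) (xOf f2) 3) (sym uC) pendant-F2)
built-rigid (op1 b u uC .f3 o3) with built-rigid b
... | _ , r = _ , Attach.rigid-attach r u (inj₁ uC) refl (subst (λ s → Pendant s (F f3) (xOf f3) 4) (sym uC) pendant-F3)
built-rigid (op2 b u uD) with built-rigid b
... | _ , r = _ , Attach.rigid-attach r u (inj₂ (subst Weak (sym uD) weakD)) refl (subst (λ s → Pendant s (F f4) (xOf f4) 2) (sym uD) pendant-F4)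
built-rigid (op3 b u uA k ok v vA) with built-rigid b
built-rigid (op3 b u uA .h2 k2 v vA) | _ , r = _ , Glue.rigid-glue r u (H-symmetric h2) rigid-H2 v vA (inj₁ uA)
built-rigid (op3 b u uA .h3 k3 v vA) | _ , r = _ , Glue.rigid-glue r u (H-symmetric h3) rigid-H3 v vA (inj₁ uA)
built-rigid (op3 b u uA .h4 k4 v vA) | _ , r = _ , Glue.rigid-glue r u (H-symmetric h4) rigid-H4 v vA (inj₁ uA)
built-rigid (op3 b u uA .h5 k5 v vA) | _ , r = _ , Glue.rigid-glue r u (H-symmetric h5) rigid-H5 v vA (inj₁ uA)
built-rigid (op3 b u uA .h6 k6 v vA) | _ , r = _ , Glue.rigid-glue r u (H-symmetric h6) rigid-H6 v vA (inj₁ uA)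
built-rigid (op3 b u uA .h7 k7 v vA) | _ , r = _ , Glue.rigid-glue r u (H-symmetric h7) rigid-H7 v vA (inj₁ uA)
built-rigid (op4 b u uD k ok v vA) with built-rigid b
built-rigid (op4 b u uD .h3 k3 v vA) | _ , r = _ , Glue.rigid-glue r u (H-symmetric h3) rigid-H3 v vA (inj₂ (uD , A-neighbours k3 v vA))
built-rigid (op4 b u uD .h4 k4 v vA) | _ , r = _ , Glue.rigid-glue r u (H-symmetric h4) rigid-H4 v vA (inj₂ (uD , A-neighbours k4 v vA))
built-rigid (op4 b u uD .h6 k6 v vA) | _ , r = _ , Glue.rigid-glue r u (H-symmetric h6) rigid-H6 v vA (inj₂ (uD , A-neighbours k6 v vA))

-- Statuses and attained values

module _ {G K : LTree} (φ : LIso G K) where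
  private
    ψ : LIso K G
    ψ = LIso-sym φ
  open LIso φ

  twoWeakNeighbours-iso : ∀ j → TwoWeakNeighbours G (from j) → TwoWeakNeighbours K j
  twoWeakNeighbours-iso j (a , b , a≢b , wa , wb , ea , eb) = to a , to b ,
    (λ e → a≢b (trans (sym (from∘to a)) (trans (cong from e) (from∘to b)))) ,
    subst Weak (sym (lab-pres a)) wa , subst Weak (sym (lab-pres b)) wb ,
    subst (λ i → Edge (adj K) i (to a)) (to∘from j) (edge-to φ ea) ,
    subst (λ i → Edge (adj K) i (to b)) (to∘from j) (edge-to φ eb)

  rigid-iso : ∀ {W} → Rigid G W → Rigid K W
  rigid-iso {W} r = record
    { lower = lowerBound-iso φ R.lower
    ; attained = attained
    ; bStructure = bStructure
    ; cStructure = λ j l → twoWeakNeighbours-iso j (R.cStructure (from j) (trans (lab-from φ j) l))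
    }
    where
    module R = Rigid r
    attained : AllAttained K W
    attained j k al with R.attained (from j) k (subst (λ s → Allowed s k) (sym (lab-from φ j)) al)
    ... | f , rdf , c , w , e = f ∘ from ,
      (λ v z → subst (Dominated K (f ∘ from)) (to∘from v) (dominated-to φ (rdf (from v) z))) ,
      (λ v → subst (λ s → Allowed s _) (lab-from φ v) (c (from v))) ,
      trans (weight-iso ψ f) w , e

    bStructure : BStructure K
    bStructure j l with R.bStructure (from j) (trans (lab-from φ j) l)
    ... | a , b , wa , sb , ea , eb , only = to a , to b ,
      subst Weak (sym (lab-pres a)) wa , subst Strong (sym (lab-pres b)) sb ,
      subst (λ i → Edge (adj K) i (to a)) (to∘from j) (edge-to φ ea) ,
      subst (λ i → Edge (adj K) i (to b)) (to∘from j) (edge-to φ eb) ,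
      λ w e → [ (λ p → inj₁ (trans (sym (to∘from w)) (cong to p))) , (λ p → inj₂ (trans (sym (to∘from w)) (cong to p))) ]′
        (only (from w) (edge-from φ e))

δ : ∀ {n} → Fin n → Fin n → ℕ
δ a u = if does (u ≟F a) then 1 else 0

sum-δ : ∀ {n} (a : Fin n) → sum (δ a) ≡ 1
sum-δ {suc n} zero    = cong suc (sum-zero n)
  where
  sum-zero : ∀ n → sum {n} (λ _ → 0) ≡ 0
  sum-zero zero    = refl
  sum-zero (suc n) = sum-zero n
sum-δ {suc n} (suc a) = sum-δ a

δ-≢ : ∀ {n} {a u : Fin n} → u ≢ a → δ a u ≡ 0
δ-≢ {a = a} {u} u≢a with u ≟F a
... | yes e = contradiction e u≢a
... | no _  = refl

sum-mono-≤ : ∀ {n} {f g : Fin n → ℕ} → (∀ i → f i ≤ g i) → sum f ≤ sum g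
sum-mono-≤ {zero}  p = z≤n
sum-mono-≤ {suc n} p = ℕ.+-mono-≤ (p zero) (sum-mono-≤ (p ∘ suc))

module Degree {n} (adj : Adj n) (x : Fin n) where
  private
    e : Fin n → ℕ
    e u = if adj x u then 1 else 0

    e-1 : ∀ {u} → Edge adj x u → e u ≡ 1
    e-1 {u} p with adj x u
    ... | true = refl

    e-0 : ∀ {u} → ¬ Edge adj x u → e u ≡ 0
    e-0 {u} p with adj x u
    ... | true  = contradiction tt p
    ... | false = refl

  deg-two : ∀ {a b} → a ≢ b → Edge adj x a → Edge adj x b → (∀ w → Edge adj x w → w ≡ a ⊎ w ≡ b) → deg adj x ≡ 2
  deg-two {a} {b} a≢b ea eb only = begin
    deg adj x                   ≡⟨ sum-allFin e ⟩
    sum e                       ≡⟨ sum-cong-≗ pointwise ⟩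
    sum (λ u → δ a u + δ b u)   ≡⟨ ∑-distrib-+ (δ a) (δ b) ⟩
    sum (δ a) + sum (δ b)       ≡⟨ cong₂ _+_ (sum-δ a) (sum-δ b) ⟩
    2                           ∎
    where
    open ≡-Reasoning
    pointwise : ∀ u → e u ≡ δ a u + δ b u
    pointwise u with u ≟F a
    ... | yes refl = trans (e-1 ea) (cong suc (sym (δ-≢ a≢b)))
    ... | no u≢a with u ≟F b
    ... | yes refl = e-1 eb
    ... | no u≢b   = e-0 λ p → [ u≢a , u≢b ]′ (only u p)

  deg-three : ∀ {a b c} → a ≢ b → a ≢ c → b ≢ c → Edge adj x a → Edge adj x b → Edge adj x c → 3 ≤ deg adj x
  deg-three {a} {b} {c} a≢b a≢c b≢c ea eb ec = begin
    3                                   ≡⟨ cong₂ _+_ (sum-δ a) (cong₂ _+_ (sum-δ b) (sum-δ c)) ⟨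
    sum (δ a) + (sum (δ b) + sum (δ c)) ≡⟨ cong (sum (δ a) +_) (∑-distrib-+ (δ b) (δ c)) ⟨
    sum (δ a) + sum (λ u → δ b u + δ c u)     ≡⟨ ∑-distrib-+ (δ a) (λ u → δ b u + δ c u) ⟨
    sum (λ u → δ a u + (δ b u + δ c u))       ≤⟨ sum-mono-≤ pointwise ⟩
    sum e                               ≡⟨ sum-allFin e ⟨
    deg adj x                           ∎
    where
    open ℕ.≤-Reasoning
    pointwise : ∀ u → δ a u + (δ b u + δ c u) ≤ e u
    pointwise u with u ≟F a
    ... | yes refl rewrite δ-≢ a≢b | δ-≢ a≢c | e-1 ea = ℕ.≤-refl
    ... | no _ with u ≟F b
    ... | yes refl rewrite δ-≢ b≢c | e-1 eb = ℕ.≤-refl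
    ... | no _ with u ≟F c
    ... | yes refl rewrite e-1 ec = ℕ.≤-refl
    ... | no _ = z≤n

module Statuses {n} {adj : Adj n} {S : Fin n → Status} {W} (rigid : Rigid (mk n adj S) W) where
  private
    module R = Rigid rigid

  allowed-0 : ∀ s → Allowed s (# 0)
  allowed-0 A = A0
  allowed-0 B = B0
  allowed-0 C = C0
  allowed-0 D = D*

  rdf-lower : ∀ {f} → IsRDF adj f → W ≤ weight f × (weight f ≡ W → Compatible (mk n adj S) f)
  rdf-lower {f} rdf = R.lower f λ v _ → rdf v

  attains : ∀ {v k} → Allowed (S v) k → Attains adj v k
  attains {v} {k} al with R.attained v k al
  ... | f , rdf , _ , w , e = f , (rdf , λ g r → subst (_≤ weight g) (sym w) (proj₁ (rdf-lower r))) , e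

  allowed : ∀ {v k} → Attains adj v k → Allowed (S v) k
  -- The value 0 is allowed for every status, so `attained` yields some Roman dominating function of
  -- weight `W` against which the minimality of `f` can be tested.
  allowed {v} (f , (rdf , min) , refl) with R.attained v (# 0) (allowed-0 (S v))
  ... | g , r , _ , w , _ = proj₂ (rdf-lower rdf) (ℕ.≤-antisym (subst (weight f ≤_) w (min g r)) (proj₁ (rdf-lower rdf))) v

  excellent : Excellent adj
  excellent v = let k , al , k≢0 = nonzero (S v) ; f , γ , e = attains al in f , γ , λ z → k≢0 (trans (sym e) z)
    where
    nonzero : ∀ s → ∃ λ k → Allowed s k × k ≢ # 0
    nonzero A = # 1 , A1 , λ ()
    nonzero B = # 2 , B2 , λ ()
    nonzero C = # 2 , C2 , λ ()
    nonzero D = # 2 , D* , λ ()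

  A⇔V01 : ∀ x → (S x ≡ A) ⇔ V01 adj x
  A⇔V01 x = mk⇔
    (λ e → attains (subst (λ s → Allowed s _) (sym e) A0) , attains (subst (λ s → Allowed s _) (sym e) A1) ,
      λ a → contradiction (subst (λ s → Allowed s _) e (allowed a)) λ ())
    λ { (_ , a1 , ¬a2) → only (S x) (allowed a1) (¬a2 ∘ attains) }
    where
    only : ∀ s → Allowed s (# 1) → ¬ Allowed s (# 2) → s ≡ A
    only A _ _  = refl
    only D _ ¬2 = contradiction D* ¬2

  D⇔V012 : ∀ x → (S x ≡ D) ⇔ V012 adj x
  D⇔V012 x = mk⇔
    (λ e → let al = λ {k} → attains {x} {k} (subst (λ s → Allowed s k) (sym e) D*) in al , al , al)
    λ { (_ , a1 , a2) → only (S x) (allowed a1) (allowed a2) }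
    where
    only : ∀ s → Allowed s (# 1) → Allowed s (# 2) → s ≡ D
    only D _ _ = refl

  Strong⇒V02 : ∀ {x} → Strong (S x) → V02 adj x
  Strong⇒V02 {x} st = attains (allowed-0 (S x)) , (λ a → not1 st (allowed a)) , attains (two st)
    where
    not1 : ∀ {s} → Strong s → ¬ Allowed s (# 1)
    not1 strongB ()
    not1 strongC ()
    two : ∀ {s} → Strong s → Allowed s (# 2)
    two strongB = B2
    two strongC = C2

  V02⇒Strong : ∀ {x} → V02 adj x → Strong (S x)
  V02⇒Strong {x} (_ , ¬a1 , a2) = strong (S x) (¬a1 ∘ attains) (allowed a2)
    where
    strong : ∀ s → ¬ Allowed s (# 1) → Allowed s (# 2) → Strong s
    strong B _ _ = strongB
    strong C _ _ = strongC
    strong D ¬1 _ = contradiction D* ¬1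

  weak≢strong : ∀ {u v} → Weak (S u) → Strong (S v) → u ≢ v
  weak≢strong w s refl = clash w s
    where
    clash : ∀ {s} → Weak s → ¬ Strong s
    clash weakA ()
    clash weakD ()

  -- A C-vertex has two neighbours outside V⁰²; a neighbour in V⁰² would be a third, so degree 2
  -- excludes status C.
  B⇔SB : ∀ x → (S x ≡ B) ⇔ SB-set adj x
  B⇔SB x = mk⇔ to from
    where
    to : S x ≡ B → SB-set adj x
    to e with R.bStructure x e
    ... | a , b , wa , sb , ea , eb , only =
      Strong⇒V02 (subst Strong (sym e) strongB) , Degree.deg-two adj x (weak≢strong wa sb) ea eb only ,
      b , eb , Strong⇒V02 sb ,
      λ w ew vw → [ (λ w≡a → contradiction (sym w≡a) (weak≢strong wa (V02⇒Strong vw))) , (λ w≡b → w≡b) ]′ (only w ew)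

    from : SB-set adj x → S x ≡ B
    from (v02 , d , u , eu , vu , _) with S x in e | V02⇒Strong v02
    ... | B | _ = refl
    ... | C | _ with R.cStructure x e
    ... | a , b , a≢b , wa , wb , ea , eb =
      contradiction (subst (3 ≤_) d (Degree.deg-three adj x a≢b (weak≢strong wa (V02⇒Strong vu)) (weak≢strong wb (V02⇒Strong vu)) ea eb eu))
        λ { (s≤s (s≤s ())) }

  C⇔V02∖B : ∀ x → (S x ≡ C) ⇔ (V02 adj x × ¬ (S x ≡ B))
  C⇔V02∖B x = mk⇔
    (λ e → Strong⇒V02 (subst Strong (sym e) strongC) , λ b → contradiction (trans (sym e) b) λ ())
    λ { (v02 , ¬b) → only (V02⇒Strong v02) ¬b }
    where
    only : ∀ {s} → Strong s → s ≢ B → s ≡ C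
    only strongB ¬b = contradiction refl ¬b
    only strongC _  = refl

-- Rooted trees

-- The vertices form an arbitrary type, so that joining graphs is a disjoint sum and isomorphisms
-- are given by pattern matching, without index arithmetic in `Fin`.
record Graph (X : Set) : Set₁ where
  constructor graph
  field
    V : Set
    E : V → V → Bool
    ℓ : V → X
open Graph public

infix 4 _≅_
record _≅_ {X : Set} (G K : Graph X) : Set where
  field
    to      : V G → V K
    from    : V K → V G
    from∘to : ∀ i → from (to i) ≡ i
    to∘from : ∀ j → to (from j) ≡ j
    E-pres  : ∀ i j → E K (to i) (to j) ≡ E G i j
    ℓ-pres  : ∀ i → ℓ K (to i) ≡ ℓ G i

inl : {A B : Set} → (A → Bool) → A ⊎ B → Bool
inl p = [ p , const false ]′

inr : {A B : Set} → (B → Bool) → A ⊎ B → Bool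
inr p = [ const false , p ]′

module _ {X : Set} where
  ≅-refl : {G : Graph X} → G ≅ G
  ≅-refl = record
    { to = λ i → i ; from = λ i → i ; from∘to = λ _ → refl ; to∘from = λ _ → refl
    ; E-pres = λ _ _ → refl ; ℓ-pres = λ _ → refl }

  ≅-sym : {G K : Graph X} → G ≅ K → K ≅ G
  ≅-sym {G} {K} φ = record
    { to = from ; from = to ; from∘to = to∘from ; to∘from = from∘to
    ; E-pres = λ i j → trans (sym (E-pres (from i) (from j))) (cong₂ (E K) (to∘from i) (to∘from j))
    ; ℓ-pres = λ i → trans (sym (ℓ-pres (from i))) (cong (ℓ K) (to∘from i)) }
    where open _≅_ φ

  ≅-trans : {G K L : Graph X} → G ≅ K → K ≅ L → G ≅ L
  ≅-trans φ ψ = record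
    { to = ψ.to ∘ φ.to ; from = φ.from ∘ ψ.from
    ; from∘to = λ i → trans (cong φ.from (ψ.from∘to (φ.to i))) (φ.from∘to i)
    ; to∘from = λ j → trans (cong ψ.to (φ.to∘from (ψ.from j))) (ψ.to∘from j)
    ; E-pres = λ i j → trans (ψ.E-pres (φ.to i) (φ.to j)) (φ.E-pres i j)
    ; ℓ-pres = λ i → trans (ψ.ℓ-pres (φ.to i)) (φ.ℓ-pres i) }
    where
    module φ = _≅_ φ
    module ψ = _≅_ ψ

  Subset : Graph X → Set
  Subset G = V G → Bool

  linkE : (G : Graph X) → Subset G → (K : Graph X) → Subset K → V G ⊎ V K → V G ⊎ V K → Bool
  linkE G p K q (inj₁ a) (inj₁ b) = E G a b
  linkE G p K q (inj₁ a) (inj₂ b) = p a ∧ q b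
  linkE G p K q (inj₂ a) (inj₁ b) = p b ∧ q a
  linkE G p K q (inj₂ a) (inj₂ b) = E K a b

  -- Subsets instead of vertices cover both operations: for attaching, both are singletons; for
  -- gluing, the second is the set of neighbours of the identified vertex in the piece.
  link : (G : Graph X) → Subset G → (K : Graph X) → Subset K → Graph X
  link G p K q = graph (V G ⊎ V K) (linkE G p K q) [ ℓ G , ℓ K ]′

  link-cong : ∀ {G G′ K K′ : Graph X} {p p′ q q′} (φ : G ≅ G′) (ψ : K ≅ K′) →
    (∀ i → p′ (_≅_.to φ i) ≡ p i) → (∀ j → q′ (_≅_.to ψ j) ≡ q j) → link G p K q ≅ link G′ p′ K′ q′
  link-cong φ ψ ep eq = record
    { to = Sum.map φ.to ψ.to ; from = Sum.map φ.from ψ.from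
    ; from∘to = λ { (inj₁ i) → cong inj₁ (φ.from∘to i) ; (inj₂ i) → cong inj₂ (ψ.from∘to i) }
    ; to∘from = λ { (inj₁ i) → cong inj₁ (φ.to∘from i) ; (inj₂ i) → cong inj₂ (ψ.to∘from i) }
    ; E-pres = λ { (inj₁ i) (inj₁ j) → φ.E-pres i j ; (inj₁ i) (inj₂ j) → cong₂ _∧_ (ep i) (eq j)
                 ; (inj₂ i) (inj₁ j) → cong₂ _∧_ (ep j) (eq i) ; (inj₂ i) (inj₂ j) → ψ.E-pres i j }
    ; ℓ-pres = λ { (inj₁ i) → φ.ℓ-pres i ; (inj₂ i) → ψ.ℓ-pres i } }
    where
    module φ = _≅_ φ
    module ψ = _≅_ ψ

  link-comm : ∀ {G K : Graph X} {p q} → link G p K q ≅ link K q G p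
  link-comm {p = p} {q} = record
    { to = Sum.swap ; from = Sum.swap ; from∘to = swap² ; to∘from = swap²
    ; E-pres = λ { (inj₁ i) (inj₁ j) → refl ; (inj₁ i) (inj₂ j) → ∧-comm (q j) (p i)
                 ; (inj₂ i) (inj₁ j) → ∧-comm (q i) (p j) ; (inj₂ i) (inj₂ j) → refl }
    ; ℓ-pres = λ { (inj₁ i) → refl ; (inj₂ i) → refl } }
    where
    swap² : ∀ {A B : Set} (x : A ⊎ B) → Sum.swap (Sum.swap x) ≡ x
    swap² (inj₁ _) = refl
    swap² (inj₂ _) = refl

  link-swap : ∀ {G K L : Graph X} {p p′ q r} →
    link (link G p K q) (inl p′) L r ≅ link (link G p′ L r) (inl p) K q
  link-swap {G} {K} {L} = record
    { to = exchange ; from = exchange ; from∘to = exchange² ; to∘from = exchange²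
    ; E-pres = λ { (inj₁ (inj₁ _)) (inj₁ (inj₁ _)) → refl ; (inj₁ (inj₁ _)) (inj₁ (inj₂ _)) → refl
                 ; (inj₁ (inj₁ _)) (inj₂ _) → refl ; (inj₁ (inj₂ _)) (inj₁ (inj₁ _)) → refl
                 ; (inj₁ (inj₂ _)) (inj₁ (inj₂ _)) → refl ; (inj₁ (inj₂ _)) (inj₂ _) → refl
                 ; (inj₂ _) (inj₁ (inj₁ _)) → refl ; (inj₂ _) (inj₁ (inj₂ _)) → refl ; (inj₂ _) (inj₂ _) → refl }
    ; ℓ-pres = λ { (inj₁ (inj₁ _)) → refl ; (inj₁ (inj₂ _)) → refl ; (inj₂ _) → refl } }
    where
    exchange : ∀ {A B C : Set} → (A ⊎ B) ⊎ C → (A ⊎ C) ⊎ B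
    exchange (inj₁ (inj₁ a)) = inj₁ (inj₁ a)
    exchange (inj₁ (inj₂ b)) = inj₂ b
    exchange (inj₂ c)        = inj₁ (inj₂ c)
    exchange² : ∀ {A B C : Set} (x : (A ⊎ B) ⊎ C) → exchange (exchange x) ≡ x
    exchange² (inj₁ (inj₁ _)) = refl
    exchange² (inj₁ (inj₂ _)) = refl
    exchange² (inj₂ _)        = refl

  link-assoc : ∀ {G K L : Graph X} {p q q′ r} →
    link G p (link K q L r) (inl q′) ≅ link (link G p K q′) (inr q) L r
  link-assoc {p = p} = record
    { to = Sum.assocˡ ; from = Sum.assocʳ
    ; from∘to = λ { (inj₁ _) → refl ; (inj₂ (inj₁ _)) → refl ; (inj₂ (inj₂ _)) → refl }
    ; to∘from = λ { (inj₁ (inj₁ _)) → refl ; (inj₁ (inj₂ _)) → refl ; (inj₂ _) → refl }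
    ; E-pres = λ { (inj₁ _) (inj₁ _) → refl ; (inj₁ _) (inj₂ (inj₁ _)) → refl
                 ; (inj₁ i) (inj₂ (inj₂ _)) → sym (∧-zeroʳ (p i)) ; (inj₂ (inj₁ _)) (inj₁ _) → refl
                 ; (inj₂ (inj₁ _)) (inj₂ (inj₁ _)) → refl ; (inj₂ (inj₁ _)) (inj₂ (inj₂ _)) → refl
                 ; (inj₂ (inj₂ _)) (inj₁ j) → sym (∧-zeroʳ (p j)) ; (inj₂ (inj₂ _)) (inj₂ (inj₁ _)) → refl
                 ; (inj₂ (inj₂ _)) (inj₂ (inj₂ _)) → refl }
    ; ℓ-pres = λ { (inj₁ _) → refl ; (inj₂ (inj₁ _)) → refl ; (inj₂ (inj₂ _)) → refl } }

-- t ▸ k is t with the tree k hung below its root.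
infixl 6 _▸_
data Tr (X : Set) : Set where
  leaf : X → Tr X
  _▸_  : Tr X → Tr X → Tr X

module _ {X : Set} where
  mutual
    ⟦_⟧ : Tr X → Graph X
    ⟦ leaf x ⟧ = graph ⊤ (λ _ _ → false) (λ _ → x)
    ⟦ t ▸ k ⟧  = link ⟦ t ⟧ (isRoot t) ⟦ k ⟧ (isRoot k)

    isRoot : (t : Tr X) → Subset ⟦ t ⟧
    isRoot (leaf x) _ = true
    isRoot (t ▸ k)    = inl (isRoot t)

  root : (t : Tr X) → V ⟦ t ⟧
  root (leaf x) = tt
  root (t ▸ k)  = inj₁ (root t)

  isRoot-root : ∀ t → isRoot t (root t) ≡ true
  isRoot-root (leaf x) = refl
  isRoot-root (t ▸ k)  = isRoot-root t

  isRoot⇒root : ∀ t v → T (isRoot t v) → v ≡ root t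
  isRoot⇒root (leaf x) v        _ = refl
  isRoot⇒root (t ▸ k)  (inj₁ v) p = cong inj₁ (isRoot⇒root t v p)

  order : Tr X → ℕ
  order (leaf x) = 1
  order (t ▸ k)  = order t + order k

  pos : (t : Tr X) → Fin (order t) → V ⟦ t ⟧
  pos (leaf x) _ = tt
  pos (t ▸ k)  i = Sum.map (pos t) (pos k) (splitAt (order t) i)

  index : (t : Tr X) → V ⟦ t ⟧ → Fin (order t)
  index (leaf x) _ = zero
  index (t ▸ k)  v = join (order t) (order k) (Sum.map (index t) (index k) v)

  pos-index : ∀ t v → pos t (index t v) ≡ v
  pos-index (leaf x) tt = refl
  pos-index (t ▸ k) (inj₁ v) rewrite Fin.splitAt-↑ˡ (order t) (index t v) (order k) = cong inj₁ (pos-index t v)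
  pos-index (t ▸ k) (inj₂ v) rewrite Fin.splitAt-↑ʳ (order t) (order k) (index k v) = cong inj₂ (pos-index k v)

  index-pos : ∀ t i → index t (pos t i) ≡ i
  index-pos (leaf x) zero = refl
  index-pos (t ▸ k) i = trans (cong (join (order t) (order k)) (go (splitAt (order t) i))) (Fin.join-splitAt (order t) (order k) i)
    where
    go : ∀ s → Sum.map (index t) (index k) (Sum.map (pos t) (pos k) s) ≡ s
    go (inj₁ i) = cong inj₁ (index-pos t i)
    go (inj₂ i) = cong inj₂ (index-pos k i)

⌈_⌉ : LTree → Graph Status
⌈ G ⌉ = graph (Fin (size G)) (adj G) (lab G)

LIso⇒≅ : ∀ {G K} → LIso G K → ⌈ G ⌉ ≅ ⌈ K ⌉
LIso⇒≅ φ = record { to = to ; from = from ; from∘to = from∘to ; to∘from = to∘from ; E-pres = adj-pres ; ℓ-pres = lab-pres }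
  where open LIso φ

≅⇒LIso : ∀ {G K} → ⌈ G ⌉ ≅ ⌈ K ⌉ → LIso G K
≅⇒LIso φ = record { to = to ; from = from ; from∘to = from∘to ; to∘from = to∘from ; adj-pres = E-pres ; lab-pres = ℓ-pres }
  where open _≅_ φ

flat : Tr Status → LTree
flat t = mk (order t) (λ i j → E ⟦ t ⟧ (pos t i) (pos t j)) (ℓ ⟦ t ⟧ ∘ pos t)

flat≅ : ∀ t → ⌈ flat t ⌉ ≅ ⟦ t ⟧
flat≅ t = record
  { to = pos t ; from = index t ; from∘to = index-pos t ; to∘from = pos-index t
  ; E-pres = λ _ _ → refl ; ℓ-pres = λ _ → refl }

hook≅link : ∀ G u {m} (b : Adj m) t h →
  ⌈ Hook.X G u b t h ⌉ ≅ link ⌈ G ⌉ (λ a → ⌊ a ≟F u ⌋) (graph (Fin m) b t) h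
hook≅link G u {m} b t h = ≅-sym record
  { to = join n m ; from = splitAt n
  ; from∘to = Fin.splitAt-join n m ; to∘from = Fin.join-splitAt n m
  ; E-pres = λ { (inj₁ i) (inj₁ j) → combine-ll _ _ x i j ; (inj₁ i) (inj₂ j) → combine-lr _ _ x i j
               ; (inj₂ i) (inj₁ j) → combine-rl _ _ x i j ; (inj₂ i) (inj₂ j) → combine-rr _ _ x i j }
  ; ℓ-pres = λ { (inj₁ i) → J.lab-l i ; (inj₂ j) → J.lab-r j } }
  where
  module J = Hook G u b t h
  open J using (n)
  x : Fin n → Fin m → Bool
  x a y = ⌊ a ≟F u ⌋ ∧ h y

-- Contexts and grafting

IsPoint : {A : Set} → (A → Bool) → A → Set
IsPoint h v = T (h v) × (∀ w → T (h w) → w ≡ v)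

-- A zipper read from the hole outwards: the outermost constructor is the layer next to the hole.
data Context (X : Set) : Set where
  □   : Context X
  inL : Context X → Tr X → Context X
  inR : Tr X → Context X → Context X

module _ {X : Set} where
  plug : Context X → Tr X → Tr X
  plug □         t = t
  plug (inL Γ k) t = plug Γ (t ▸ k)
  plug (inR s Γ) t = plug Γ (s ▸ t)

  lift : ∀ Γ t → Subset ⟦ t ⟧ → Subset ⟦ plug Γ t ⟧
  lift □         t h = h
  lift (inL Γ k) t h = lift Γ (t ▸ k) (inl h)
  lift (inR s Γ) t h = lift Γ (s ▸ t) (inr h)

  embed : ∀ Γ t → V ⟦ t ⟧ → V ⟦ plug Γ t ⟧
  embed □         t v = v
  embed (inL Γ k) t v = embed Γ (t ▸ k) (inj₁ v)
  embed (inR s Γ) t v = embed Γ (s ▸ t) (inj₂ v)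

  isPoint-lift : ∀ Γ t {h v} → IsPoint h v → IsPoint (lift Γ t h) (embed Γ t v)
  isPoint-lift □         t p       = p
  isPoint-lift (inL Γ k) t (p , u) = isPoint-lift Γ (t ▸ k) (p , λ { (inj₁ w) q → cong inj₁ (u w q) ; (inj₂ w) () })
  isPoint-lift (inR s Γ) t (p , u) = isPoint-lift Γ (s ▸ t) (p , λ { (inj₂ w) q → cong inj₂ (u w q) ; (inj₁ w) () })

  ℓ-embed : ∀ Γ t v → ℓ ⟦ plug Γ t ⟧ (embed Γ t v) ≡ ℓ ⟦ t ⟧ v
  ℓ-embed □         t v = refl
  ℓ-embed (inL Γ k) t v = ℓ-embed Γ (t ▸ k) (inj₁ v)
  ℓ-embed (inR s Γ) t v = ℓ-embed Γ (s ▸ t) (inj₂ v)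

  -- The root is required to correspond to the old root, since this is what lets the isomorphism
  -- pass through each `link` of a surrounding context.
  Grafted : (K : Graph X) → Subset K → (t : Tr X) → Subset ⟦ t ⟧ → Tr X → Set
  Grafted K r t h t′ = Σ (link ⟦ t ⟧ h K r ≅ ⟦ t′ ⟧) λ φ → ∀ v → isRoot t′ (_≅_.to φ v) ≡ inl (isRoot t) v

  graft-plug : ∀ K r Γ {t h t′} → Grafted K r t h t′ → Grafted K r (plug Γ t) (lift Γ t h) (plug Γ t′)
  graft-plug K r □ φ = φ
  graft-plug K r (inL Γ k) {t} {h} (φ , e) = graft-plug K r Γ
    ( ≅-trans (link-swap {G = ⟦ t ⟧}) (link-cong φ ≅-refl e (λ _ → refl))
    , λ { (inj₁ (inj₁ v)) → e (inj₁ v) ; (inj₁ (inj₂ v)) → refl ; (inj₂ v) → e (inj₂ v) })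
  graft-plug K r (inR s Γ) {t} {h} (φ , e) = graft-plug K r Γ
    ( ≅-trans (≅-sym (link-assoc {G = ⟦ s ⟧})) (link-cong ≅-refl φ (λ _ → refl) e)
    , λ { (inj₁ (inj₁ v)) → refl ; (inj₁ (inj₂ v)) → refl ; (inj₂ v) → refl })

  graft-leaf : ∀ Γ x k → link ⟦ plug Γ (leaf x) ⟧ (lift Γ (leaf x) (const true)) ⟦ k ⟧ (isRoot k) ≅ ⟦ plug Γ (leaf x ▸ k) ⟧
  graft-leaf Γ x k = proj₁ (graft-plug ⟦ k ⟧ (isRoot k) Γ {leaf x} {const true} {leaf x ▸ k}
    (≅-refl , λ { (inj₁ _) → refl ; (inj₂ _) → refl }))

-- Messages

module _ {X : Set} where
  wt : (t : Tr X) → (V ⟦ t ⟧ → Fin 3) → ℕ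
  wt (leaf x) f = toℕ (f tt)
  wt (t ▸ k)  f = wt t (f ∘ inj₁) + wt k (f ∘ inj₂)

  wt-sum : ∀ t f → wt t f ≡ sum (λ i → toℕ (f (pos t i)))
  wt-sum (leaf x) f = sym (ℕ.+-identityʳ _)
  wt-sum (t ▸ k)  f = trans (cong₂ _+_ (wt-sum t (f ∘ inj₁)) (wt-sum k (f ∘ inj₂)))
    (sym (trans (sum-splitAt (order t) _) (cong₂ _+_
      (sum-cong-≗ λ i → cong (λ s → toℕ (f (Sum.map (pos t) (pos k) s))) (Fin.splitAt-↑ˡ (order t) i (order k)))
      (sum-cong-≗ λ j → cong (λ s → toℕ (f (Sum.map (pos t) (pos k) s))) (Fin.splitAt-↑ʳ (order t) (order k) j)))))

  DominatedIn : (t : Tr X) → (V ⟦ t ⟧ → Fin 3) → V ⟦ t ⟧ → Set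
  DominatedIn t f v = ∃ λ u → T (E ⟦ t ⟧ v u) × f u ≡ # 2

  RDF : (t : Tr X) → (V ⟦ t ⟧ → Fin 3) → Set
  RDF t f = ∀ v → f v ≡ # 0 → DominatedIn t f v

  Interior : (t : Tr X) → (V ⟦ t ⟧ → Fin 3) → Set
  Interior t f = ∀ v → ¬ T (isRoot t v) → f v ≡ # 0 → DominatedIn t f v

  root? : ∀ (t : Tr X) v → T (isRoot t v) ⊎ ¬ T (isRoot t v)
  root? t v with isRoot t v
  ... | true  = inj₁ tt
  ... | false = inj₂ λ ()

  T-root : ∀ (t : Tr X) → T (isRoot t (root t))
  T-root t = Equivalence.from T-≡ (isRoot-root t)

  interior⇒RDF : ∀ {t : Tr X} {f} → Interior t f → (f (root t) ≡ # 0 → DominatedIn t f (root t)) → RDF t f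
  interior⇒RDF {t} {f} int d v z with root? t v
  ... | inj₂ nr = int v nr z
  ... | inj₁ r with isRoot⇒root t v r
  ... | refl = d z

  module _ {t k : Tr X} {f : V ⟦ t ▸ k ⟧ → Fin 3} where
    private
      f₁ : V ⟦ t ⟧ → Fin 3
      f₁ = f ∘ inj₁
      f₂ : V ⟦ k ⟧ → Fin 3
      f₂ = f ∘ inj₂

    dominated-inj₁⁻ : ∀ {v} → DominatedIn (t ▸ k) f (inj₁ v) → DominatedIn t f₁ v ⊎ (T (isRoot t v) × f₂ (root k) ≡ # 2)
    dominated-inj₁⁻ (inj₁ u , e , p) = inj₁ (u , e , p)
    dominated-inj₁⁻ (inj₂ u , e , p) with Equivalence.to T-∧ e
    ... | r , r′ with isRoot⇒root k u r′
    ... | refl = inj₂ (r , p)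

    dominated-inj₂⁻ : ∀ {v} → DominatedIn (t ▸ k) f (inj₂ v) → DominatedIn k f₂ v ⊎ (T (isRoot k v) × f₁ (root t) ≡ # 2)
    dominated-inj₂⁻ (inj₂ u , e , p) = inj₁ (u , e , p)
    dominated-inj₂⁻ (inj₁ u , e , p) with Equivalence.to T-∧ e
    ... | r , r′ with isRoot⇒root t u r
    ... | refl = inj₂ (r′ , p)

    interior-▸⁻ : Interior (t ▸ k) f → Interior t f₁ × Interior k f₂ ×
      (f₂ (root k) ≡ # 0 → DominatedIn k f₂ (root k) ⊎ f₁ (root t) ≡ # 2)
    interior-▸⁻ int =
      (λ v nr z → [ (λ d → d) , (λ p → contradiction (proj₁ p) nr) ]′ (dominated-inj₁⁻ (int (inj₁ v) nr z))) ,
      (λ v nr z → [ (λ d → d) , (λ p → contradiction (proj₁ p) nr) ]′ (dominated-inj₂⁻ (int (inj₂ v) (λ ()) z))) ,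
      (λ z → [ inj₁ , inj₂ ∘ proj₂ ]′ (dominated-inj₂⁻ (int (inj₂ (root k)) (λ ()) z)))

    dominated-inj₁ : ∀ {v} → DominatedIn t f₁ v → DominatedIn (t ▸ k) f (inj₁ v)
    dominated-inj₁ (u , e , p) = inj₁ u , e , p

    dominated-inj₂ : ∀ {v} → DominatedIn k f₂ v → DominatedIn (t ▸ k) f (inj₂ v)
    dominated-inj₂ (u , e , p) = inj₂ u , e , p

    dominated-root : f₂ (root k) ≡ # 2 → DominatedIn (t ▸ k) f (inj₁ (root t))
    dominated-root p = inj₂ (root k) , Equivalence.from T-∧ (T-root t , T-root k) , p

    interior-▸ : Interior t f₁ → Interior k f₂ →
      (f₂ (root k) ≡ # 0 → DominatedIn k f₂ (root k) ⊎ f₁ (root t) ≡ # 2) → Interior (t ▸ k) f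
    interior-▸ int₁ int₂ r (inj₁ v) nr z = dominated-inj₁ (int₁ v nr z)
    interior-▸ int₁ int₂ r (inj₂ v) nr z with root? k v
    ... | inj₂ nr′ = dominated-inj₂ (int₂ v nr′ z)
    ... | inj₁ r′ with isRoot⇒root k v r′
    ... | refl with r z
    ... | inj₁ d = dominated-inj₂ d
    ... | inj₂ p = inj₁ (root t) , Equivalence.from T-∧ (T-root t , T-root k) , p

  -- Minimum weights of the functions on t dominating all vertices but possibly the root, with root value 0 for q
  -- and 2 for s; p is the minimum over Roman dominating functions with root value at most 1.
  mutual
    q p s : Tr X → ℕ
    q (leaf x) = 0
    q (t ▸ k)  = q t + (p k ⊓ s k)
    p (leaf x) = 1
    -- Either the root is taken care of within `t`, or it has value 0 and `k` is the child of value
    -- 2 dominating it.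
    p (t ▸ k)  = (p t + (p k ⊓ s k)) ⊓ (q t + s k)
    s (leaf x) = 2
    s (t ▸ k)  = s t + (q k ⊓ s k)

  -- A missing dominator of the root is replaced by the value 1 there. Hence root value 1 needs no
  -- number of its own: its minimum is `suc (q t)`.
  p≤1+q : ∀ t → p t ≤ suc (q t)
  p≤1+q (leaf x) = ℕ.≤-refl
  p≤1+q (t ▸ k)  = ℕ.≤-trans (ℕ.m⊓n≤m _ _) (ℕ.+-monoˡ-≤ _ (p≤1+q t))

  record Bounds (t : Tr X) (f : V ⟦ t ⟧ → Fin 3) : Set where
    field
      two   : f (root t) ≡ # 2 → s t ≤ wt t f
      one   : f (root t) ≡ # 1 → suc (q t) ≤ wt t f
      zero′ : f (root t) ≡ # 0 → q t ≤ wt t f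
      zero″ : f (root t) ≡ # 0 → DominatedIn t f (root t) → p t ≤ wt t f

    any-root : q t ⊓ s t ≤ wt t f
    any-root with f (root t) in e
    ... | zero           = ℕ.≤-trans (ℕ.m⊓n≤m _ _) (zero′ e)
    ... | suc zero       = ℕ.≤-trans (ℕ.m⊓n≤m _ _) (ℕ.≤-trans (ℕ.n≤1+n _) (one e))
    ... | suc (suc zero) = ℕ.≤-trans (ℕ.m⊓n≤n _ _) (two e)

    dominated-root⇒ : (f (root t) ≡ # 0 → DominatedIn t f (root t)) → p t ⊓ s t ≤ wt t f
    dominated-root⇒ d with f (root t) in e
    ... | zero           = ℕ.≤-trans (ℕ.m⊓n≤m _ _) (zero″ e (d refl))
    ... | suc zero       = ℕ.≤-trans (ℕ.m⊓n≤m _ _) (ℕ.≤-trans (p≤1+q t) (one e))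
    ... | suc (suc zero) = ℕ.≤-trans (ℕ.m⊓n≤n _ _) (two e)

  bounds : ∀ t f → Interior t f → Bounds t f
  bounds (leaf x) f int = record
    { two   = λ e → subst (λ c → 2 ≤ toℕ c) (sym e) ℕ.≤-refl
    ; one   = λ e → subst (λ c → 1 ≤ toℕ c) (sym e) ℕ.≤-refl
    ; zero′ = λ _ → z≤n
    ; zero″ = λ { _ (_ , () , _) } }
  bounds (t ▸ k) f int with interior-▸⁻ {t} {k} int
  ... | int₁ , int₂ , r = record
    { two   = λ e → ℕ.+-mono-≤ (b₁.two e) b₂.any-root
    ; one   = λ e → ℕ.+-mono-≤ (b₁.one e) (kid λ e′ → contradiction (trans (sym e) e′) λ ())
    ; zero′ = λ e → ℕ.+-mono-≤ (b₁.zero′ e) (kid λ e′ → contradiction (trans (sym e) e′) λ ())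
    ; zero″ = λ e d → [ (λ d₁ → ℕ.≤-trans (ℕ.m⊓n≤m _ _) (ℕ.+-mono-≤ (b₁.zero″ e d₁) (kid λ e′ → contradiction (trans (sym e) e′) λ ())))
                      , (λ p₂ → ℕ.≤-trans (ℕ.m⊓n≤n _ _) (ℕ.+-mono-≤ (b₁.zero′ e) (b₂.two (proj₂ p₂)))) ]′ (dominated-inj₁⁻ {t} {k} d) }
    where
    module b₁ = Bounds (bounds t (f ∘ inj₁) int₁)
    module b₂ = Bounds (bounds k (f ∘ inj₂) int₂)
    kid : f (inj₁ (root t)) ≢ # 2 → p k ⊓ s k ≤ wt k (f ∘ inj₂)
    kid ne = b₂.dominated-root⇒ λ z → [ (λ d → d) , (λ e → contradiction e ne) ]′ (r z)

  record Realised (t : Tr X) (w : ℕ) (P : (V ⟦ t ⟧ → Fin 3) → Set) : Set where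
    constructor realise
    field
      f        : V ⟦ t ⟧ → Fin 3
      interior : Interior t f
      weight≡  : wt t f ≡ w
      holds    : P f

  RootDominated : (t : Tr X) → (V ⟦ t ⟧ → Fin 3) → Set
  RootDominated t f = f (root t) ≡ # 0 → DominatedIn t f (root t)

  mutual
    realise-q : ∀ t → Realised t (q t) (λ f → f (root t) ≡ # 0)
    realise-q (leaf x) = realise (λ _ → # 0) (λ _ n → contradiction tt n) refl refl
    realise-q (t ▸ k) with realise-q t | realise-min k
    ... | realise f i w z | realise g j w′ d = realise [ f , g ]′ (interior-▸ i j (inj₁ ∘ d)) (cong₂ _+_ w w′) z

    realise-s : ∀ t → Realised t (s t) (λ f → f (root t) ≡ # 2)
    realise-s (leaf x) = realise (λ _ → # 2) (λ _ n → contradiction tt n) refl refl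
    realise-s (t ▸ k) with realise-s t | ℕ.⊓-sel (q k) (s k) | realise-q k | realise-s k
    ... | realise f i w z | inj₁ e | realise g j w′ _ | _ =
      realise [ f , g ]′ (interior-▸ i j (λ _ → inj₂ z)) (cong₂ _+_ w (trans w′ (sym e))) z
    ... | realise f i w z | inj₂ e | _ | realise g j w′ _ =
      realise [ f , g ]′ (interior-▸ i j (λ _ → inj₂ z)) (cong₂ _+_ w (trans w′ (sym e))) z

    realise-p : ∀ t → Realised t (p t) (RootDominated t)
    realise-p (leaf x) = realise (λ _ → # 1) (λ _ n → contradiction tt n) refl λ ()
    realise-p (t ▸ k) with ℕ.⊓-sel (p t + (p k ⊓ s k)) (q t + s k) | realise-p t | realise-min k | realise-q t | realise-s k
    ... | inj₁ e | realise f i w d | realise g j w′ d′ | _ | _ =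
      realise [ f , g ]′ (interior-▸ i j (inj₁ ∘ d′)) (trans (cong₂ _+_ w w′) (sym e)) (dominated-inj₁ ∘ d)
    ... | inj₂ e | _ | _ | realise f i w z | realise g j w′ z′ =
      realise [ f , g ]′ (interior-▸ i j (λ y → contradiction (trans (sym y) z′) λ ())) (trans (cong₂ _+_ w w′) (sym e))
        (λ _ → dominated-root {t} {k} z′)

    realise-min : ∀ t → Realised t (p t ⊓ s t) (RootDominated t)
    realise-min t with ℕ.⊓-sel (p t) (s t) | realise-p t | realise-s t
    ... | inj₁ e | realise f i w d | _ = realise f i (trans w (sym e)) d
    ... | inj₂ e | _ | realise f i w z = realise f i (trans w (sym e)) (λ y → contradiction (trans (sym y) z) λ ())

Represents : ∀ {n} → Adj n → Tr ⊤ → Set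
Represents {n} adj t = ⟦ t ⟧ ≅ graph (Fin n) adj (const tt)

module _ {n} {adj : Adj n} {t : Tr ⊤} (φ : Represents adj t) where
  open _≅_ φ

  weight-represents : ∀ f → weight f ≡ wt t (f ∘ to)
  weight-represents f = trans (weight-sum f) (trans
    (sum-permute (toℕ ∘ f) (permutation (to ∘ pos t) (index t ∘ from)
      (λ j → trans (cong to (pos-index t (from j))) (to∘from j))
      (λ i → trans (cong (index t) (from∘to (pos t i))) (index-pos t i))))
    (sym (wt-sum t (f ∘ to))))

  RDF-to : ∀ {f} → IsRDF adj f → RDF t (f ∘ to)
  RDF-to {f} rdf v z with rdf (to v) z
  ... | u , e , p = from u , subst T (trans (cong (adj (to v)) (sym (to∘from u))) (E-pres v (from u))) e ,
    trans (cong f (to∘from u)) p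

  RDF-from : ∀ {f} → RDF t f → IsRDF adj (f ∘ from)
  RDF-from {f} rdf v z with rdf (from v) z
  ... | u , e , p = to u , subst T (trans (sym (E-pres (from v) u)) (cong (λ w → adj w (to u)) (to∘from v))) e ,
    trans (cong f (from∘to u)) p

  min-weight : ∀ {f g} → IsγR adj f → RDF t g → weight f ≤ wt t g
  min-weight {f} {g} (_ , min) rdf = subst (weight f ≤_) eq (min (g ∘ from) (RDF-from rdf))
    where
    wt-cong : ∀ {X} (t : Tr X) {f g} → f ≗ g → wt t f ≡ wt t g
    wt-cong (leaf x) e = cong toℕ (e tt)
    wt-cong (t ▸ k)  e = cong₂ _+_ (wt-cong t (e ∘ inj₁)) (wt-cong k (e ∘ inj₂))
    eq : weight (g ∘ from) ≡ wt t g
    eq = trans (weight-represents (g ∘ from)) (wt-cong t (cong g ∘ from∘to))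

-- The message of a rooted tree t is (p t - q t , s t - q t), the second entry cut off below at 0:
-- tL = (1,2), tR = (1,1), tN₁ = (1,0), tQ = (0,2), tP = (0,1), tN₀ = (0,0).
data Ty : Set where
  tL tR tN₁ tQ tP tN₀ : Ty

ε δ′ : Ty → ℕ
ε tL  = 1
ε tR  = 1
ε tN₁ = 1
ε tQ  = 0
ε tP  = 0
ε tN₀ = 0
δ′ tL  = 2
δ′ tQ  = 2
δ′ tR  = 1
δ′ tP  = 1
δ′ tN₁ = 0
δ′ tN₀ = 0

-- The two effects of a child on its parent. `lose`: the child is one unit cheaper below a parent of
-- value 2, so the surcharge for that value drops by one. `dom`: the child can have value 2 at no
-- extra cost, so the parent is dominated for free. A child sending `tL` does the first, one sending
-- `tN₀` or `tN₁` the second, one sending `tR` both, one sending `tP` or `tQ` neither.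
lose dom : Ty → Ty
lose tL  = tR
lose tR  = tN₁
lose tN₁ = tN₁
lose tQ  = tP
lose tP  = tN₀
lose tN₀ = tN₀
dom tL  = tQ
dom tR  = tP
dom tN₁ = tN₀
dom tQ  = tQ
dom tP  = tP
dom tN₀ = tN₀

add : Ty → Ty → Ty
add x tL  = lose x
add x tR  = dom (lose x)
add x tN₁ = dom x
add x tQ  = x
add x tP  = x
add x tN₀ = dom x

lose-dom : ∀ x → lose (dom x) ≡ dom (lose x)
lose-dom tL  = refl
lose-dom tR  = refl
lose-dom tN₁ = refl
lose-dom tQ  = refl
lose-dom tP  = refl
lose-dom tN₀ = refl

add-dom : ∀ x y → add (dom x) y ≡ dom (add x y)
add-dom x tL  = lose-dom x
add-dom x tR  = cong dom (lose-dom x)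
add-dom x tN₁ = refl
add-dom x tQ  = refl
add-dom x tP  = refl
add-dom x tN₀ = refl

add-lose : ∀ x y → add (lose x) y ≡ lose (add x y)
add-lose x tL  = refl
add-lose x tR  = sym (lose-dom (lose x))
add-lose x tN₁ = sym (lose-dom x)
add-lose x tQ  = refl
add-lose x tP  = refl
add-lose x tN₀ = sym (lose-dom x)

-- Each message acts as a composite of `lose` and `dom`, and these commute; the subtrees at a vertex
-- can thus be absorbed in any order.
add-swap : ∀ x y z → add (add x y) z ≡ add (add x z) y
add-swap x tL  z = add-lose x z
add-swap x tR  z = trans (add-dom (lose x) z) (cong dom (add-lose x z))
add-swap x tN₁ z = add-dom x z
add-swap x tQ  z = refl
add-swap x tP  z = refl
add-swap x tN₀ z = add-dom x z

-- At difference zero only an inequality is kept: once `s ≤ q`, the minima of `s` with `p` and with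
-- `q` are both `s`, however much smaller it is. This truncation keeps the set of messages finite.
Near : ℕ → ℕ → ℕ → Set
Near zero    q s = s ≤ q
Near (suc d) q s = s ≡ suc d + q

record Shape (x : Ty) (q p s : ℕ) : Set where
  constructor shape
  field
    p≡   : p ≡ ε x + q
    near : Near (δ′ x) q s

near-≤ : ∀ d {q s} → Near d q s → s ≤ d + q
near-≤ zero    h = h
near-≤ (suc d) h = ℕ.≤-reflexive h

ε-lose : ∀ x → ε (lose x) ≡ ε x
ε-lose tL  = refl
ε-lose tR  = refl
ε-lose tN₁ = refl
ε-lose tQ  = refl
ε-lose tP  = refl
ε-lose tN₀ = refl

shape-lose : ∀ {x q p s} g → Shape x q p s → Shape (lose x) (q + suc g) (p + suc g) (s + g)
shape-lose {x} {q} {p} {s} g (shape p≡ h) = shape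
  (trans (cong (_+ suc g) (trans p≡ (cong (_+ q) (sym (ε-lose x))))) (ℕ.+-assoc (ε (lose x)) q (suc g)))
  (subst (λ d → Near d (q + suc g) (s + g)) (sym (δ-lose x)) (go (δ′ x) h))
  where
  δ-lose : ∀ x → δ′ (lose x) ≡ δ′ x ∸ 1
  δ-lose tL  = refl
  δ-lose tR  = refl
  δ-lose tN₁ = refl
  δ-lose tQ  = refl
  δ-lose tP  = refl
  δ-lose tN₀ = refl
  go : ∀ d {s} → Near d q s → Near (d ∸ 1) (q + suc g) (s + g)
  go zero          h    = ℕ.+-mono-≤ h (ℕ.n≤1+n g)
  go (suc zero)    refl = ℕ.≤-reflexive (sym (ℕ.+-suc q g))
  go (suc (suc d)) refl = cong suc (trans (cong suc (ℕ.+-assoc d q g)) (trans (sym (ℕ.+-suc d (q + g))) (cong (d +_) (sym (ℕ.+-suc q g)))))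

shape-dom : ∀ {x q p s} → Shape x q p s → Shape (dom x) q q s
shape-dom {tL}  (shape _ h) = shape refl h
shape-dom {tR}  (shape _ h) = shape refl h
shape-dom {tN₁} (shape _ h) = shape refl h
shape-dom {tQ}  (shape _ h) = shape refl h
shape-dom {tP}  (shape _ h) = shape refl h
shape-dom {tN₀} (shape _ h) = shape refl h

shape-add-0 : ∀ {x q p s} g → Shape x q p s → Shape x (q + g) (p + g) (s + g)
shape-add-0 {x} {q} {p} {s} g (shape p≡ h) = shape (trans (cong (_+ g) p≡) (ℕ.+-assoc (ε x) q g)) (go (δ′ x) h)
  where
  go : ∀ d {s} → Near d q s → Near d (q + g) (s + g)
  go zero    h    = ℕ.+-monoˡ-≤ g h
  go (suc d) refl = cong suc (ℕ.+-assoc d q g)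

q≤p : ∀ {x q p s} → Shape x q p s → q ≤ p
q≤p {x} {q} (shape refl _) = ℕ.m≤n+m q (ε x)

p≤1+q′ : ∀ {x q p s} → Shape x q p s → p ≤ suc q
p≤1+q′ {x} {q} (shape refl _) = ℕ.+-monoˡ-≤ q (ε≤1 x)
  where
  ε≤1 : ∀ x → ε x ≤ 1
  ε≤1 tL  = s≤s z≤n
  ε≤1 tR  = s≤s z≤n
  ε≤1 tN₁ = s≤s z≤n
  ε≤1 tQ  = z≤n
  ε≤1 tP  = z≤n
  ε≤1 tN₀ = z≤n

-- Let m = `p′ ⊓ s′`. If m < `s′`, having the root dominated by this child costs at least the one
-- unit for which it can be repaired anyway, as `p ≤ suc q`. If m = `s′`, the dominator is free and
-- the new `p` falls to the new `q`.
shape-add : ∀ {x y q p s q′ p′ s′} → Shape x q p s → Shape y q′ p′ s′ →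
  Shape (add x y) (q + (p′ ⊓ s′)) ((p + (p′ ⊓ s′)) ⊓ (q + s′)) (s + (q′ ⊓ s′))
shape-add {x} {y} {q} {p} {s} {q′} {p′} {s′} X Y = go y Y
  where
  undominated : ∀ {z m g} → m < s′ → Shape z (q + m) (p + m) (s + g) → Shape z (q + m) ((p + m) ⊓ (q + s′)) (s + g)
  undominated {m = m} {g} lt = subst (λ w → Shape _ (q + m) w (s + g)) (sym (ℕ.m≤n⇒m⊓n≡m
    (ℕ.≤-trans (ℕ.+-monoˡ-≤ m (p≤1+q′ X)) (subst (_≤ q + s′) (ℕ.+-suc q m) (ℕ.+-monoʳ-≤ q lt)))))

  dominated : ∀ {z m g} → s′ ≡ m → Shape z (q + m) (p + m) (s + g) → Shape (dom z) (q + m) ((p + m) ⊓ (q + s′)) (s + g)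
  dominated {m = m} {g} refl Z = subst (λ w → Shape _ (q + m) w (s + g)) (sym (ℕ.m≥n⇒m⊓n≡n (ℕ.+-monoˡ-≤ m (q≤p X)))) (shape-dom Z)

  values : ∀ {z} {m m′ g g′ : ℕ} → m ≡ m′ → g ≡ g′ →
    Shape z (q + m) ((p + m) ⊓ (q + s′)) (s + g) → Shape z (q + m′) ((p + m′) ⊓ (q + s′)) (s + g′)
  values refl refl Z = Z

  go : ∀ y → Shape y q′ p′ s′ → Shape (add x y) (q + (p′ ⊓ s′)) ((p + (p′ ⊓ s′)) ⊓ (q + s′)) (s + (q′ ⊓ s′))
  go tL  (shape refl refl) = values (sym (ℕ.m≤n⇒m⊓n≡m (ℕ.n≤1+n _))) (sym (ℕ.m≤n⇒m⊓n≡m (ℕ.m≤n+m q′ 2)))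
    (undominated ℕ.≤-refl (shape-lose q′ X))
  go tR  (shape refl refl) = values (sym (ℕ.⊓-idem _)) (sym (ℕ.m≤n⇒m⊓n≡m (ℕ.n≤1+n q′)))
    (dominated refl (shape-lose q′ X))
  go tN₁ (shape refl h)    = values (sym (ℕ.m≥n⇒m⊓n≡n (ℕ.≤-trans h (ℕ.n≤1+n q′)))) (sym (ℕ.m≥n⇒m⊓n≡n h))
    (dominated refl (shape-add-0 s′ X))
  go tQ  (shape refl refl) = values (sym (ℕ.m≤n⇒m⊓n≡m (ℕ.m≤n+m q′ 2))) (sym (ℕ.m≤n⇒m⊓n≡m (ℕ.m≤n+m q′ 2)))
    (undominated (ℕ.n≤1+n _) (shape-add-0 q′ X))
  go tP  (shape refl refl) = values (sym (ℕ.m≤n⇒m⊓n≡m (ℕ.n≤1+n q′))) (sym (ℕ.m≤n⇒m⊓n≡m (ℕ.n≤1+n q′)))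
    (undominated ℕ.≤-refl (shape-add-0 q′ X))
  go tN₀ (shape refl h)    = values (sym (ℕ.m≥n⇒m⊓n≡n h)) (sym (ℕ.m≥n⇒m⊓n≡n h))
    (dominated refl (shape-add-0 s′ X))

module _ {X : Set} where
  -- An initial state other than `tL` accounts for parts that meet the root of `t` from outside,
  -- such as the part containing its parent.
  fold : Ty → Tr X → Ty
  fold x (leaf _) = x
  fold x (t ▸ k)  = add (fold x t) (fold tL k)

  τ : Tr X → Ty
  τ = fold tL

  fold-add : ∀ x y (t : Tr X) → fold (add x y) t ≡ add (fold x t) y
  fold-add x y (leaf _) = refl
  fold-add x y (t ▸ k)  = trans (cong (λ z → add z (τ k)) (fold-add x y t)) (add-swap (fold x t) y (τ k))

  shape-τ : ∀ (t : Tr X) → Shape (τ t) (q t) (p t) (s t)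
  shape-τ (leaf _) = shape refl refl
  shape-τ (t ▸ k)  = shape-add (shape-τ t) (shape-τ k)

-- For an edge ab of a tree, the three alternatives are what is left of "some γR-function is nonzero at a"
-- in terms of the messages x, y of the two sides.
Half : Ty → Ty → Set
Half x y = δ′ x ≡ 0 ⊎ (δ′ x ≤ ε x + ε y × δ′ x ≤ δ′ y) ⊎ (1 ≤ ε x × suc (ε y) ≤ δ′ y)

half? : ∀ x y → Dec (Half x y)
half? x y = (δ′ x ≟ℕ 0) ⊎-dec (((δ′ x ≤? ε x + ε y) ×-dec (δ′ x ≤? δ′ y)) ⊎-dec ((1 ≤? ε x) ×-dec (suc (ε y) ≤? δ′ y)))

Ok : Ty → Ty → Set
Ok x y = True (half? x y) × True (half? y x)

-- The last hypothesis lists the cheapest ways to be nonzero at the first end: value 2 there and an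
-- end without need of a dominator on the other side, value 2 at both ends, value 1. Comparison with
-- `W ≤ p + p′` and `W ≤ q + s′` turns the first and the third into the second and third
-- alternatives of `Half`, and shows that the middle one forces `s ≤ q`.
half : ∀ {x y q p s q′ p′ s′ W} → Shape x q p s → Shape y q′ p′ s′ → W ≤ p + p′ → W ≤ q + s′ →
  s + q′ ≤ W ⊎ s + s′ ≤ W ⊎ suc (q + p′) ≤ W → Half x y
half {x} {y} {q} {p} {s} {q′} {p′} {s′} {W} (shape refl h) (shape refl h′) W≤pp W≤qs nz = go (δ′ x) h nz
  where
  open ℕ.≤-Reasoning
  go : ∀ d → Near d q s → s + q′ ≤ W ⊎ s + s′ ≤ W ⊎ suc (q + p′) ≤ W →
    d ≡ 0 ⊎ (d ≤ ε x + ε y × d ≤ δ′ y) ⊎ (1 ≤ ε x × suc (ε y) ≤ δ′ y)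
  go zero    _    _        = inj₁ refl
  go (suc d) refl (inj₁ a) = inj₂ (inj₁
    ( ℕ.+-cancelʳ-≤ (q + q′) _ _ (begin
        suc d + (q + q′)            ≡⟨ ℕ.+-assoc (suc d) q q′ ⟨
        suc d + q + q′              ≤⟨ ℕ.≤-trans a W≤pp ⟩
        ε x + q + (ε y + q′)        ≡⟨ ℕ.+-assoc (ε x) q _ ⟩
        ε x + (q + (ε y + q′))      ≡⟨ cong (ε x +_) (trans (sym (ℕ.+-assoc q (ε y) q′)) (trans (cong (_+ q′) (ℕ.+-comm q (ε y))) (ℕ.+-assoc (ε y) q q′))) ⟩
        ε x + (ε y + (q + q′))      ≡⟨ ℕ.+-assoc (ε x) (ε y) _ ⟨
        ε x + ε y + (q + q′)        ∎)
    , ℕ.+-cancelʳ-≤ (q + q′) _ _ (begin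
        suc d + (q + q′)            ≡⟨ ℕ.+-assoc (suc d) q q′ ⟨
        suc d + q + q′              ≤⟨ ℕ.≤-trans a W≤qs ⟩
        q + s′                      ≤⟨ ℕ.+-monoʳ-≤ q (near-≤ (δ′ y) h′) ⟩
        q + (δ′ y + q′)             ≡⟨ trans (sym (ℕ.+-assoc q (δ′ y) q′)) (trans (cong (_+ q′) (ℕ.+-comm q (δ′ y))) (ℕ.+-assoc (δ′ y) q q′)) ⟩
        δ′ y + (q + q′)             ∎)))
  go (suc d) refl (inj₂ (inj₁ b)) = contradiction (ℕ.+-cancelʳ-≤ s′ _ _ (ℕ.≤-trans b W≤qs)) (ℕ.<⇒≱ (s≤s (ℕ.m≤n+m q d)))
  go (suc d) refl (inj₂ (inj₂ c)) = inj₂ (inj₂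
    ( ℕ.+-cancelʳ-≤ q _ _ (ℕ.+-cancelʳ-≤ p′ _ _ (ℕ.≤-trans c W≤pp))
    , ℕ.+-cancelʳ-≤ q′ _ _ (ℕ.≤-trans (ℕ.+-cancelˡ-≤ q _ _ (subst (_≤ q + s′) (sym (ℕ.+-suc q p′)) (ℕ.≤-trans c W≤qs))) (near-≤ (δ′ y) h′))))

module _ {n} {adj : Adj n} (exc : Excellent adj) where
  -- Minimum functions on the two sides combine to competitors bounding the weight from above; the
  -- restrictions of a γR-function that is nonzero at an end bound it from below.
  edge-ok : ∀ a b → Represents adj (a ▸ b) → Ok (τ a) (τ b)
  edge-ok a b φ = fromWitness half-a , fromWitness half-b
    where
    open _≅_ φ
    module _ {f} (γ : IsγR adj f) where
      g₁ : V ⟦ a ⟧ → Fin 3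
      g₁ = f ∘ to ∘ inj₁
      g₂ : V ⟦ b ⟧ → Fin 3
      g₂ = f ∘ to ∘ inj₂
      rdf : RDF (a ▸ b) (f ∘ to)
      rdf = RDF-to {t = a ▸ b} φ (proj₁ γ)
      parts : Interior a g₁ × Interior b g₂ × (g₂ (root b) ≡ # 0 → DominatedIn b g₂ (root b) ⊎ g₁ (root a) ≡ # 2)
      parts = interior-▸⁻ {t = a} {b} (λ v _ → rdf v)
      module B₁ = Bounds (bounds a g₁ (proj₁ parts))
      module B₂ = Bounds (bounds b g₂ (proj₁ (proj₂ parts)))

      w≡ : weight f ≡ wt a g₁ + wt b g₂
      w≡ = weight-represents {t = a ▸ b} φ f

      root-a : g₁ (root a) ≡ # 0 → DominatedIn a g₁ (root a) ⊎ g₂ (root b) ≡ # 2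
      root-a z = [ inj₁ , inj₂ ∘ proj₂ ]′ (dominated-inj₁⁻ {t = a} {b} (rdf (inj₁ (root a)) z))

      least : ∀ {h h′ w w′} → Interior a h → Interior b h′ →
        (h′ (root b) ≡ # 0 → DominatedIn b h′ (root b) ⊎ h (root a) ≡ # 2) →
        (h (root a) ≡ # 0 → DominatedIn (a ▸ b) [ h , h′ ]′ (inj₁ (root a))) →
        wt a h ≡ w → wt b h′ ≡ w′ → weight f ≤ w + w′
      least {h} {h′} i i′ d′ d refl refl = min-weight {t = a ▸ b} φ {g = [ h , h′ ]′} γ
        (interior⇒RDF {t = a ▸ b} {[ h , h′ ]′} (interior-▸ {t = a} {b} i i′ d′) d)

      ≤pp : weight f ≤ p a + p b
      ≤pp with realise-p a | realise-p b
      ... | realise h i w d | realise h′ i′ w′ d′ = least i i′ (inj₁ ∘ d′) (dominated-inj₁ {t = a} {b} ∘ d) w w′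

      ≤sq : weight f ≤ s a + q b
      ≤sq with realise-s a | realise-q b
      ... | realise h i w z | realise h′ i′ w′ _ = least i i′ (λ _ → inj₂ z) (λ y → contradiction (trans (sym y) z) λ ()) w w′

      ≤qs : weight f ≤ q a + s b
      ≤qs with realise-q a | realise-s b
      ... | realise h i w _ | realise h′ i′ w′ z =
        least i i′ (λ y → contradiction (trans (sym y) z) λ ()) (λ _ → dominated-root {t = a} {b} z) w w′

    half-a : Half (τ a) (τ b)
    half-a with exc (to (inj₁ (root a)))
    ... | f , γ , f≢0 = half (shape-τ a) (shape-τ b) (≤pp γ) (≤qs γ) (go (g₁ γ (root a)) refl)
      where
      go : ∀ c → g₁ γ (root a) ≡ c → s a + q b ≤ weight f ⊎ s a + s b ≤ weight f ⊎ suc (q a + p b) ≤ weight f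
      go zero e = contradiction e f≢0
      go (suc zero) e with ℕ.⊓-sel (p b) (s b) | ℕ.+-mono-≤ (B₁.one γ e)
             (B₂.dominated-root⇒ γ λ z → [ (λ d → d) , (λ e′ → contradiction (trans (sym e) e′) λ ()) ]′ (proj₂ (proj₂ (parts γ)) z))
      ... | inj₁ m | h rewrite m = inj₂ (inj₂ (subst (_ ≤_) (sym (w≡ γ)) h))
      -- If value 2 is the better choice at the other end, it dominates the root of `a`, whose value
      -- 1 could have been 0.
      ... | inj₂ m | h rewrite m = contradiction (≤qs γ) (ℕ.<⇒≱ (subst (_ ≤_) (sym (w≡ γ)) h))
      go (suc (suc zero)) e with ℕ.⊓-sel (q b) (s b) | ℕ.+-mono-≤ (B₁.two γ e) (B₂.any-root γ)
      ... | inj₁ m | h rewrite m = inj₁ (subst (_ ≤_) (sym (w≡ γ)) h)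
      ... | inj₂ m | h rewrite m = inj₂ (inj₁ (subst (_ ≤_) (sym (w≡ γ)) h))

    half-b : Half (τ b) (τ a)
    half-b with exc (to (inj₂ (root b)))
    ... | f , γ , f≢0 = half (shape-τ b) (shape-τ a) (subst (weight f ≤_) (ℕ.+-comm (p a) (p b)) (≤pp γ))
        (subst (weight f ≤_) (ℕ.+-comm (s a) (q b)) (≤sq γ)) (go (g₂ γ (root b)) refl)
      where
      total : ∀ {x y} → x ≤ wt b (g₂ γ) → y ≤ wt a (g₁ γ) → x + y ≤ weight f
      total {x} {y} u v = subst (x + y ≤_) (trans (ℕ.+-comm (wt b (g₂ γ)) _) (sym (w≡ γ))) (ℕ.+-mono-≤ u v)
      go : ∀ c → g₂ γ (root b) ≡ c → s b + q a ≤ weight f ⊎ s b + s a ≤ weight f ⊎ suc (q b + p a) ≤ weight f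
      go zero e = contradiction e f≢0
      go (suc zero) e with ℕ.⊓-sel (p a) (s a) | total (B₂.one γ e)
             (B₁.dominated-root⇒ γ λ z → [ (λ d → d) , (λ e′ → contradiction (trans (sym e) e′) λ ()) ]′ (root-a γ z))
      ... | inj₁ m | h rewrite m = inj₂ (inj₂ h)
      ... | inj₂ m | h rewrite m = contradiction (subst (weight f ≤_) (ℕ.+-comm (s a) (q b)) (≤sq γ)) (ℕ.<⇒≱ h)
      go (suc (suc zero)) e with ℕ.⊓-sel (q a) (s a) | total (B₂.two γ e) (B₁.any-root γ)
      ... | inj₁ m | h rewrite m = inj₁ h
      ... | inj₂ m | h rewrite m = inj₂ (inj₁ h)

-- x is the state of the root before the subtrees of t are hung below it; the messages along all edges of t are
-- then as in an excellent tree.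
Down : ∀ {X} → Tr X → Ty → Set
Down (leaf _) x = ⊤
Down (t ▸ k)  x = Down t (add x (τ k)) × Ok (fold x t) (τ k) × Down k (add tL (fold x t))

-- Rerooting and reordering of subtrees

infix 4 _≅ʳ_ _∼_
record _≅ʳ_ {X : Set} (t t′ : Tr X) : Set where
  constructor rooted
  field
    unrooted  : ⟦ t ⟧ ≅ ⟦ t′ ⟧
    root-pres : ∀ v → isRoot t′ (_≅_.to unrooted v) ≡ isRoot t v
open _≅ʳ_

module _ {X : Set} where
  ≅ʳ-refl : {t : Tr X} → t ≅ʳ t
  ≅ʳ-refl = rooted ≅-refl λ _ → refl

  ≅ʳ-trans : {t u v : Tr X} → t ≅ʳ u → u ≅ʳ v → t ≅ʳ v
  ≅ʳ-trans (rooted φ e) (rooted ψ e′) = rooted (≅-trans φ ψ) λ v → trans (e′ (_≅_.to φ v)) (e v)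

  ≅ʳ-▸ : {t t′ k k′ : Tr X} → t ≅ʳ t′ → k ≅ʳ k′ → t ▸ k ≅ʳ t′ ▸ k′
  ≅ʳ-▸ (rooted φ e) (rooted ψ e′) = rooted (link-cong φ ψ e e′) λ { (inj₁ v) → e v ; (inj₂ v) → refl }

  ≅ʳ-swap : (t a b : Tr X) → t ▸ a ▸ b ≅ʳ t ▸ b ▸ a
  ≅ʳ-swap t a b = rooted (link-swap {G = ⟦ t ⟧}) λ { (inj₁ (inj₁ v)) → refl ; (inj₁ (inj₂ v)) → refl ; (inj₂ v) → refl }

  ▸-comm : (a b : Tr X) → ⟦ a ▸ b ⟧ ≅ ⟦ b ▸ a ⟧
  ▸-comm a b = link-comm {G = ⟦ a ⟧}

  infixl 6 _⊕_
  -- The root of `t` is merged into that of `c`. Moving subtrees across in this way makes any edge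
  -- of the tree an edge at the root of a suitable term.
  _⊕_ : Tr X → Tr X → Tr X
  c ⊕ leaf _  = c
  c ⊕ (t ▸ k) = (c ⊕ t) ▸ k

  ▸-⊕ : (c k t : Tr X) → (c ▸ k) ⊕ t ≅ʳ (c ⊕ t) ▸ k
  ▸-⊕ c k (leaf _) = ≅ʳ-refl
  ▸-⊕ c k (t ▸ j)  = ≅ʳ-trans (≅ʳ-▸ (▸-⊕ c k t) ≅ʳ-refl) (≅ʳ-swap (c ⊕ t) k j)

  τ-⊕ : (c t : Tr X) → τ (c ⊕ t) ≡ fold (τ c) t
  τ-⊕ c (leaf _) = refl
  τ-⊕ c (t ▸ k)  = cong (λ x → add x (τ k)) (τ-⊕ c t)

leaf-⊕ : (t : Tr ⊤) → leaf tt ⊕ t ≡ t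
leaf-⊕ (leaf tt) = refl
leaf-⊕ (t ▸ k)   = cong (_▸ k) (leaf-⊕ t)

-- `c` collects all parts at the current root that lie outside `t`, so its message is the state
-- required by `Down`. Every edge becomes the outermost one after rerooting, where `edge-ok`
-- applies.
down : ∀ {n} {adj : Adj n} → Excellent adj → ∀ c t → Represents adj (c ⊕ t) → Down t (τ c)
down exc c (leaf _) φ = tt
down exc c (t ▸ k)  φ =
  down exc (c ▸ k) t (≅-trans (unrooted (▸-⊕ c k t)) φ) ,
  subst (λ x → Ok x (τ k)) (τ-⊕ c t) (edge-ok exc (c ⊕ t) k φ) ,
  subst (λ x → Down k (add tL x)) (τ-⊕ c t)
    (down exc (leaf tt ▸ (c ⊕ t)) k (≅-trans (unrooted (▸-⊕ (leaf tt) (c ⊕ t) k))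
      (subst (λ u → Represents _ (u ▸ (c ⊕ t))) (sym (leaf-⊕ k)) (≅-trans (▸-comm k (c ⊕ t)) φ))))

-- Used for reorderings of subtrees only; the fields are the data that the growth needs to survive
-- them. `iso` goes from `t′` to `t` because a labelling is found for the reordered tree and carried
-- back.
record _∼_ (t t′ : Tr ⊤) : Set where
  field
    iso   : t′ ≅ʳ t
    order≡ : order t ≡ order t′
    fold≡ : ∀ x → fold x t ≡ fold x t′
    down⇒ : ∀ x → Down t x → Down t′ x

∼-refl : ∀ {t} → t ∼ t
∼-refl = record { iso = ≅ʳ-refl ; order≡ = refl ; fold≡ = λ _ → refl ; down⇒ = λ _ d → d }

∼-trans : ∀ {t u v} → t ∼ u → u ∼ v → t ∼ v
∼-trans a b = record
  { iso = ≅ʳ-trans b.iso a.iso ; order≡ = trans a.order≡ b.order≡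
  ; fold≡ = λ x → trans (a.fold≡ x) (b.fold≡ x) ; down⇒ = λ x → b.down⇒ x ∘ a.down⇒ x }
  where
  module a = _∼_ a
  module b = _∼_ b

∼-▸ : ∀ {t t′} k → t ∼ t′ → t ▸ k ∼ t′ ▸ k
∼-▸ {t} {t′} k a = record
  { iso = ≅ʳ-▸ iso ≅ʳ-refl ; order≡ = cong (_+ order k) order≡
  ; fold≡ = λ x → cong (λ y → add y (τ k)) (fold≡ x)
  ; down⇒ = λ { x (d , ok , d′) → down⇒ _ d , subst (λ y → Ok y (τ k)) (fold≡ x) ok ,
                                   subst (λ y → Down k (add tL y)) (fold≡ x) d′ } }
  where open _∼_ a

∼-swap : ∀ t a b → t ▸ a ▸ b ∼ t ▸ b ▸ a
∼-swap t a b = record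
  { iso = ≅ʳ-swap t b a
  ; order≡ = trans (ℕ.+-assoc (order t) _ _) (trans (cong (order t +_) (ℕ.+-comm (order a) _)) (sym (ℕ.+-assoc (order t) _ _)))
  ; fold≡ = λ x → add-swap (fold x t) (τ a) (τ b)
  ; down⇒ = λ { x ((d , oka , da) , okb , db) →
      ( subst (Down t) (add-swap x (τ b) (τ a)) d
      , subst (λ y → Ok y (τ b)) (sym (fold-add x (τ a) t)) okb
      , subst (λ y → Down b (add tL y)) (sym (fold-add x (τ a) t)) db)
      , subst (λ y → Ok y (τ a)) (fold-add x (τ b) t) oka
      , subst (λ y → Down a (add tL y)) (fold-add x (τ b) t) da } }

data AllKids (P : Ty → Set) : Tr ⊤ → Set where
  leaf : ∀ {x} → AllKids P (leaf x)
  _▸_  : ∀ {t k} → AllKids P t → P (τ k) → AllKids P (t ▸ k)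

Picked : (Ty → Set) → Tr ⊤ → Set
Picked P t = ∃ λ t′ → ∃ λ k → P (τ k) × t ∼ t′ ▸ k

pick : ∀ {P : Ty → Set} → (∀ x → Dec (P x)) → ∀ t → Picked P t ⊎ AllKids (¬_ ∘ P) t
pick P? (leaf _) = inj₂ leaf
pick P? (t ▸ k) with P? (τ k) | pick P? t
... | yes p | _                       = inj₁ (t , k , p , ∼-refl)
... | no _  | inj₁ (t′ , k′ , p , r) = inj₁ (t′ ▸ k , k′ , p , ∼-trans (∼-▸ k r) (∼-swap t′ k′ k))
... | no ¬p | inj₂ all                = inj₂ (all ▸ ¬p)

-- Growing labelled trees

record Fam (t : Tr Status) : Set where
  constructor fam
  field
    G     : LTree
    built : Built G
    iso   : ⌈ G ⌉ ≅ ⟦ t ⟧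

fam-≅ : ∀ {t t′} → ⟦ t ⟧ ≅ ⟦ t′ ⟧ → Fam t → Fam t′
fam-≅ φ (fam G b ψ) = fam G b (≅-trans ψ φ)

record Piece (K : LTree) (h : Fin (size K) → Bool) (k : Tr Status) : Set where
  constructor piece
  field
    iso  : ⌈ K ⌉ ≅ ⟦ k ⟧
    mark : ∀ j → isRoot k (_≅_.to iso j) ≡ h j

tree-check : ∀ K t p q → True (isIso? K (flat t) p q) → ⌈ K ⌉ ≅ ⟦ t ⟧
tree-check K t p q ok = ≅-trans (LIso⇒≅ (iso-check {K} {flat t} p q ok)) (flat≅ t)

piece-check : ∀ {K h k} p q → True (isIso? K (flat k) p q) →
  True (Fin.all? λ j → isRoot k (pos k (lookup p j)) ≟B h j) → Piece K h k
piece-check {K} {h} {k} p q ok mark = piece (tree-check K k p q ok) (toWitness mark)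

module _ {b : Set} {h : b → Bool} {v : b} where
  isPoint-dec : IsPoint h v → ∀ w → (w≟v : Dec (w ≡ v)) → h w ≡ ⌊ w≟v ⌋
  isPoint-dec (hv , _) w (yes refl) = Equivalence.to T-≡ hv
  isPoint-dec (_ , only) w (no w≢v) with h w in e
  ... | false = refl
  ... | true  = contradiction (only w (Equivalence.from T-≡ e)) w≢v

-- An operation may act at any vertex of a built tree. The context singles out this vertex as a leaf
-- of the labelled term, so each operation becomes the replacement of `leaf x` by `leaf x ▸ k`.
fam-hook : ∀ Γ {x k m b t h} → Piece (mk m b t) h k →
  (∀ {G} → Built G → ∀ u → lab G u ≡ x → Built (Hook.X G u b t h)) →
  Fam (plug Γ (leaf x)) → Fam (plug Γ (leaf x ▸ k))
fam-hook Γ {x} {k} {m} {b} {t} {h} (piece ψ mark) op (fam G built φ) =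
  fam (Hook.X G u b t h) (op built u (trans (trans (sym (ℓ-pres u)) (cong (ℓ ⟦ plug Γ (leaf x) ⟧) (to∘from v))) (ℓ-embed Γ (leaf x) tt)))
  (≅-trans (hook≅link G u b t h) (≅-trans (link-cong φ ψ at-v mark) (graft-leaf Γ x k)))
  where
  open _≅_ φ
  v : V ⟦ plug Γ (leaf x) ⟧
  v = embed Γ (leaf x) tt
  u : Fin (size G)
  u = from v
  point : IsPoint (lift Γ (leaf x) (const true) ∘ to) u
  point with isPoint-lift Γ (leaf x) {const true} {tt} (tt , λ _ _ → refl)
  ... | p , only = subst (T ∘ lift Γ (leaf x) (const true)) (sym (to∘from v)) p ,
    λ w q → trans (sym (from∘to w)) (cong from (only (to w) q))
  at-v : ∀ a → lift Γ (leaf x) (const true) (to a) ≡ ⌊ a ≟F u ⌋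
  at-v a = isPoint-dec point a (a ≟F u)

data Arm : Set where
  armA armD : Arm

data Arms : Set where
  AA AD DD : Arms

-- The two forms of a neighbour of a C-vertex, and the C-vertex with two such neighbours.
arm : Arm → Tr Status
arm armA = leaf A
arm armD = leaf D ▸ leaf D

pathC : Arms → Tr Status
pathC AA = leaf C ▸ arm armA ▸ arm armA
pathC AD = leaf C ▸ arm armA ▸ arm armD
pathC DD = leaf C ▸ arm armD ▸ arm armD

-- What is left of `H h3` to `H h7` after removal of an A-leaf, rooted at its C-neighbour: `x` is
-- the other arm of that vertex, and `pathC yz` is the path `F f1`, `F f2` or `F f3` around the
-- second C-vertex.
pieceC : Arm → Arms → Tr Status
pieceC x yz = leaf C ▸ arm x ▸ pathC yz

pieceB : Tr Status
pieceB = leaf B ▸ (leaf B ▸ leaf A)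

fam-DD : Fam (leaf D ▸ leaf D)
fam-DD = fam (H h1) (start h1 s1) (tree-check (H h1) (leaf D ▸ leaf D) (# 0 ∷ # 1 ∷ []) (# 0 ∷ # 1 ∷ []) _)

fam-C : ∀ Γ yz → Fam (plug Γ (leaf C)) → Fam (plug Γ (leaf C ▸ pathC yz))
fam-C Γ AA = fam-hook Γ (piece-check {F f1} (# 1 ∷ # 0 ∷ # 2 ∷ []) (# 1 ∷ # 0 ∷ # 2 ∷ []) _ _)
  λ b u e → op1 b u e f1 o1
fam-C Γ AD = fam-hook Γ (piece-check {F f2} (# 1 ∷ # 0 ∷ # 2 ∷ # 3 ∷ []) (# 1 ∷ # 0 ∷ # 2 ∷ # 3 ∷ []) _ _)
  λ b u e → op1 b u e f2 o2
fam-C Γ DD = fam-hook Γ (piece-check {F f3} (# 2 ∷ # 1 ∷ # 0 ∷ # 3 ∷ # 4 ∷ []) (# 2 ∷ # 1 ∷ # 0 ∷ # 3 ∷ # 4 ∷ []) _ _)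
  λ b u e → op1 b u e f3 o3

fam-D-C : ∀ Γ → Fam (plug Γ (leaf D)) → Fam (plug Γ (leaf D ▸ (leaf C ▸ arm armD)))
fam-D-C Γ = fam-hook Γ (piece-check {F f4} (# 0 ∷ # 1 ∷ # 2 ∷ []) (# 0 ∷ # 1 ∷ # 2 ∷ []) _ _)
  λ b u e → op2 b u e

fam-A-B : ∀ Γ → Fam (plug Γ (leaf A)) → Fam (plug Γ (leaf A ▸ pieceB))
fam-A-B Γ = fam-hook Γ (piece-check (# 0 ∷ # 1 ∷ # 2 ∷ []) (# 0 ∷ # 1 ∷ # 2 ∷ []) _ _)
  λ b u e → op3 b u e h2 k2 (# 0) refl

fam-A-C : ∀ Γ x yz → Fam (plug Γ (leaf A)) → Fam (plug Γ (leaf A ▸ pieceC x yz))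
fam-A-C Γ armA AA = fam-hook Γ (piece-check (# 0 ∷ # 2 ∷ # 1 ∷ # 3 ∷ # 4 ∷ []) (# 0 ∷ # 2 ∷ # 1 ∷ # 3 ∷ # 4 ∷ []) _ _)
  λ b u e → op3 b u e h3 k3 (# 2) refl
fam-A-C Γ armA AD = fam-hook Γ (piece-check (# 0 ∷ # 2 ∷ # 1 ∷ # 3 ∷ # 4 ∷ # 5 ∷ []) (# 0 ∷ # 2 ∷ # 1 ∷ # 3 ∷ # 4 ∷ # 5 ∷ []) _ _)
  λ b u e → op3 b u e h4 k4 (# 2) refl
fam-A-C Γ armA DD = fam-hook Γ
  (piece-check (# 0 ∷ # 2 ∷ # 1 ∷ # 3 ∷ # 4 ∷ # 5 ∷ # 6 ∷ []) (# 0 ∷ # 2 ∷ # 1 ∷ # 3 ∷ # 4 ∷ # 5 ∷ # 6 ∷ []) _ _)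
  λ b u e → op3 b u e h6 k6 (# 2) refl
fam-A-C Γ armD AA = fam-hook Γ (piece-check (# 3 ∷ # 0 ∷ # 4 ∷ # 5 ∷ # 1 ∷ # 2 ∷ []) (# 1 ∷ # 4 ∷ # 5 ∷ # 0 ∷ # 2 ∷ # 3 ∷ []) _ _)
  λ b u e → op3 b u e h4 k4 (# 4) refl
fam-A-C Γ armD AD = fam-hook Γ
  (piece-check (# 0 ∷ # 3 ∷ # 1 ∷ # 2 ∷ # 4 ∷ # 5 ∷ # 6 ∷ []) (# 0 ∷ # 2 ∷ # 3 ∷ # 1 ∷ # 4 ∷ # 5 ∷ # 6 ∷ []) _ _)
  λ b u e → op3 b u e h5 k5 (# 2) refl
fam-A-C Γ armD DD = fam-hook Γ
  (piece-check (# 0 ∷ # 3 ∷ # 1 ∷ # 2 ∷ # 4 ∷ # 5 ∷ # 6 ∷ # 7 ∷ []) (# 0 ∷ # 2 ∷ # 3 ∷ # 1 ∷ # 4 ∷ # 5 ∷ # 6 ∷ # 7 ∷ []) _ _)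
  λ b u e → op3 b u e h7 k7 (# 2) refl

fam-D-CA : ∀ Γ yz → Fam (plug Γ (leaf D)) → Fam (plug Γ (leaf D ▸ pieceC armA yz))
fam-D-CA Γ AA = fam-hook Γ (piece-check (# 0 ∷ # 2 ∷ # 1 ∷ # 3 ∷ # 4 ∷ []) (# 0 ∷ # 2 ∷ # 1 ∷ # 3 ∷ # 4 ∷ []) _ _)
  λ b u e → op4 b u e h3 k3 (# 2) refl
fam-D-CA Γ AD = fam-hook Γ (piece-check (# 0 ∷ # 2 ∷ # 1 ∷ # 3 ∷ # 4 ∷ # 5 ∷ []) (# 0 ∷ # 2 ∷ # 1 ∷ # 3 ∷ # 4 ∷ # 5 ∷ []) _ _)
  λ b u e → op4 b u e h4 k4 (# 2) refl
fam-D-CA Γ DD = fam-hook Γ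
  (piece-check (# 0 ∷ # 2 ∷ # 1 ∷ # 3 ∷ # 4 ∷ # 5 ∷ # 6 ∷ []) (# 0 ∷ # 2 ∷ # 1 ∷ # 3 ∷ # 4 ∷ # 5 ∷ # 6 ∷ []) _ _)
  λ b u e → op4 b u e h6 k6 (# 2) refl

fam-start-B : Fam (leaf A ▸ pieceB)
fam-start-B = fam (H h2) (start h2 s2) (tree-check (H h2) (leaf A ▸ pieceB) (# 0 ∷ # 1 ∷ # 2 ∷ # 3 ∷ []) (# 0 ∷ # 1 ∷ # 2 ∷ # 3 ∷ []) _)

-- H₆ and H₇ are not initial trees, but arise from H₁ by O₂ and O₁.
fam-DD-C : ∀ yz → Fam (leaf D ▸ (leaf C ▸ pathC yz ▸ arm armD) ▸ leaf D)
fam-DD-C yz = fam-C (inL (inR (leaf D) (inL □ (leaf D))) (arm armD)) yz (fam-D-C (inL □ (leaf D)) fam-DD)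

fam-start-C : ∀ x yz → Fam (leaf A ▸ pieceC x yz)
fam-start-C armA AA = fam (H h3) (start h3 s3) (tree-check (H h3) (leaf A ▸ pieceC armA AA)
  (# 1 ∷ # 3 ∷ # 0 ∷ # 2 ∷ # 4 ∷ # 5 ∷ []) (# 2 ∷ # 0 ∷ # 3 ∷ # 1 ∷ # 4 ∷ # 5 ∷ []) _)
fam-start-C armA AD = fam (H h4) (start h4 s4) (tree-check (H h4) (leaf A ▸ pieceC armA AD)
  (# 1 ∷ # 3 ∷ # 0 ∷ # 2 ∷ # 4 ∷ # 5 ∷ # 6 ∷ []) (# 2 ∷ # 0 ∷ # 3 ∷ # 1 ∷ # 4 ∷ # 5 ∷ # 6 ∷ []) _)
fam-start-C armA DD = fam-≅ {t} {leaf A ▸ pieceC armA DD} (≅-trans (≅-sym (flat≅ t)) (tree-check (flat t) (leaf A ▸ pieceC armA DD)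
  (# 4 ∷ # 3 ∷ # 1 ∷ # 0 ∷ # 2 ∷ # 6 ∷ # 7 ∷ # 5 ∷ []) (# 3 ∷ # 2 ∷ # 4 ∷ # 1 ∷ # 0 ∷ # 7 ∷ # 5 ∷ # 6 ∷ []) _)) (fam-DD-C AA)
  where
  t : Tr Status
  t = leaf D ▸ (leaf C ▸ pathC AA ▸ arm armD) ▸ leaf D
fam-start-C armD AA = fam (H h4) (start h4 s4) (tree-check (H h4) (leaf A ▸ pieceC armD AA)
  (# 4 ∷ # 1 ∷ # 5 ∷ # 6 ∷ # 0 ∷ # 2 ∷ # 3 ∷ []) (# 4 ∷ # 1 ∷ # 5 ∷ # 6 ∷ # 0 ∷ # 2 ∷ # 3 ∷ []) _)
fam-start-C armD AD = fam (H h5) (start h5 s5) (tree-check (H h5) (leaf A ▸ pieceC armD AD)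
  (# 1 ∷ # 4 ∷ # 0 ∷ # 2 ∷ # 3 ∷ # 5 ∷ # 6 ∷ # 7 ∷ []) (# 2 ∷ # 0 ∷ # 3 ∷ # 4 ∷ # 1 ∷ # 5 ∷ # 6 ∷ # 7 ∷ []) _)
fam-start-C armD DD = fam-≅ {t} {leaf A ▸ pieceC armD DD} (≅-trans (≅-sym (flat≅ t)) (tree-check (flat t) (leaf A ▸ pieceC armD DD)
  (# 5 ∷ # 4 ∷ # 1 ∷ # 0 ∷ # 2 ∷ # 3 ∷ # 7 ∷ # 8 ∷ # 6 ∷ []) (# 3 ∷ # 2 ∷ # 4 ∷ # 5 ∷ # 1 ∷ # 0 ∷ # 8 ∷ # 6 ∷ # 7 ∷ []) _)) (fam-DD-C AD)
  where
  t : Tr Status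
  t = leaf D ▸ (leaf C ▸ pathC AD ▸ arm armD) ▸ leaf D

-- What the messages force around a vertex

data IsN : Ty → Set where
  n₀ : IsN tN₀
  n₁ : IsN tN₁

-- A- and D-vertices as seen by a C-neighbour: an A-vertex sends `tL`; a D-vertex has absorbed the
-- `tL` of its D-neighbour and sends `tR`.
data IsArm : Arm → Ty → Set where
  isA : IsArm armA tL
  isD : IsArm armD tR

isN? : ∀ x → Dec (IsN x)
isN? tL  = no λ ()
isN? tR  = no λ ()
isN? tN₁ = yes n₁
isN? tQ  = no λ ()
isN? tP  = no λ ()
isN? tN₀ = yes n₀

isArm? : ∀ a x → Dec (IsArm a x)
isArm? armA tL  = yes isA
isArm? armA tR  = no λ ()
isArm? armA tN₁ = no λ ()
isArm? armA tQ  = no λ ()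
isArm? armA tP  = no λ ()
isArm? armA tN₀ = no λ ()
isArm? armD tL  = no λ ()
isArm? armD tR  = yes isD
isArm? armD tN₁ = no λ ()
isArm? armD tQ  = no λ ()
isArm? armD tP  = no λ ()
isArm? armD tN₀ = no λ ()

someArm? : ∀ x → Dec (∃ λ a → IsArm a x)
someArm? x with isArm? armA x | isArm? armD x
... | yes p | _     = yes (armA , p)
... | no _  | yes p = yes (armD , p)
... | no ¬p | no ¬q = no λ { (armA , p) → ¬p p ; (armD , q) → ¬q q }

lose≢tL : ∀ x → lose x ≢ tL
lose≢tL tL  ()
lose≢tL tR  ()
lose≢tL tN₁ ()
lose≢tL tQ  ()
lose≢tL tP  ()
lose≢tL tN₀ ()

ε-dom : ∀ x → ε (dom x) ≡ 0
ε-dom tL  = refl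
ε-dom tR  = refl
ε-dom tN₁ = refl
ε-dom tQ  = refl
ε-dom tP  = refl
ε-dom tN₀ = refl

δ-dom : ∀ x → δ′ (dom x) ≡ δ′ x
δ-dom tL  = refl
δ-dom tR  = refl
δ-dom tN₁ = refl
δ-dom tQ  = refl
δ-dom tP  = refl
δ-dom tN₀ = refl

lose≡tR : ∀ x → lose x ≡ tR → x ≡ tL
lose≡tR tL  _ = refl
lose≡tR tR  ()
lose≡tR tN₁ ()
lose≡tR tQ  ()
lose≡tR tP  ()
lose≡tR tN₀ ()

add-ε1 : ∀ x y → ε (add x y) ≡ 1 → (y ≡ tL × add x y ≡ lose x) ⊎ (add x y ≡ x × (y ≡ tP ⊎ y ≡ tQ))
add-ε1 x tL  e = inj₁ (refl , refl)
add-ε1 x tR  e = contradiction (trans (sym (ε-dom (lose x))) e) λ ()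
add-ε1 x tN₁ e = contradiction (trans (sym (ε-dom x)) e) λ ()
add-ε1 x tQ  e = inj₂ (refl , inj₂ refl)
add-ε1 x tP  e = inj₂ (refl , inj₁ refl)
add-ε1 x tN₀ e = contradiction (trans (sym (ε-dom x)) e) λ ()

add≡tL : ∀ x y → add x y ≡ tL → x ≡ tL × (y ≡ tP ⊎ y ≡ tQ)
add≡tL x y e with add-ε1 x y (cong ε e)
... | inj₁ (refl , f) = contradiction (trans (sym f) e) (lose≢tL x)
... | inj₂ (f , k)    = trans (sym f) e , k

add≡tR : ∀ x y → x ≢ tL → add x y ≡ tR → x ≡ tR × (y ≡ tP ⊎ y ≡ tQ)
add≡tR x y n e with add-ε1 x y (cong ε e)
... | inj₁ (refl , f) = contradiction (lose≡tR x (trans (sym f) e)) n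
... | inj₂ (f , k)    = trans (sym f) e , k

¬Ok-tQ : ∀ x → ¬ Ok x tQ
¬Ok-tQ tL  (_ , ())
¬Ok-tQ tR  (_ , ())
¬Ok-tQ tN₁ (_ , ())
¬Ok-tQ tQ  (_ , ())
¬Ok-tQ tP  (_ , ())
¬Ok-tQ tN₀ (_ , ())

PorQ : ∀ {x y} → Ok x y → y ≡ tP ⊎ y ≡ tQ → y ≡ tP
PorQ ok (inj₁ e)    = e
PorQ {x} ok (inj₂ refl) = contradiction ok (¬Ok-tQ x)

Ok-tN₀ : ∀ y → Ok tN₀ y → IsN y
Ok-tN₀ tL  (_ , ())
Ok-tN₀ tR  (_ , ())
Ok-tN₀ tN₁ _ = n₁
Ok-tN₀ tQ  (_ , ())
Ok-tN₀ tP  (_ , ())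
Ok-tN₀ tN₀ _ = n₀

Ok-N : ∀ x {y} → IsN y → Ok x y → IsN x
Ok-N tL  n₀ (() , _)
Ok-N tL  n₁ (() , _)
Ok-N tR  n₀ (() , _)
Ok-N tR  n₁ (() , _)
Ok-N tN₁ _  _ = n₁
Ok-N tQ  n₀ (() , _)
Ok-N tQ  n₁ (() , _)
Ok-N tP  n₀ (() , _)
Ok-N tP  n₁ (() , _)
Ok-N tN₀ _  _ = n₀

add-N : ∀ x {y} → IsN y → add x y ≡ dom x
add-N x n₀ = refl
add-N x n₁ = refl

add-tN₀ : ∀ y → add tN₀ y ≡ tN₀
add-tN₀ tL  = refl
add-tN₀ tR  = refl
add-tN₀ tN₁ = refl
add-tN₀ tQ  = refl
add-tN₀ tP  = refl
add-tN₀ tN₀ = refl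

add-tP : ∀ y → add tP y ≡ tP ⊎ add tP y ≡ tN₀
add-tP tL  = inj₂ refl
add-tP tR  = inj₂ refl
add-tP tN₁ = inj₁ refl
add-tP tQ  = inj₁ refl
add-tP tP  = inj₁ refl
add-tP tN₀ = inj₁ refl

fold-tN₀ : ∀ (t : Tr ⊤) → fold tN₀ t ≡ tN₀
fold-tN₀ (leaf _) = refl
fold-tN₀ (t ▸ k)  = trans (cong (λ x → add x (τ k)) (fold-tN₀ t)) (add-tN₀ (τ k))

fold-tP : ∀ (t : Tr ⊤) → fold tP t ≡ tP ⊎ fold tP t ≡ tN₀
fold-tP (leaf _) = inj₁ refl
fold-tP (t ▸ k) with fold-tP t
... | inj₁ e = subst (λ x → add x (τ k) ≡ tP ⊎ add x (τ k) ≡ tN₀) (sym e) (add-tP (τ k))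
... | inj₂ e = inj₂ (trans (cong (λ x → add x (τ k)) e) (add-tN₀ (τ k)))

-- The message sent towards an arm by a C-vertex.
towards-arm : ∀ (t : Tr ⊤) {a y} → IsArm a y → Ok (fold tP t) y → fold tP t ≡ tP
towards-arm t arm ok with fold tP t | fold-tP t
... | _ | inj₁ e = e
towards-arm t isA (_ , ()) | _ | inj₂ refl
towards-arm t isD (_ , ()) | _ | inj₂ refl

-- Only a child sending `tL` lowers the second entry of the message without clearing the first.
-- Without one, the message stays `tL` until some child dominates the root.
no-L : ∀ {t} → AllKids (¬_ ∘ IsArm armA) t → τ t ≡ tL ⊎ ε (τ t) ≡ 0
no-L leaf = inj₁ refl
no-L (_▸_ {t} {k} all ¬L) with no-L all
... | inj₂ e = inj₂ (ε-add (τ t) (τ k) e)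
  where
  ε-add : ∀ x y → ε x ≡ 0 → ε (add x y) ≡ 0
  ε-add x tL  e = trans (ε-lose x) e
  ε-add x tR  e = ε-dom (lose x)
  ε-add x tN₁ e = ε-dom x
  ε-add x tQ  e = e
  ε-add x tP  e = e
  ε-add x tN₀ e = ε-dom x
... | inj₁ e rewrite e with τ k
... | tL  = contradiction isA ¬L
... | tR  = inj₂ refl
... | tN₁ = inj₂ refl
... | tQ  = inj₁ refl
... | tP  = inj₁ refl
... | tN₀ = inj₂ refl

-- `dom` is applied only by children sending `tR`, `tN₀` or `tN₁`. Hence a vertex sending `tP` has a
-- child of one of these kinds.
no-dom : ∀ {t} → AllKids (¬_ ∘ IsArm armD) t → AllKids (¬_ ∘ IsN) t → ε (τ t) ≡ 1
no-dom leaf leaf = refl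
no-dom (_▸_ {t} {k} all ¬R) (all′ ▸ ¬N) with τ k
... | tL  = trans (ε-lose (τ t)) (no-dom all all′)
... | tR  = contradiction isD ¬R
... | tN₁ = contradiction n₁ ¬N
... | tQ  = no-dom all all′
... | tP  = no-dom all all′
... | tN₀ = contradiction n₀ ¬N

-- `lose` is applied only by children sending `tL` or `tR`, and nothing else changes `δ′`.
no-arm : ∀ {t} → AllKids (λ x → ¬ ∃ λ a → IsArm a x) t → δ′ (τ t) ≡ 2
no-arm leaf = refl
no-arm (_▸_ {t} {k} all ¬LR) with τ k
... | tL  = contradiction (armA , isA) ¬LR
... | tR  = contradiction (armD , isD) ¬LR
... | tN₁ = trans (δ-dom (τ t)) (no-arm all)
... | tQ  = no-arm all
... | tP  = no-arm all
... | tN₀ = trans (δ-dom (τ t)) (no-arm all)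

find-L : ∀ {t} → τ t ≡ tR → Picked (IsArm armA) t
find-L {t} e with pick (isArm? armA) t
... | inj₁ found = found
... | inj₂ all with no-L all
... | inj₁ e′ = contradiction (trans (sym e′) e) λ ()
... | inj₂ e′ = contradiction (trans (sym (cong ε e)) e′) λ ()

find-arm : ∀ {t} → δ′ (τ t) ≢ 2 → Picked (λ x → ∃ λ a → IsArm a x) t
find-arm {t} n with pick someArm? t
... | inj₁ found = found
... | inj₂ all   = contradiction (no-arm all) n

erase : Tr Status → Tr ⊤
erase (leaf _) = leaf tt
erase (t ▸ k)  = erase t ▸ erase k

-- The context is the part of the labelled tree outside the current subtree; its own unexpanded
-- vertices are still leaves, so the intermediate trees stay in the family.
record Grown (Γ : Context Status) (t : Tr ⊤) : Set where
  constructor grown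
  field
    {tree} : Tr Status
    erased : erase tree ≅ʳ t
    family : Fam (plug Γ tree)

grown-∼ : ∀ {Γ t t′} → t ∼ t′ → Grown Γ t′ → Grown Γ t
grown-∼ r (grown φ f) = grown (≅ʳ-trans φ (_∼_.iso r)) f

order≥1 : ∀ {X} (t : Tr X) → 1 ≤ order t
order≥1 (leaf _) = s≤s z≤n
order≥1 (t ▸ k)  = ℕ.≤-trans (order≥1 t) (ℕ.m≤m+n _ _)

<ˡ : ∀ {t k : Tr ⊤} {n} → order (t ▸ k) ≤ suc n → order t ≤ n
<ˡ {t} {k} h = s≤s⁻¹ (ℕ.≤-trans (subst (_≤ order t + order k) (ℕ.+-comm (order t) 1) (ℕ.+-monoʳ-≤ (order t) (order≥1 k))) h)

<ʳ : ∀ {t k : Tr ⊤} {n} → order (t ▸ k) ≤ suc n → order k ≤ n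
<ʳ {t} {k} h = s≤s⁻¹ (ℕ.≤-trans (ℕ.+-monoˡ-≤ (order k) (order≥1 t)) h)

≤ˡ : ∀ {t k : Tr ⊤} {n} → order (t ▸ k) ≤ n → order t ≤ n
≤ˡ {t} = ℕ.≤-trans (ℕ.m≤m+n (order t) _)

≤ʳ : ∀ {t k : Tr ⊤} {n} → order (t ▸ k) ≤ n → order k ≤ n
≤ʳ {t} = ℕ.≤-trans (ℕ.m≤n+m _ (order t))

order-∼ : ∀ {t t′ n} → t ∼ t′ → order t ≤ n → order t′ ≤ n
order-∼ r = subst (_≤ _) (_∼_.order≡ r)

-- A C-vertex with an arm x and a C-neighbour m.
record ArmAndC (a : Arm) (k : Tr ⊤) : Set where
  field
    {rest x m} : Tr ⊤
    similar    : k ∼ rest ▸ x ▸ m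
    x-arm      : IsArm a (τ x)
    m-N        : IsN (τ m)
    rest-down  : Down rest tN₀
    x-down     : Down x tL
    m-down     : Down m tQ


isArm-A : ∀ {x} → IsArm armA x → x ≡ tL
isArm-A isA = refl

isArm-D : ∀ {x} → IsArm armD x → x ≡ tR
isArm-D isD = refl

add-arm-tQ : ∀ {a x} → IsArm a x → add tQ x ≡ tP
add-arm-tQ isA = refl
add-arm-tQ isD = refl

add-arm-tP : ∀ {a x} → IsArm a x → add tP x ≡ tN₀
add-arm-tP isA = refl
add-arm-tP isD = refl

arm-down : ∀ (t : Tr ⊤) {a} {x : Tr ⊤} → IsArm a (τ x) → Ok (fold tP t) (τ x) → Down x (add tL (fold tP t)) → Down x tL
arm-down t {x = x} arm ok = subst (λ z → Down x (add tL z)) (towards-arm t arm ok)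

-- The hypothesis on `y` covers both states of a C-vertex, `tR` below an A-vertex and `tP` below a
-- D-vertex. The C-neighbour `m` turns either into `tP`, and the arm then into `tN₀`.
armAndC : ∀ {a y k rest x m} → dom y ≡ tP → Down k y → k ∼ rest ▸ x ▸ m → IsArm a (τ x) → IsN (τ m) → ArmAndC a k
armAndC {y = y} {rest = rest} {x} {m} y-P d r arm N with _∼_.down⇒ r y d
... | (dr , okx , dx) , okm , dm = record
  { similar = r ; x-arm = arm ; m-N = N
  ; rest-down = subst (Down rest) (trans (cong (λ z → add z (τ x)) add-m) (add-arm-tP arm)) dr
  ; x-down = arm-down rest arm (subst (λ z → Ok (fold z rest) (τ x)) add-m okx)
      (subst (λ z → Down x (add tL (fold z rest))) add-m dx)
  ; m-down = subst (Down m) (add-N tL (Ok-N _ N okm)) dm }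
  where
  add-m : add y (τ m) ≡ tP
  add-m = trans (add-N y N) y-P

-- A C-vertex with two arms y, z.
record Fork (b c : Arm) (k : Tr ⊤) : Set where
  field
    {rest y z} : Tr ⊤
    similar    : k ∼ rest ▸ y ▸ z
    y-arm      : IsArm b (τ y)
    z-arm      : IsArm c (τ z)
    rest-down  : Down rest tN₀
    y-down     : Down y tL
    z-down     : Down z tL

-- `tQ` is the state of a vertex that has absorbed one C-neighbour; the two arms lead from it
-- through `tP` to `tN₀`.
fork : ∀ {b c k rest y z} → Down k tQ → k ∼ rest ▸ y ▸ z → IsArm b (τ y) → IsArm c (τ z) → Fork b c k
fork {rest = rest} {y} {z} d r y-arm z-arm with _∼_.down⇒ r tQ d
... | (dr , oky , dy) , okz , dz = record
  { similar = r ; y-arm = y-arm ; z-arm = z-arm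
  ; rest-down = subst (Down rest) (trans (cong (λ w → add w (τ y)) (add-arm-tQ z-arm)) (add-arm-tP y-arm)) dr
  ; y-down = arm-down rest y-arm (subst (λ w → Ok (fold w rest) (τ y)) (add-arm-tQ z-arm) oky)
      (subst (λ w → Down y (add tL (fold w rest))) (add-arm-tQ z-arm) dy)
  ; z-down = arm-down rest z-arm (subst (λ w → Ok w (τ z)) state okz) (subst (λ w → Down z (add tL w)) state dz) }
  where
  state : add (fold tQ rest) (τ y) ≡ fold tP rest
  state = trans (sym (fold-add tQ (τ y) rest)) (cong (λ w → fold w rest) (add-arm-tQ y-arm))

N-δ≢2 : ∀ {x} → IsN x → δ′ x ≢ 2
N-δ≢2 n₀ ()
N-δ≢2 n₁ ()

-- One arm lowers `δ′` by one, from 2 to 1 only, while the messages between C-vertices have `δ′`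
-- equal to 0.
second-arm : ∀ x {a y} → IsArm a y → IsN (add x y) → δ′ x ≢ 2
second-arm tL  isA () _
second-arm tL  isD () _
second-arm tR  _ _ ()
second-arm tN₁ _ _ ()
second-arm tQ  isA () _
second-arm tQ  isD () _
second-arm tP  _ _ ()
second-arm tN₀ _ _ ()

find-fork : ∀ {k} → Down k tQ → IsN (τ k) → Fork armA armA k ⊎ Fork armA armD k ⊎ Fork armD armD k
find-fork {k} d N with find-arm (N-δ≢2 N)
... | k′ , z , (c , z-arm) , r with find-arm (second-arm (τ k′) z-arm (subst IsN (_∼_.fold≡ r tL) N))
... | rest , y , (b , y-arm) , r′ = go b c y-arm z-arm
  where
  r″ : k ∼ rest ▸ y ▸ z
  r″ = ∼-trans r (∼-▸ z r′)
  go : ∀ b c → IsArm b (τ y) → IsArm c (τ z) → Fork armA armA k ⊎ Fork armA armD k ⊎ Fork armD armD k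
  go armA armA i j = inj₁ (fork d r″ i j)
  go armA armD i j = inj₂ (inj₁ (fork d r″ i j))
  go armD armA i j = inj₂ (inj₁ (fork d (∼-trans r″ (∼-swap rest y z)) j i))
  go armD armD i j = inj₂ (inj₂ (fork d r″ i j))

fold-lose : ∀ (t : Tr ⊤) → fold tR t ≡ lose (τ t)
fold-lose t = fold-add tL tL t

order-parts : ∀ {k rest x y : Tr ⊤} {n} → k ∼ rest ▸ x ▸ y → order k ≤ n → order rest ≤ n × order x ≤ n × order y ≤ n
order-parts {k} {rest} {x} {y} r h =
  ≤ˡ {rest} {x} (≤ˡ {rest ▸ x} {y} h′) , ≤ʳ {rest} {x} (≤ˡ {rest ▸ x} {y} h′) , ≤ʳ {rest ▸ x} {y} h′
  where h′ = order-∼ r h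

arm-beside-N : ∀ {x y} → IsN y → add x y ≡ tP → δ′ x ≢ 2
arm-beside-N {x} N e δ2 = contradiction
  (trans (sym δ2) (trans (sym (δ-dom x)) (cong δ′ (trans (sym (add-N x N)) e)))) λ ()

-- The growth, by recursion on the order

mutual
  -- The recursion runs on the bound `n` of the order, since subtrees are reordered through `∼`
  -- before they are visited. The message `tL` is preserved only by children sending `tP` or `tQ`,
  -- and `Ok` excludes `tQ`; so `kidA` applies to every child.
  growA : ∀ n Γ t → order t ≤ n → Down t tL → τ t ≡ tL → Fam (plug Γ (leaf A)) → Grown Γ t
  growA n       Γ (leaf _) _ _ _ f = grown ≅ʳ-refl f
  growA zero    Γ (t ▸ k)  h _ _ f = contradiction (ℕ.≤-trans (order≥1 (t ▸ k)) h) λ ()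
  growA (suc n) Γ (t ▸ k)  h (dt , ok , dk) e f with add≡tL (τ t) (τ k) e
  ... | et , ek with PorQ ok ek
  ... | kP with kidA n (inR (leaf A) Γ) k (<ʳ {t} {k} h) (subst (λ y → Down k (add tL y)) et dk) kP
                  (fam-A-B Γ f) (λ x yz → fam-A-C Γ x yz f)
  ... | grown {k̂} φ fk with growA n (inL Γ k̂) t (<ˡ {t} {k} h) (subst (λ y → Down t (add tL y)) kP dt) et fk
  ... | grown ψ ft = grown (≅ʳ-▸ ψ φ) ft

  -- The D-neighbour lies outside `t` and is present only through the initial state `tR`; hence the
  -- condition on `fold tR t` and not on `τ t`.
  growD : ∀ n Γ t → order t ≤ n → Down t tR → fold tR t ≡ tR → Fam (plug Γ (leaf D)) → Grown Γ t
  growD n       Γ (leaf _) _ _ _ f = grown ≅ʳ-refl f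
  growD zero    Γ (t ▸ k)  h _ _ f = contradiction (ℕ.≤-trans (order≥1 (t ▸ k)) h) λ ()
  growD (suc n) Γ (t ▸ k)  h (dt , ok , dk) e f
    with add≡tR (fold tR t) (τ k) (λ z → lose≢tL (τ t) (trans (sym (fold-lose t)) z)) e
  ... | et , ek with PorQ ok ek
  ... | kP with kidD n (inR (leaf D) Γ) k (<ʳ {t} {k} h) (subst (λ y → Down k (add tL y)) et dk) kP
                  (fam-D-C Γ f) (λ yz → fam-D-CA Γ yz f)
  ... | grown {k̂} φ fk with growD n (inL Γ k̂) t (<ˡ {t} {k} h) (subst (λ y → Down t (add tR y)) kP dt) et fk
  ... | grown ψ ft = grown (≅ʳ-▸ ψ φ) ft

  -- In the state `tN₀` both arms are already accounted for, no child changes the state any more,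
  -- and only `tN₀` or `tN₁` may stand opposite to it. So all remaining children are C-vertices.
  growC : ∀ n Γ t → order t ≤ n → Down t tN₀ → Fam (plug Γ (leaf C)) → Grown Γ t
  growC n       Γ (leaf _) _ _ f = grown ≅ʳ-refl f
  growC zero    Γ (t ▸ k)  h _ f = contradiction (ℕ.≤-trans (order≥1 (t ▸ k)) h) λ ()
  growC (suc n) Γ (t ▸ k)  h (dt , ok , dk) f
    with kidN n (inR (leaf C) Γ) k (<ʳ {t} {k} h) (subst (λ y → Down k (add tL y)) (fold-tN₀ t) dk)
           (Ok-tN₀ (τ k) (subst (λ y → Ok y (τ k)) (fold-tN₀ t) ok)) (λ yz → fam-C Γ yz f)
  ... | grown {k̂} φ fk with growC n (inL Γ k̂) t (<ˡ {t} {k} h) (subst (Down t) (add-tN₀ (τ k)) dt) fk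
  ... | grown ψ ft = grown (≅ʳ-▸ ψ φ) ft

  growDD : ∀ n Γ t k → order t ≤ n → order k ≤ n → Down t tR → τ t ≡ tL → Down k tR → τ k ≡ tL →
    Fam (plug Γ (leaf D ▸ leaf D)) → Grown Γ (t ▸ k)
  growDD n Γ t k h h′ dt et dk ek f
    with growD n (inL Γ (leaf D)) t h dt (trans (fold-lose t) (cong lose et)) f
  ... | grown {t̂} ψ ft with growD n (inR t̂ Γ) k h′ dk (trans (fold-lose k) (cong lose ek)) ft
  ... | grown φ fk = grown (≅ʳ-▸ ψ φ) fk

  growArm : ∀ n Γ x a → IsArm a (τ x) → order x ≤ n → Down x tL → Fam (plug Γ (arm a)) → Grown Γ x
  growArm n Γ x armA arm h d f = growA n Γ x h d (isArm-A arm) f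
  growArm n Γ x armD arm h d f with find-L (isArm-D arm)
  ... | x′ , l , l-arm , r with _∼_.down⇒ r tL d
  ... | dx , _ , dl = grown-∼ r (growDD n Γ x′ l (≤ˡ {x′} {l} (order-∼ r h)) (≤ʳ {x′} {l} (order-∼ r h))
        (subst (λ y → Down x′ (add tL y)) l-L dx) x′-L (subst (λ y → Down l (add tL y)) x′-L dl) l-L f)
    where
    l-L : τ l ≡ tL
    l-L = isArm-A l-arm
    x′-L : τ x′ ≡ tL
    x′-L = lose≡tR (τ x′) (trans (sym (cong (add (τ x′)) l-L)) (trans (sym (_∼_.fold≡ r tL)) (isArm-D arm)))

  growFork : ∀ n Γ k {b c} → Fork b c k → order k ≤ n → Fam (plug Γ (leaf C ▸ arm b ▸ arm c)) → Grown Γ k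
  growFork n Γ k {b} {c} F h f with order-parts (Fork.similar F) h
  ... | h₁ , h₂ , h₃ with growArm n (inR (leaf C) (inL Γ (arm c))) (Fork.y F) b (Fork.y-arm F) h₂ (Fork.y-down F) f
  ... | grown {ŷ} φ fy with growArm n (inR (leaf C ▸ ŷ) Γ) (Fork.z F) c (Fork.z-arm F) h₃ (Fork.z-down F) fy
  ... | grown {ẑ} ψ fz with growC n (inL (inL Γ ẑ) ŷ) (Fork.rest F) h₁ (Fork.rest-down F) fz
  ... | grown χ fr = grown-∼ (Fork.similar F) (grown (≅ʳ-▸ (≅ʳ-▸ χ φ) ψ) fr)

  kidN : ∀ n Γ k → order k ≤ n → Down k tQ → IsN (τ k) → (∀ yz → Fam (plug Γ (pathC yz))) → Grown Γ k
  kidN n Γ k h d N f with find-fork d N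
  ... | inj₁ F        = growFork n Γ k F h (f AA)
  ... | inj₂ (inj₁ F) = growFork n Γ k F h (f AD)
  ... | inj₂ (inj₂ F) = growFork n Γ k F h (f DD)

  growArmC : ∀ n Γ k a → ArmAndC a k → order k ≤ n → (∀ yz → Fam (plug Γ (pieceC a yz))) → Grown Γ k
  growArmC n Γ k a Q h f with order-parts (ArmAndC.similar Q) h
  ... | h₁ , h₂ , h₃ with kidN n (inR (leaf C ▸ arm a) Γ) (ArmAndC.m Q) h₃ (ArmAndC.m-down Q) (ArmAndC.m-N Q) f
  ... | grown {m̂} φ fm with growArm n (inR (leaf C) (inL Γ m̂)) (ArmAndC.x Q) a (ArmAndC.x-arm Q) h₂ (ArmAndC.x-down Q) fm
  ... | grown {x̂} ψ fx with growC n (inL (inL Γ m̂) x̂) (ArmAndC.rest Q) h₁ (ArmAndC.rest-down Q) fx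
  ... | grown χ fr = grown-∼ (ArmAndC.similar Q) (grown (≅ʳ-▸ (≅ʳ-▸ χ ψ) φ) fr)

  -- The message `tP` requires something below that dominates `k`. If this is a C-neighbour, `k` is
  -- a C-vertex and the remaining arm is found. Otherwise it is a child `x` sending `tR`, which
  -- could be a D- or a B-vertex: with a further child, `k` is again a C-vertex; with none, `k` and
  -- `x` are the two B-vertices of a copy of `H h2`.
  kidA : ∀ n Γ k → order k ≤ n → Down k tR → τ k ≡ tP → Fam (plug Γ pieceB) →
    (∀ x yz → Fam (plug Γ (pieceC x yz))) → Grown Γ k
  kidA n Γ k h d e fB fC with pick isN? k
  ... | inj₁ (k′ , m , N , r) with find-arm {k′} (arm-beside-N N (trans (sym (_∼_.fold≡ r tL)) e))
  ... | rest , x , (a , x-arm) , r′ = growArmC n Γ k a (armAndC refl d (∼-trans r (∼-▸ m r′)) x-arm N) h (fC a)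
  kidA n Γ k h d e fB fC | inj₂ ¬N with pick (isArm? armD) k
  ... | inj₂ ¬R = contradiction (trans (sym (cong ε e)) (no-dom ¬R ¬N)) λ ()
  -- The state at the edge to `m` contains the outer A-vertex and `x`, which together give `tN₀`; so
  -- `m` must be a C-vertex.
  ... | inj₁ (k₁ ▸ m , x , x-arm , r) with _∼_.down⇒ r tR d
  ... | (_ , okm , _) , _ = growArmC n Γ k armD (armAndC refl d (∼-trans r (∼-swap k₁ m x)) x-arm
        (Ok-tN₀ (τ m) (subst (λ y → Ok y (τ m)) (trans (cong (λ y → fold (add tR y) k₁) (isArm-D x-arm)) (fold-tN₀ k₁)) okm))) h (fC armD)
  kidA n Γ k h d e fB fC | inj₂ ¬N | inj₁ (leaf _ , x , x-arm , r) with _∼_.down⇒ r tR d | find-L (isArm-D x-arm)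
  ... | _ , _ , dx | x′ , l , l-arm , r′ with _∼_.down⇒ r′ tP dx
  kidA n Γ k h d e fB fC | inj₂ ¬N | inj₁ (leaf _ , x , x-arm , r) | _ , _ , dx | leaf _ , l , l-arm , r′ | _ , okl , dl
    with growA n (inR (leaf B) (inR (leaf B) Γ)) l (≤ʳ {leaf tt} {l} (order-∼ r′ (≤ʳ {leaf tt} {x} (order-∼ r h)))) dl (isArm-A l-arm) fB
  ... | grown φ f = grown-∼ r (grown (≅ʳ-▸ ≅ʳ-refl (≅ʳ-trans (≅ʳ-▸ ≅ʳ-refl φ) (_∼_.iso r′))) f)
  -- A further child `m` of `x` would be opposite to `tN₀` and hence dominate `x`, whereas the
  -- message `tR` of `x` says that `x` is not dominated for free.
  kidA n Γ k h d e fB fC | inj₂ ¬N | inj₁ (leaf _ , x , x-arm , r) | _ , _ , dx | x″ ▸ m , l , l-arm , r′ | (_ , okm , _) , _ =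
    contradiction (trans (sym ε-x) (cong ε (isArm-D x-arm))) λ ()
    where
    m-N : IsN (τ m)
    m-N = Ok-tN₀ (τ m) (subst (λ y → Ok y (τ m)) (trans (cong (λ y → fold (add tP y) x″) (isArm-A l-arm)) (fold-tN₀ x″)) okm)
    ε-x : ε (τ x) ≡ 0
    ε-x = trans (cong ε (trans (_∼_.fold≡ r′ tL) (trans (cong (add (add (τ x″) (τ m))) (isArm-A l-arm)) (cong lose (add-N (τ x″) m-N)))))
      (trans (ε-lose (dom (τ x″))) (ε-dom (τ x″)))

  -- With a D-arm, `k` and this arm are added by `O₂`, whatever else is below `k`. Without one, a
  -- C-neighbour has to dominate `k`, and `k` comes with its A-arm and that neighbour by `O₄`.
  kidD : ∀ n Γ k → order k ≤ n → Down k tP → τ k ≡ tP → Fam (plug Γ (leaf C ▸ arm armD)) →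
    (∀ yz → Fam (plug Γ (pieceC armA yz))) → Grown Γ k
  kidD n Γ k h d e fD fC with pick (isArm? armD) k
  ... | inj₁ (k′ , x , x-arm , r) = growD-C n Γ k k′ x h d x-arm r fD
  ... | inj₂ ¬R with pick isN? k
  ... | inj₂ ¬N = contradiction (trans (sym (cong ε e)) (no-dom ¬R ¬N)) λ ()
  ... | inj₁ (k′ , m , N , r) with find-arm {k′} (arm-beside-N N (trans (sym (_∼_.fold≡ r tL)) e))
  ... | rest , x , (armA , x-arm) , r′ = growArmC n Γ k armA (armAndC refl d (∼-trans r (∼-▸ m r′)) x-arm N) h fC
  ... | rest , x , (armD , x-arm) , r′ =
    growD-C n Γ k (rest ▸ m) x h d x-arm (∼-trans r (∼-trans (∼-▸ m r′) (∼-swap rest x m))) fD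

  growD-C : ∀ n Γ k k′ x → order k ≤ n → Down k tP → IsArm armD (τ x) → k ∼ k′ ▸ x →
    Fam (plug Γ (leaf C ▸ arm armD)) → Grown Γ k
  growD-C n Γ k k′ x h d x-arm r fD with _∼_.down⇒ r tP d
  ... | dk , okx , dx with growArm n (inR (leaf C) Γ) x armD x-arm (≤ʳ {k′} {x} (order-∼ r h)) (arm-down k′ x-arm okx dx) fD
  ... | grown {x̂} φ fx with growC n (inL Γ x̂) k′ (≤ˡ {k′} {x} (order-∼ r h)) (subst (Down k′) (add-arm-tP x-arm) dk) fx
  ... | grown ψ fk = grown-∼ r (grown (≅ʳ-▸ ψ φ) fk)

-- Labelling an excellent tree

module _ {n} {adj : Adj n} (exc : Excellent adj) where
  Labelled : Set
  Labelled = Σ (Tr Status) λ t → Represents adj (erase t) × Fam t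

  down-root : ∀ t → Represents adj t → Down t tL
  down-root t φ = down exc (leaf tt) t (subst (Represents adj) (sym (leaf-⊕ t)) φ)

  represents-∼ : ∀ {t t′} → t ∼ t′ → Represents adj t → Represents adj t′
  represents-∼ r = ≅-trans (_≅ʳ_.unrooted (_∼_.iso r))

  from-grown : ∀ {t} → Represents adj t → Grown □ t → Labelled
  from-grown φ (grown {t̂} ψ f) = t̂ , ≅-trans (_≅ʳ_.unrooted ψ) φ , f

  reroot : ∀ a b → Represents adj (a ▸ b) → Represents adj (b ▸ a)
  reroot a b = ≅-trans (▸-comm b a)

  -- The partner of `tL` is `tL` or `tP`. In the first case the edge joins two D-vertices and the
  -- growth starts from `H h1`; in the second the root of `l` is an A-vertex, and the growth starts
  -- there after rerooting.
  label-L : ∀ c l → τ l ≡ tL → Represents adj (c ▸ l) → Labelled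
  label-L c l eL φ with down-root (c ▸ l) φ
  ... | dc , ok , dl = go (τ c) refl (subst (Ok (τ c)) eL ok)
    where
    go : ∀ x → τ c ≡ x → Ok x tL → Labelled
    go tL  e _ = from-grown φ (growDD _ □ c l (ℕ.m≤m⊔n _ _) (ℕ.m≤n⊔m _ _)
      (subst (λ y → Down c (add tL y)) eL dc) e (subst (λ y → Down l (add tL y)) e dl) eL fam-DD)
    go tR  e (_ , ())
    go tN₁ e (_ , ())
    go tQ  e (() , _)
    go tN₀ e (_ , ())
    go tP  e _ with down-root (l ▸ c) (reroot c l φ)
    ... | dl′ , _ , dc′ with kidA _ (inR (leaf A) □) c ℕ.≤-refl (subst (λ y → Down c (add tL y)) eL dc′) e fam-start-B fam-start-C
    ... | grown {ĉ} ψ fc with growA _ (inL □ ĉ) l ℕ.≤-refl (subst (λ y → Down l (add tL y)) e dl′) eL fc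
    ... | grown χ fl = from-grown (reroot c l φ) (grown (≅ʳ-▸ χ ψ) fl)

  label-R : ∀ c x → τ x ≡ tR → Represents adj (c ▸ x) → Labelled
  label-R c x eR φ with find-L eR
  ... | x′ , l , l-arm , r = label-L (x′ ▸ c) l (isArm-A l-arm)
    (represents-∼ (∼-trans (∼-▸ c r) (∼-swap x′ l c)) (reroot c x φ))

  label-arm : ∀ c x {a} → IsArm a (τ x) → Represents adj (c ▸ x) → Labelled
  label-arm c x {armA} i = label-L c x (isArm-A i)
  label-arm c x {armD} i = label-R c x (isArm-D i)

  -- Unless one side of the edge already sends `tL` or `tR`, both ends are C-vertices; then the
  -- first has an arm, and the edge to this arm is used instead.
  label : ∀ a b → Represents adj (a ▸ b) → Labelled
  label a b φ with ok-cases (τ a) (τ b) (proj₁ (proj₂ (down-root (a ▸ b) φ)))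
    where
    ok-cases : ∀ x y → Ok x y → (∃ λ a → IsArm a y) ⊎ (∃ λ a → IsArm a x) ⊎ IsN x
    ok-cases x   tL  _ = inj₁ (armA , isA)
    ok-cases x   tR  _ = inj₁ (armD , isD)
    ok-cases tL  y   _ = inj₂ (inj₁ (armA , isA))
    ok-cases tR  y   _ = inj₂ (inj₁ (armD , isD))
    ok-cases tN₁ y   _ = inj₂ (inj₂ n₁)
    ok-cases tN₀ y   _ = inj₂ (inj₂ n₀)
    ok-cases tP  tN₁ (() , _)
    ok-cases tP  tQ  (() , _)
    ok-cases tP  tP  (() , _)
    ok-cases tP  tN₀ (() , _)
    ok-cases tQ  tN₁ (() , _)
    ok-cases tQ  tQ  (() , _)
    ok-cases tQ  tP  (() , _)
    ok-cases tQ  tN₀ (() , _)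
  ... | inj₁ (_ , i)        = label-arm a b i φ
  ... | inj₂ (inj₁ (_ , i)) = label-arm b a i (reroot a b φ)
  ... | inj₂ (inj₂ N) with find-arm {a} (N-δ≢2 N)
  ... | a′ , x , (_ , i) , r = label-arm (a′ ▸ b) x i (represents-∼ (∼-trans (∼-▸ b r) (∼-swap a′ x b)) φ)

-- Every finite tree is a rooted term

data Path {A : Set} (R : A → A → Bool) : A → List A → A → Set where
  [_] : ∀ v → Path R v (v ∷ []) v
  _∷_ : ∀ {u w l v} → T (R u w) → Path R w l v → Path R u (u ∷ l) v

module _ {A : Set} {R : A → A → Bool} where
  path-++ : ∀ {u l v w l′ x} → Path R u l v → T (R v w) → Path R w l′ x → Path R u (l ++ₗ l′) x
  path-++ [ _ ]   e q = e ∷ q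
  path-++ (f ∷ p) e q = f ∷ path-++ p e q

  path-length : ∀ {u l v} → Path R u l v → u ≢ v → 2 ≤ length l
  path-length [ _ ]         n = contradiction refl n
  path-length (_ ∷ [ _ ])   n = s≤s (s≤s z≤n)
  path-length (_ ∷ (_ ∷ _)) n = s≤s (s≤s z≤n)

  path-linked : ∀ {u l v x y} → T (R x u) → Path R u l v → T (R v y) → Linked (λ a b → T (R a b)) (x ∷ l ++ₗ y ∷ [])
  path-linked d [ _ ]   e = d ∷ e ∷ [-]
  path-linked d (f ∷ p) e = d ∷ path-linked f p e

  path-map : ∀ {B : Set} {S : B → B → Bool} (f : A → B) → (∀ {u v} → T (R u v) → T (S (f u) (f v))) →
    ∀ {u l v} → Path R u l v → Path S (f u) (mapₗ f l) (f v)
  path-map f h [ v ]   = [ f v ]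
  path-map f h (e ∷ p) = h e ∷ path-map f h p

tree-path : ∀ (t : Tr ⊤) u v → ∃ λ l → Path (E ⟦ t ⟧) u l v × Unique l
tree-path (leaf _) tt tt = tt ∷ [] , [ tt ] , All.[] ∷ []
tree-path (t ▸ k) (inj₁ u) (inj₁ v) with tree-path t u v
... | l , p , un = mapₗ inj₁ l , path-map inj₁ (λ e → e) p , Unique.map⁺ inj₁-injective un
tree-path (t ▸ k) (inj₂ u) (inj₂ v) with tree-path k u v
... | l , p , un = mapₗ inj₂ l , path-map inj₂ (λ e → e) p , Unique.map⁺ inj₂-injective un
tree-path (t ▸ k) (inj₁ u) (inj₂ v) with tree-path t u (root t) | tree-path k (root k) v
... | l , p , un | l′ , p′ , un′ = _ ,
  path-++ (path-map inj₁ (λ e → e) p) (Equivalence.from T-≡ (cong₂ _∧_ (isRoot-root t) (isRoot-root k))) (path-map inj₂ (λ e → e) p′) ,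
  Unique.++⁺ (Unique.map⁺ inj₁-injective un) (Unique.map⁺ inj₂-injective un′) disjoint
  where
  disjoint : ∀ {x} → ¬ (x ∈ mapₗ inj₁ l × x ∈ mapₗ inj₂ l′)
  disjoint (a , b) with ∈-map⁻ inj₁ a | ∈-map⁻ inj₂ b
  ... | _ , _ , refl | _ , _ , ()
tree-path (t ▸ k) (inj₂ u) (inj₁ v) with tree-path k u (root k) | tree-path t (root t) v
... | l , p , un | l′ , p′ , un′ = _ ,
  path-++ (path-map inj₂ (λ e → e) p) (Equivalence.from T-≡ (cong₂ _∧_ (isRoot-root t) (isRoot-root k))) (path-map inj₁ (λ e → e) p′) ,
  Unique.++⁺ (Unique.map⁺ inj₂-injective un) (Unique.map⁺ inj₁-injective un′) disjoint
  where
  disjoint : ∀ {x} → ¬ (x ∈ mapₗ inj₂ l × x ∈ mapₗ inj₁ l′)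
  disjoint (a , b) with ∈-map⁻ inj₂ a | ∈-map⁻ inj₁ b
  ... | _ , _ , refl | _ , _ , ()

record Insertion (t : Tr ⊤) (p : V ⟦ t ⟧) : Set where
  constructor insertion
  field
    {h}    : Subset ⟦ t ⟧
    point  : IsPoint h p
    {tree} : Tr ⊤
    order≡ : order tree ≡ suc (order t)
    graft  : Grafted ⟦ leaf tt ⟧ (const true) t h tree

insert : ∀ t p → Insertion t p
insert (leaf tt) tt = insertion {h = const true} (tt , λ _ _ → refl) {leaf tt ▸ leaf tt} refl
  ((≅-refl {G = ⟦ leaf tt ▸ leaf tt ⟧}) , λ { (inj₁ _) → refl ; (inj₂ _) → refl })
insert (t ▸ k) (inj₁ p) with insert t p
... | insertion pt o g = insertion (isPoint-lift (inL □ k) t pt) (cong (_+ order k) o) (graft-plug _ _ (inL □ k) g)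
insert (t ▸ k) (inj₂ p) with insert k p
... | insertion pt o g = insertion (isPoint-lift (inR t □) k pt)
  (trans (cong (order t +_) o) (ℕ.+-suc (order t) (order k))) (graft-plug _ _ (inR t □) g)

record Embedded {n} (adj : Adj n) (G : Graph ⊤) : Set where
  field
    ι         : V G → Fin n
    injective : ∀ {u v} → ι u ≡ ι v → u ≡ v
    induced   : ∀ u v → adj (ι u) (ι v) ≡ E G u v

embedded-≅ : ∀ {n} {adj : Adj n} {G K} → G ≅ K → Embedded adj G → Embedded adj K
embedded-≅ φ e = record
  { ι = ι ∘ from
  ; injective = λ {u} {v} q → trans (sym (to∘from u)) (trans (cong to (injective q)) (to∘from v))
  ; induced = λ u v → trans (induced (from u) (from v)) (_≅_.E-pres (≅-sym φ) u v) }
  where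
  open _≅_ φ
  open Embedded e

module _ {n} {adj : Adj n} (simple : IsSimple adj) (acyclic : Acyclic adj) where
  embedded-order : ∀ {t} → Embedded adj ⟦ t ⟧ → order t ≤ n
  embedded-order {t} e = Fin.injective⇒≤ {f = ι ∘ pos t}
    (λ {i} {j} q → trans (sym (index-pos t i)) (trans (cong (index t) (injective q)) (index-pos t j)))
    where open Embedded e

  module _ {t} (e : Embedded adj ⟦ t ⟧) where
    open Embedded e

    -- A second edge from `y` into the embedded tree would close a cycle with the tree path between
    -- its two ends; so the enlarged tree is again induced.
    extend : ∀ p y → Edge adj (ι p) y → (∀ u → ι u ≢ y) → ∃ λ t′ → order t′ ≡ suc (order t) × Embedded adj ⟦ t′ ⟧
    extend p y py new with insert t p
    ... | insertion {h} (hp , only) o (φ , _) = _ , o , embedded-≅ φ record { ι = ι′ ; injective = injective′ ; induced = induced′ }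
      where
      ι′ : V ⟦ t ⟧ ⊎ ⊤ → Fin n
      ι′ = [ ι , const y ]′

      injective′ : ∀ {u v} → ι′ u ≡ ι′ v → u ≡ v
      injective′ {inj₁ u} {inj₁ v} q = cong inj₁ (injective q)
      injective′ {inj₁ u} {inj₂ v} q = contradiction q (new u)
      injective′ {inj₂ u} {inj₁ v} q = contradiction (sym q) (new v)
      injective′ {inj₂ u} {inj₂ v} q = refl

      cycle : ∀ u → u ≢ p → Edge adj (ι u) y → HasCycle adj
      cycle u u≢p uy with tree-path t p u
      ... | l , path , un = y , mapₗ ι l ,
        subst (2 ≤_) (sym (length-map ι l)) (path-length path (u≢p ∘ sym)) ,
        All.map⁺ (All.universal (λ v q → new v (sym q)) l) ∷ Unique.map⁺ injective un ,
        path-linked (subst T (proj₁ simple (ι p) y) py) (path-map ι (λ {a} {b} → subst T (sym (induced a b))) path) uy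

      adj-y : ∀ u → adj (ι u) y ≡ h u ∧ true
      adj-y u with h u in eh
      ... | true  = Equivalence.to T-≡ (subst (λ v → Edge adj (ι v) y) (sym (only u (Equivalence.from T-≡ eh))) py)
      ... | false with adj (ι u) y in ea
      ... | false = refl
      ... | true  = contradiction (cycle u u≢p (Equivalence.from T-≡ ea)) acyclic
        where
        u≢p : u ≢ p
        u≢p refl = contradiction (trans (sym eh) (Equivalence.to T-≡ hp)) λ ()

      induced′ : ∀ u v → adj (ι′ u) (ι′ v) ≡ linkE ⟦ t ⟧ h ⟦ leaf tt ⟧ (const true) u v
      induced′ (inj₁ u) (inj₁ v) = induced u v
      induced′ (inj₁ u) (inj₂ _) = adj-y u
      induced′ (inj₂ _) (inj₁ v) = trans (proj₁ simple y (ι v)) (adj-y v)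
      induced′ (inj₂ _) (inj₂ _) = proj₂ simple y

    Covered : Fin n → Set
    Covered v = ∃ λ i → ι (pos t i) ≡ v

    covered? : ∀ v → Dec (Covered v)
    covered? v = Fin.any? λ i → ι (pos t i) ≟F v

    exit : ∀ {u v} → Star (Edge adj) u v → Covered u → ¬ Covered v → ∃ λ p → ∃ λ y → Edge adj (ι p) y × ¬ Covered y
    exit nil c ¬c = contradiction c ¬c
    exit (_◅_ {j = w} uw path) (i , refl) ¬c with covered? w
    ... | yes c = exit path c ¬c
    ... | no ¬w = pos t i , w , uw , ¬w

    represents : (∀ v → Covered v) → Represents adj t
    represents cov = record
      { to = ι ; from = λ v → pos t (proj₁ (cov v)) ; from∘to = λ u → injective (proj₂ (cov (ι u)))
      ; to∘from = λ v → proj₂ (cov v) ; E-pres = induced ; ℓ-pres = λ _ → refl }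

  -- Each step adds one vertex at an edge leaving the covered set. The counter `m` bounds the
  -- vertices still missing; at 0 a further step would embed more than `n` vertices.
  spanning : Connected adj → ∀ m t → Embedded adj ⟦ t ⟧ → n ≤ order t + m → ∃ (Represents adj)
  spanning conn m t e bound with Fin.all? (covered? {t} e)
  ... | yes cov = t , represents {t} e cov
  ... | no ¬cov with Fin.¬∀⟶∃¬ n _ (covered? {t} e) ¬cov
  ... | v , ¬v with exit {t} e (conn (Embedded.ι e (root t)) v) (index t (root t) , cong (Embedded.ι e) (pos-index t (root t))) ¬v
  ... | p , y , py , ¬y with extend {t} e p y py (λ u q → ¬y (index t u , trans (cong (Embedded.ι e) (pos-index t u)) q))
  spanning conn zero t e bound | no _ | _ | _ | t′ , o , e′ =
    contradiction (ℕ.≤-trans (subst (_≤ n) o (embedded-order {t′} e′)) (subst (n ≤_) (ℕ.+-identityʳ (order t)) bound)) ℕ.1+n≰n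
  spanning conn (suc m) t e bound | no _ | _ | _ | t′ , o , e′ = spanning conn m t′ e′
    (subst (n ≤_) (trans (ℕ.+-suc (order t) m) (cong (_+ m) (sym o))) bound)

tree-represented : ∀ {n} {adj : Adj n} → IsTree adj → 2 ≤ n → ∃ λ a → ∃ λ b → Represents adj (a ▸ b)
tree-represented {suc (suc n)} {adj} (simple , conn , acyclic) (s≤s (s≤s z≤n)) =
  split-root (spanning simple acyclic conn (suc (suc n)) (leaf tt) single (ℕ.n≤1+n _))
  where
  single : Embedded adj ⟦ leaf tt ⟧
  single = record { ι = λ _ → zero ; injective = λ _ → refl ; induced = λ _ _ → proj₂ simple zero }

  split-root : ∃ (Represents adj) → ∃ λ a → ∃ λ b → Represents adj (a ▸ b)
  split-root (a ▸ b  , φ) = a , b , φ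
  split-root (leaf _ , φ) = contradiction (trans (sym (_≅_.to∘from φ zero)) (_≅_.to∘from φ (suc zero))) λ ()

-- From labelled terms to labellings of the given tree

strip : ∀ {X} → Graph X → Graph ⊤
strip G = graph (V G) (E G) (const tt)

strip-erase : ∀ t → Σ (strip ⟦ t ⟧ ≅ ⟦ erase t ⟧) λ φ → ∀ v → isRoot (erase t) (_≅_.to φ v) ≡ isRoot t v
strip-erase (leaf _) = ≅-refl , λ _ → refl
strip-erase (t ▸ k) with strip-erase t | strip-erase k
... | φ , e | ψ , e′ = ≅-trans strip-link (link-cong φ ψ e e′) , λ { (inj₁ v) → e v ; (inj₂ _) → refl }
  where
  strip-link : strip ⟦ t ▸ k ⟧ ≅ link (strip ⟦ t ⟧) (isRoot t) (strip ⟦ k ⟧) (isRoot k)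
  strip-link = record
    { to = λ v → v ; from = λ v → v ; from∘to = λ _ → refl ; to∘from = λ _ → refl
    ; E-pres = λ { (inj₁ _) (inj₁ _) → refl ; (inj₁ _) (inj₂ _) → refl ; (inj₂ _) (inj₁ _) → refl ; (inj₂ _) (inj₂ _) → refl }
    ; ℓ-pres = λ _ → refl }

labelled⇒InFam : ∀ {n} {adj : Adj n} (t : Tr Status) → Represents adj (erase t) → Fam t →
  Σ (Fin n → Status) λ S → InFam (mk n adj S)
labelled⇒InFam {n} {adj} t φ (fam G built ψ) = S , G , built , ≅⇒LIso (≅-trans ψ labelled)
  where
  θ : strip ⟦ t ⟧ ≅ graph (Fin n) adj (const tt)
  θ = ≅-trans (proj₁ (strip-erase t)) φ
  open _≅_ θ
  S : Fin n → Status
  S v = ℓ ⟦ t ⟧ (from v)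
  labelled : ⟦ t ⟧ ≅ ⌈ mk n adj S ⌉
  labelled = record
    { to = to ; from = from ; from∘to = from∘to ; to∘from = to∘from
    ; E-pres = E-pres ; ℓ-pres = λ u → cong (ℓ ⟦ t ⟧) (from∘to u) }

inFam-rigid : ∀ {G} → InFam G → ∃ (Rigid G)
inFam-rigid (K , built , φ) with built-rigid built
... | W , r = W , rigid-iso φ r

theorem2p1 : (n : ℕ) (adjT : Adj n) → IsTree adjT → 2 ≤ n →
    (Excellent adjT ⇔ Σ (Fin n → Status) (λ S → InFam (mk n adjT S)))
    × ((S : Fin n → Status) → InFam (mk n adjT S) →
    (∀ x → (S x ≡ B) ⇔ SB-set adjT x)
    × (∀ x → (S x ≡ A) ⇔ V01 adjT x)
    × (∀ x → (S x ≡ D) ⇔ V012 adjT x)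
    × (∀ x → (S x ≡ C) ⇔ (V02 adjT x × ¬ (S x ≡ B))))
theorem2p1 n adjT tree 2≤n = mk⇔ labelling (λ (_ , member) → Statuses.excellent (proj₂ (inFam-rigid member))) , statuses
  where
  labelling : Excellent adjT → Σ (Fin n → Status) (λ S → InFam (mk n adjT S))
  labelling exc =
    let a , b , φ = tree-represented tree 2≤n
        t , ψ , f = label exc a b φ
    in labelled⇒InFam t ψ f

  statuses : (S : Fin n → Status) → InFam (mk n adjT S) → _
  statuses S member = Statuses.B⇔SB r , Statuses.A⇔V01 r , Statuses.D⇔V012 r , Statuses.C⇔V02∖B r
    where r = proj₂ (inFam-rigid member)
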